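{- Let $R$ be a finite Frobenius ring, let $V=R^n$, and let $G$ be a finite permutation group on the coordinates of $V$. Let $H$ be a subgroup of $G$ with $t$ orbits on the coordinates such that $|H|$ has an inverse in $R$. Let $0\le d\le t$ and $f\in\mathrm{Harm}_d(t)$. Let $C$ be a left $G$-code of length $n$ over $R$. Then, for $D=C\theta_H$ and for $D=((C^{\perp})\theta_H)M_H$, one has $$W^{H}_{D,f}(x,y) = (xy)^d\, Z^{H}_{D,f}(x,y),$$ where $Z^{H}_{D,f}$ is a homogeneous polynomial of degree $t-2d$, and these polynomials satisfy $$Z^{H}_{((C^{\perp})\theta_H)M_H,\,f}(x,y) = (-1)^d\,\frac{|R|^d}{|C\theta_H|}\, Z^{H}_{C\theta_H,f}\bigl(x+(|R|-1)y,\;x-y\bigr),$$ where $M_H$ is the $H$-orbit length matrix.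
   Context: A finite (associative, unital) ring $R$ is Frobenius if $R/\mathrm{Rad}(R)\cong \mathrm{Soc}(R_R)$ as right $R$-modules and $R/\mathrm{Rad}(R)\cong\mathrm{Soc}({}_RR)$ as left $R$-modules. $R$ need not be commutative. On $V=R^n$ put $(u,v):=u_1v_1+\cdots+u_nv_n$. A permutation group $G$ on $\{1,\dots,n\}$ acts on $V$ on the right by $(vg)_i = v_{ig^{ -1}}$. A left $G$-code is a left $R$-submodule $C$ of $V$ with $Cg\subseteq C$ for all $g\in G$; its right dual is $C^{\perp}:=\{u\in V:(v,u)=0\text{ for all }v\in C\}$. "$|H|$ has an inverse in $R$" means $|H|\cdot 1_R$ is a unit. Define $v\theta_H:=\frac1{|H|}\sum_{h\in H}vh$ for $v\in V$ and $X\theta_H:=\{v\theta_H:v\in X\}$. Let $H_V(\alpha_1),\dots,H_V(\alpha_t)$ be the orbits of $H$ on $\{1,\dots,n\}$, $m_i$ the cardinality of $H_V(\alpha_i)$, and $\overline{H_V(\alpha_i)}\in V$ the vector with entry $1$ at the positions in $H_V(\alpha_i)$ and $0$ elsewhere. Every $u\in V\theta_H$ is uniquely $u=\sum_{i=1}^t u_i\overline{H_V(\alpha_i)}$ with $u_i\in R$; put $\mathrm{supp}_H(u):=\{i:u_i\neq0\}\subseteq[t]:=\{1,\dots,t\}$ and $\mathrm{wt}_H(u):=|\mathrm{supp}_H(u)|$. The $H$-orbit length matrix is $M_H:=\mathrm{diag}(\ell_1,\dots,\ell_n)$ with $\ell_j=m_i$ if $j\in H_V(\alpha_i)$; $YM_H:=\{yM_H:y\in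 Y\}$ for $Y\subseteq V$. Let $[t]_d$ be the set of $d$-element subsets of $[t]$ and $\mathbb{R}[t]_d$ the real vector space with basis $[t]_d$, an element being written $f=\sum_{z\in[t]_d}f(z)z$. Let $\gamma$ be the linear map $\mathbb{R}[t]_d\to\mathbb{R}[t]_{d-1}$ with $\gamma(z)=\sum_{y\in[t]_{d-1},\,y\subseteq z}y$ (zero if $d=0$), and $\mathrm{Harm}_d(t):=\ker(\gamma|_{\mathbb{R}[t]_d})$. For $f\in\mathbb{R}[t]_d$ and $u\in V\theta_H$ set $\widetilde f(u):=\sum f(\mathrm{supp}_H(v))$, summed over all $v\in V\theta_H$ with $\mathrm{wt}_H(v)=d$ and $\mathrm{supp}_H(v)\subseteq\mathrm{supp}_H(u)$. For a left or right $R$-submodule $D\subseteq V\theta_H$ and $f\in \mathrm{Harm}_d(t)$, the harmonic $H$-weight enumerator is $W^H_{D,f}(x,y):=\sum_{u\in D}\widetilde f(u)\,x^{t-\mathrm{wt}_H(u)}y^{\mathrm{wt}_H(u)}$. The zero polynomial is regarded as homogeneous of every degree. -}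

module Defs where

open import Algebra.Bundles using (Ring)
open import Algebra.Module.Bundles.Raw using (RawLeftModule; RawRightModule)
open import Algebra.Module.Morphism.Structures
  using (module LeftModuleMorphisms; module RightModuleMorphisms)
import Algebra.Definitions.RawMonoid as RawMonoidDefs
import Algebra.Properties.Ring as RingProperties
open import Data.Bool using (not)
open import Data.Fin using (Fin; finToFun; funToFin)
import Data.Fin.Properties as Fin
open import Data.Fin.Permutation using (Permutation′; _⟨$⟩ʳ_; _⟨$⟩ˡ_; _∘ₚ_; flip)
  renaming (id to idₚ; _≈_ to _≈ₚ_)
open import Data.Fin.Subset using (Subset; inside; outside; ∣_∣; ⁅_⁆)
  renaming (_∈_ to _∈ˢ_; _⊆_ to _⊆ˢ_; ⊤ to ⊤ˢ)
open import Data.Fin.Subset.Properties using (_⊆?_)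
open import Data.Integer as ℤ using (ℤ; +_)
open import Data.List using (List; []; _∷_; _++_; map; concatMap; cartesianProductWith;
  filter; foldr; length; tabulate)
open import Data.List.Properties using (filter-some)
open import Data.List.Relation.Unary.All using (All; []; _∷_)
import Data.List.Relation.Unary.All.Properties as All
open import Data.List.Relation.Unary.AllPairs using (AllPairs)
open import Data.List.Relation.Unary.Any using (Any; any?)
import Data.List.Relation.Unary.Any.Properties as Any
open import Data.Nat as ℕ using (ℕ; zero; suc; _^_; _∸_)
import Data.Nat.Properties as ℕ
open import Data.Product using (Σ; Σ-syntax; ∃; _×_; _,_; proj₁; proj₂)
open import Data.Rational as ℚ using (ℚ; 0ℚ; 1ℚ; Positive; NonNegative)
import Data.Rational.Properties as ℚ
open import Data.Rational.Solver using (module +-*-Solver)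
open import Data.Sum using (_⊎_)
open import Data.Unit using (⊤; tt)
import Data.Vec as Vec
open import Data.Vec.Functional using (Vector)
open import Function using (_∘_)
open import Function.Bundles using (Inverse)
open import Level using (Level; _⊔_; 0ℓ) renaming (suc to lsuc)
open import Relation.Binary.PropositionalEquality as ≡
  using (_≡_; _≢_; refl; cong; cong₂; subst)
open import Relation.Nullary using (¬_; Dec; yes; no; does)
open import Relation.Nullary.Decidable using (map′; _×-dec_; _→-dec_)
open import Relation.Unary using (Pred; Decidable)

-- The real numbers are represented by Cauchy sequences of rationals, compared with _≃_.

IsCauchy : (ℕ → ℚ) → Set
IsCauchy s = ∀ ε → .{{Positive ε}} →
  ∃ λ N → ∀ m n → N ℕ.≤ m → N ℕ.≤ n → ℚ.∣ s m ℚ.- s n ∣ ℚ.≤ ε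

record ℝ : Set where
  constructor mkℝ
  field
    seq    : ℕ → ℚ
    cauchy : IsCauchy seq

open ℝ

infix 4 _≃_

_≃_ : ℝ → ℝ → Set
x ≃ y = ∀ ε → .{{Positive ε}} →
  ∃ λ N → ∀ n → N ℕ.≤ n → ℚ.∣ seq x n ℚ.- seq y n ∣ ℚ.≤ ε

fromℚ : ℚ → ℝ
fromℚ p = mkℝ (λ _ → p) λ ε → 0 , λ _ _ _ _ →
  subst (ℚ._≤ ε) (≡.sym (cong ℚ.∣_∣ (ℚ.+-inverseʳ p))) (ℚ.<⇒≤ (ℚ.positive⁻¹ ε))

0ℝ 1ℝ -1ℝ : ℝ
0ℝ  = fromℚ 0ℚ
1ℝ  = fromℚ 1ℚ
-1ℝ = fromℚ (ℚ.- 1ℚ)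

private
  open ℚ.≤-Reasoning
  open +-*-Solver using (solve; _:+_; _:*_; _:-_; _:=_)

  ∣+-∣-bound : ∀ a b c d →
    ℚ.∣ (a ℚ.+ b) ℚ.- (c ℚ.+ d) ∣ ℚ.≤ ℚ.∣ a ℚ.- c ∣ ℚ.+ ℚ.∣ b ℚ.- d ∣
  ∣+-∣-bound a b c d = begin
    ℚ.∣ (a ℚ.+ b) ℚ.- (c ℚ.+ d) ∣  ≡⟨ cong ℚ.∣_∣ (solve 4
      (λ a b c d → (a :+ b) :- (c :+ d) := (a :- c) :+ (b :- d)) refl a b c d) ⟩
    ℚ.∣ (a ℚ.- c) ℚ.+ (b ℚ.- d) ∣  ≤⟨ ℚ.∣p+q∣≤∣p∣+∣q∣ (a ℚ.- c) (b ℚ.- d) ⟩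
    ℚ.∣ a ℚ.- c ∣ ℚ.+ ℚ.∣ b ℚ.- d ∣  ∎

  ∣*-∣-bound : ∀ a b c d →
    ℚ.∣ a ℚ.* b ℚ.- c ℚ.* d ∣ ℚ.≤ ℚ.∣ a ∣ ℚ.* ℚ.∣ b ℚ.- d ∣ ℚ.+ ℚ.∣ d ∣ ℚ.* ℚ.∣ a ℚ.- c ∣
  ∣*-∣-bound a b c d = begin
    ℚ.∣ a ℚ.* b ℚ.- c ℚ.* d ∣  ≡⟨ cong ℚ.∣_∣ (solve 4
      (λ a b c d → a :* b :- c :* d := a :* (b :- d) :+ d :* (a :- c)) refl a b c d) ⟩
    ℚ.∣ a ℚ.* (b ℚ.- d) ℚ.+ d ℚ.* (a ℚ.- c) ∣
      ≤⟨ ℚ.∣p+q∣≤∣p∣+∣q∣ (a ℚ.* (b ℚ.- d)) (d ℚ.* (a ℚ.- c)) ⟩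
    ℚ.∣ a ℚ.* (b ℚ.- d) ∣ ℚ.+ ℚ.∣ d ℚ.* (a ℚ.- c) ∣
      ≡⟨ cong₂ ℚ._+_ (ℚ.∣p*q∣≡∣p∣*∣q∣ a (b ℚ.- d)) (ℚ.∣p*q∣≡∣p∣*∣q∣ d (a ℚ.- c)) ⟩
    ℚ.∣ a ∣ ℚ.* ℚ.∣ b ℚ.- d ∣ ℚ.+ ℚ.∣ d ∣ ℚ.* ℚ.∣ a ℚ.- c ∣  ∎

  ∣∣-bound : ∀ a b → ℚ.∣ a ∣ ℚ.≤ ℚ.∣ b ∣ ℚ.+ ℚ.∣ a ℚ.- b ∣
  ∣∣-bound a b = begin
    ℚ.∣ a ∣  ≡⟨ cong ℚ.∣_∣ (solve 2 (λ a b → a := b :+ (a :- b)) refl a b) ⟩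
    ℚ.∣ b ℚ.+ (a ℚ.- b) ∣  ≤⟨ ℚ.∣p+q∣≤∣p∣+∣q∣ b (a ℚ.- b) ⟩
    ℚ.∣ b ∣ ℚ.+ ℚ.∣ a ℚ.- b ∣  ∎

  *-mono-≤-nonNeg : ∀ {a b c d} → NonNegative c → NonNegative b →
    a ℚ.≤ b → c ℚ.≤ d → a ℚ.* c ℚ.≤ b ℚ.* d
  *-mono-≤-nonNeg {b = b} {c = c} c≥0 b≥0 a≤b c≤d =
    ℚ.≤-trans (ℚ.*-monoʳ-≤-nonNeg c {{c≥0}} a≤b) (ℚ.*-monoˡ-≤-nonNeg b {{b≥0}} c≤d)

  -- A positive δ with (A + B) δ = ε.
  divide : ∀ A B → Positive A → Positive B → ∀ ε → Positive ε →
    Σ[ δ ∈ ℚ ] Positive δ × A ℚ.* δ ℚ.+ B ℚ.* δ ≡ ε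
  divide A B A>0 B>0 ε ε>0 = δ , δ>0 , ≡.trans (≡.sym (ℚ.*-distribʳ-+ δ A B))
    (≡.trans (≡.sym (ℚ.*-assoc S (ℚ.1/ S) ε))
    (≡.trans (cong (ℚ._* ε) (ℚ.*-inverseʳ S)) (ℚ.*-identityˡ ε)))
    where
    S = A ℚ.+ B
    instance
      S-pos : Positive S
      S-pos = ℚ.pos+pos⇒pos A {{A>0}} B {{B>0}}
      S-nonZero : ℚ.NonZero S
      S-nonZero = ℚ.pos⇒nonZero S
    δ = ℚ.1/ S ℚ.* ε
    δ>0 : Positive δ
    δ>0 = ℚ.pos*pos⇒pos (ℚ.1/ S) {{ℚ.1/pos⇒pos S}} ε {{ε>0}}

  +-cauchy : ∀ s r → IsCauchy s → IsCauchy r → IsCauchy (λ n → s n ℚ.+ r n)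
  +-cauchy s r s-c r-c ε {{ε>0}} =
    let δ , δ>0 , δ+δ≡ε = divide 1ℚ 1ℚ _ _ ε (ℚ.positive (ℚ.positive⁻¹ ε {{ε>0}}))
        Ns , p = s-c δ {{δ>0}}
        Nr , q = r-c δ {{δ>0}}
    in Ns ℕ.⊔ Nr , λ m n N≤m N≤n →
      ℚ.≤-trans (∣+-∣-bound (s m) (r m) (s n) (r n))
      (ℚ.≤-trans (ℚ.+-mono-≤
        (p m n (ℕ.m⊔n≤o⇒m≤o Ns Nr N≤m) (ℕ.m⊔n≤o⇒m≤o Ns Nr N≤n))
        (q m n (ℕ.m⊔n≤o⇒n≤o Ns Nr N≤m) (ℕ.m⊔n≤o⇒n≤o Ns Nr N≤n)))
      (ℚ.≤-reflexive (≡.trans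
        (≡.sym (cong₂ ℚ._+_ (ℚ.*-identityˡ δ) (ℚ.*-identityˡ δ))) δ+δ≡ε)))

  eventualBound : ∀ s → IsCauchy s →
    Σ[ B ∈ ℚ ] Positive B × ∃ λ N → ∀ n → N ℕ.≤ n → ℚ.∣ s n ∣ ℚ.≤ B
  eventualBound s s-c =
    let N , p = s-c 1ℚ
    in ℚ.∣ s N ∣ ℚ.+ 1ℚ
     , ℚ.nonNeg+pos⇒pos ℚ.∣ s N ∣ {{ℚ.∣-∣-nonNeg (s N)}} 1ℚ
     , N , λ n N≤n → ℚ.≤-trans (∣∣-bound (s n) (s N))
         (ℚ.+-monoʳ-≤ ℚ.∣ s N ∣ (p n N N≤n ℕ.≤-refl))

  *-cauchy : ∀ s r → IsCauchy s → IsCauchy r → IsCauchy (λ n → s n ℚ.* r n)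
  *-cauchy s r s-c r-c ε {{ε>0}} =
    let A , A>0 , Ms , s≤A = eventualBound s s-c
        B , B>0 , Mr , r≤B = eventualBound r r-c
        δ , δ>0 , Aδ+Bδ≡ε = divide A B A>0 B>0 ε (ℚ.positive (ℚ.positive⁻¹ ε {{ε>0}}))
        Ns , p = s-c δ {{δ>0}}
        Nr , q = r-c δ {{δ>0}}
        M≤ : ∀ {k} → (Ms ℕ.⊔ Mr) ℕ.⊔ (Ns ℕ.⊔ Nr) ℕ.≤ k → Ms ℕ.⊔ Mr ℕ.≤ k
        M≤ = ℕ.m⊔n≤o⇒m≤o (Ms ℕ.⊔ Mr) (Ns ℕ.⊔ Nr)
        N≤ : ∀ {k} → (Ms ℕ.⊔ Mr) ℕ.⊔ (Ns ℕ.⊔ Nr) ℕ.≤ k → Ns ℕ.⊔ Nr ℕ.≤ k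
        N≤ = ℕ.m⊔n≤o⇒n≤o (Ms ℕ.⊔ Mr) (Ns ℕ.⊔ Nr)
    in (Ms ℕ.⊔ Mr) ℕ.⊔ (Ns ℕ.⊔ Nr) , λ m n h k →
      ℚ.≤-trans (∣*-∣-bound (s m) (r m) (s n) (r n))
      (ℚ.≤-trans (ℚ.+-mono-≤
        (*-mono-≤-nonNeg (ℚ.∣-∣-nonNeg (r m ℚ.- r n)) (ℚ.pos⇒nonNeg A {{A>0}})
          (s≤A m (ℕ.m⊔n≤o⇒m≤o Ms Mr (M≤ h)))
          (q m n (ℕ.m⊔n≤o⇒n≤o Ns Nr (N≤ h)) (ℕ.m⊔n≤o⇒n≤o Ns Nr (N≤ k))))
        (*-mono-≤-nonNeg (ℚ.∣-∣-nonNeg (s m ℚ.- s n)) (ℚ.pos⇒nonNeg B {{B>0}})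
          (r≤B n (ℕ.m⊔n≤o⇒n≤o Ms Mr (M≤ k)))
          (p m n (ℕ.m⊔n≤o⇒m≤o Ns Nr (N≤ h)) (ℕ.m⊔n≤o⇒m≤o Ns Nr (N≤ k)))))
      (ℚ.≤-reflexive Aδ+Bδ≡ε))

infixl 6 _+ʳ_
infixl 7 _*ʳ_
infixr 8 _^ʳ_

_+ʳ_ _*ʳ_ : ℝ → ℝ → ℝ
x +ʳ y = mkℝ (λ n → seq x n ℚ.+ seq y n) (+-cauchy (seq x) (seq y) (cauchy x) (cauchy y))
x *ʳ y = mkℝ (λ n → seq x n ℚ.* seq y n) (*-cauchy (seq x) (seq y) (cauchy x) (cauchy y))

_^ʳ_ : ℝ → ℕ → ℝ
x ^ʳ zero  = 1ℝ
x ^ʳ suc k = x *ʳ x ^ʳ k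

fraction : (a b : ℕ) → .{{ℕ.NonZero b}} → ℝ
fraction a b = fromℚ (+ a ℚ./ b)

-- The sum of g over those members of a list that satisfy P; g may use the
-- proof of P.
sumOver : ∀ {a p} {A : Set a} {P : Pred A p} →
  List A → Decidable P → (∀ x → P x → ℝ) → ℝ
sumOver []       P? g = 0ℝ
sumOver (x ∷ xs) P? g with P? x
... | yes px = g x px +ʳ sumOver xs P? g
... | no  _  = sumOver xs P? g

-- ℝ[x,y]: finite formal sums of monomials (c , i , j), standing for
-- c xⁱ yʲ; two such sums are the same polynomial when all their
-- coefficients agree.

Poly : Set
Poly = List (ℝ × ℕ × ℕ)

coeff : Poly → ℕ → ℕ → ℝ
coeff p i j = sumOver p (λ (_ , i′ , j′) → (i′ ℕ.≟ i) ×-dec (j′ ℕ.≟ j)) (λ (c , _) _ → c)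

infix 4 _≈ₚ[x,y]_

_≈ₚ[x,y]_ : Poly → Poly → Set
P ≈ₚ[x,y] Q = ∀ i j → coeff P i j ≃ coeff Q i j

constₚ : ℝ → Poly
constₚ c = (c , 0 , 0) ∷ []

X Y : Poly
X = (1ℝ , 1 , 0) ∷ []
Y = (1ℝ , 0 , 1) ∷ []

infixl 6 _+ₚ_ _-ₚ_
infixl 7 _*ₚ_
infixr 8 _^ₚ_

_+ₚ_ _*ₚ_ _-ₚ_ : Poly → Poly → Poly
_+ₚ_ = _++_
_*ₚ_ = cartesianProductWith
  λ (c , i , j) (c′ , i′ , j′) → c *ʳ c′ , i ℕ.+ i′ , j ℕ.+ j′
P -ₚ Q = P +ₚ constₚ -1ℝ *ₚ Q

_^ₚ_ : Poly → ℕ → Poly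
P ^ₚ zero  = constₚ 1ℝ
P ^ₚ suc k = P *ₚ P ^ₚ k

infix 9 _[_,_]

_[_,_] : Poly → Poly → Poly → Poly
Z [ P , Q ] = concatMap (λ (c , i , j) → constₚ c *ₚ P ^ₚ i *ₚ Q ^ₚ j) Z

-- The degree is an integer: t - 2d may be negative, and then only the zero
-- polynomial is homogeneous of that degree.
Homogeneous : ℤ → Poly → Set
Homogeneous e P = ∀ i j → + (i ℕ.+ j) ≢ e → coeff P i j ≃ 0ℝ

[_]_ : ℕ → ℕ → Set
[ t ] d = Σ[ z ∈ Subset t ] ∣ z ∣ ≡ d

ℝ[_]_ : ℕ → ℕ → Set
ℝ[ t ] d = [ t ] d → ℝ

allSubsets : ∀ t → List (Subset t)
allSubsets zero    = Vec.[] ∷ []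
allSubsets (suc t) =
  map (outside Vec.∷_) (allSubsets t) ++ map (inside Vec.∷_) (allSubsets t)

-- The coefficient of γ f at y is the sum of f z over the d-subsets z ⊇ y.
γ : ∀ {t d} → ℝ[ t ] d → ℝ[ t ] (ℕ.pred d)
γ {t} {zero}  f _       = 0ℝ
γ {t} {suc d} f (y , _) =
  sumOver (allSubsets t) (λ z → (∣ z ∣ ℕ.≟ suc d) ×-dec (y ⊆? z)) λ z (∣z∣≡d , _) → f (z , ∣z∣≡d)

Harm : ∀ t d → ℝ[ t ] d → Set
Harm t d f = ∀ y → γ f y ≃ 0ℝ

-- A permutation group is given by the duplicate-free list of its elements.
-- Permutations compose from left to right (_∘ₚ_), so i ↦ π ⟨$⟩ʳ i is a right action.

record PermutationGroup (n : ℕ) : Set where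
  field
    elements : List (Permutation′ n)
    distinct : AllPairs (λ π ρ → ¬ (π ≈ₚ ρ)) elements

  infix 4 _∈ᴳ

  _∈ᴳ : Permutation′ n → Set
  π ∈ᴳ = Any (π ≈ₚ_) elements

  field
    id-∈  : idₚ ∈ᴳ
    ∘-∈   : ∀ {π ρ} → π ∈ᴳ → ρ ∈ᴳ → (π ∘ₚ ρ) ∈ᴳ
    inv-∈ : ∀ {π} → π ∈ᴳ → flip π ∈ᴳ

  order : ℕ
  order = length elements

  InOrbit : Fin n → Fin n → Set
  InOrbit i j = Any (λ π → π ⟨$⟩ʳ i ≡ j) elements

  InOrbit? : ∀ i j → Dec (InOrbit i j)
  InOrbit? i j = any? (λ π → (π ⟨$⟩ʳ i) Fin.≟ j) elements

  orbitSize : Fin n → ℕ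
  orbitSize i = ∣ Vec.tabulate (λ j → does (InOrbit? i j)) ∣

infix 4 _≤ᴳ_

_≤ᴳ_ : ∀ {n} → PermutationGroup n → PermutationGroup n → Set
H ≤ᴳ G = ∀ {π} → π ∈ᴴ → π ∈ᴳ
  where
  open PermutationGroup G using (_∈ᴳ)
  open PermutationGroup H using () renaming (_∈ᴳ to _∈ᴴ)

-- A numbering of the orbits by Fin t, the i-th one being the orbit of α i.
record Orbits {n} (H : PermutationGroup n) (t : ℕ) : Set where
  open PermutationGroup H
  field
    α         : Fin t → Fin n
    covering  : ∀ j → ∃ λ i → InOrbit (α i) j
    separated : ∀ {i k} → InOrbit (α i) (α k) → i ≡ k

Enumeration : ∀ {c ℓ} → Ring c ℓ → ℕ → Set (c ⊔ ℓ)
Enumeration R q = Inverse (Ring.setoid R) (≡.setoid (Fin q))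

module Frobenius {c ℓ} (R : Ring c ℓ) {q} (enum : Enumeration R q) where
  open Ring R renaming (refl to ≈-refl; sym to ≈-sym; trans to ≈-trans)
  open RingProperties R using (-0#≈0#; -‿+-comm)
  open Inverse enum using (to)

  -- Subsets of R are given as subsets of Fin q through the enumeration.
  infix 4 _∈ᴿ_

  _∈ᴿ_ : Carrier → Subset q → Set
  a ∈ᴿ I = to a ∈ˢ I

  record IsRightIdeal (I : Subset q) : Set c where
    field
      0-∈ : 0# ∈ᴿ I
      +-∈ : ∀ {a b} → a ∈ᴿ I → b ∈ᴿ I → a + b ∈ᴿ I
      neg-∈ : ∀ {a} → a ∈ᴿ I → - a ∈ᴿ I
      *-∈ : ∀ {a} r → a ∈ᴿ I → a * r ∈ᴿ I

  record IsLeftIdeal (I : Subset q) : Set c where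
    field
      0-∈ : 0# ∈ᴿ I
      +-∈ : ∀ {a b} → a ∈ᴿ I → b ∈ᴿ I → a + b ∈ᴿ I
      neg-∈ : ∀ {a} → a ∈ᴿ I → - a ∈ᴿ I
      *-∈ : ∀ {a} r → a ∈ᴿ I → r * a ∈ᴿ I

  module _ (IsIdeal : Subset q → Set c) where

    IsMaximal : Subset q → Set c
    IsMaximal M = IsIdeal M × M ≢ ⊤ˢ ×
      (∀ J → IsIdeal J → M ⊆ˢ J → J ≡ M ⊎ J ≡ ⊤ˢ)

    IsMinimal : Subset q → Set c
    IsMinimal I = IsIdeal I × I ≢ ⁅ to 0# ⁆ ×
      (∀ J → IsIdeal J → J ⊆ˢ I → J ≡ ⁅ to 0# ⁆ ⊎ J ≡ I)

    -- The sum of all minimal ideals of the given sidedness.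
    Soc : Carrier → Set (c ⊔ ℓ)
    Soc a = Σ[ xs ∈ List Carrier ]
      All (λ x → ∃ λ I → IsMinimal I × x ∈ᴿ I) xs × a ≈ foldr _+_ 0# xs

    private
      foldr-++ : ∀ xs ys → foldr _+_ 0# (xs ++ ys) ≈ foldr _+_ 0# xs + foldr _+_ 0# ys
      foldr-++ []       ys = ≈-sym (+-identityˡ _)
      foldr-++ (x ∷ xs) ys = ≈-trans (+-congˡ (foldr-++ xs ys)) (≈-sym (+-assoc x _ _))

    Soc-0 : Soc 0#
    Soc-0 = [] , [] , ≈-refl

    Soc-+ : ∀ {a b} → Soc a → Soc b → Soc (a + b)
    Soc-+ (xs , pxs , a≈) (ys , pys , b≈) =
      xs ++ ys , All.++⁺ pxs pys , ≈-trans (+-cong a≈ b≈) (≈-sym (foldr-++ xs ys))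

    Soc-map : (g : Carrier → Carrier) → (∀ {a b} → a ≈ b → g a ≈ g b) →
      g 0# ≈ 0# → (∀ a b → g (a + b) ≈ g a + g b) →
      (∀ {I a} → IsIdeal I → a ∈ᴿ I → g a ∈ᴿ I) →
      ∀ {a} → Soc a → Soc (g a)
    Soc-map g g-cong g-0 g-+ g-∈ (xs , pxs , a≈) =
      map g xs , go pxs , ≈-trans (g-cong a≈) (g-sum xs)
      where
      go : ∀ {xs} → All (λ x → ∃ λ I → IsMinimal I × x ∈ᴿ I) xs →
        All (λ x → ∃ λ I → IsMinimal I × x ∈ᴿ I) (map g xs)
      go []                         = []
      go ((I , min , x∈I) ∷ pxs) = (I , min , g-∈ (proj₁ min) x∈I) ∷ go pxs

      g-sum : ∀ xs → g (foldr _+_ 0# xs) ≈ foldr _+_ 0# (map g xs)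
      g-sum []       = g-0
      g-sum (x ∷ xs) = ≈-trans (g-+ x _) (+-congˡ (g-sum xs))

  -- The Jacobson radical; the maximal left ideals have the same intersection.
  Rad : Carrier → Set c
  Rad a = ∀ M → IsMaximal IsRightIdeal M → a ∈ᴿ M

  R/Rad-right : RawRightModule Carrier c c
  R/Rad-right = record
    { Carrierᴹ = Carrier
    ; _≈ᴹ_ = λ a b → Rad (a - b)
    ; _+ᴹ_ = _+_
    ; _*ᵣ_ = _*_
    ; 0ᴹ = 0#
    ; -ᴹ_ = -_
    }

  R/Rad-left : RawLeftModule Carrier c c
  R/Rad-left = record
    { Carrierᴹ = Carrier
    ; _≈ᴹ_ = λ a b → Rad (a - b)
    ; _+ᴹ_ = _+_
    ; _*ₗ_ = _*_
    ; 0ᴹ = 0#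
    ; -ᴹ_ = -_
    }

  private
    neg-+ : ∀ a b → - (a + b) ≈ - a + - b
    neg-+ a b = ≈-sym (-‿+-comm a b)

  Soc-right : RawRightModule Carrier (c ⊔ ℓ) ℓ
  Soc-right = record
    { Carrierᴹ = Σ Carrier (Soc IsRightIdeal)
    ; _≈ᴹ_ = λ (a , _) (b , _) → a ≈ b
    ; _+ᴹ_ = λ (a , p) (b , r) → a + b , Soc-+ IsRightIdeal p r
    ; _*ᵣ_ = λ (a , p) r → a * r , Soc-map IsRightIdeal (_* r) *-congʳ (zeroˡ r) (distribʳ r)
        (λ I-ideal → IsRightIdeal.*-∈ I-ideal r) p
    ; 0ᴹ = 0# , Soc-0 IsRightIdeal
    ; -ᴹ_ = λ (a , p) → - a , Soc-map IsRightIdeal -_ -‿cong -0#≈0# neg-+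
        (λ I-ideal → IsRightIdeal.neg-∈ I-ideal) p
    }

  Soc-left : RawLeftModule Carrier (c ⊔ ℓ) ℓ
  Soc-left = record
    { Carrierᴹ = Σ Carrier (Soc IsLeftIdeal)
    ; _≈ᴹ_ = λ (a , _) (b , _) → a ≈ b
    ; _+ᴹ_ = λ (a , p) (b , r) → a + b , Soc-+ IsLeftIdeal p r
    ; _*ₗ_ = λ r (a , p) → r * a , Soc-map IsLeftIdeal (r *_) *-congˡ (zeroʳ r) (distribˡ r)
        (λ I-ideal → IsLeftIdeal.*-∈ I-ideal r) p
    ; 0ᴹ = 0# , Soc-0 IsLeftIdeal
    ; -ᴹ_ = λ (a , p) → - a , Soc-map IsLeftIdeal -_ -‿cong -0#≈0# neg-+
        (λ I-ideal → IsLeftIdeal.neg-∈ I-ideal) p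
    }

  open RightModuleMorphisms R/Rad-right Soc-right using (IsRightModuleIsomorphism)
  open LeftModuleMorphisms R/Rad-left Soc-left using (IsLeftModuleIsomorphism)

  IsFrobenius : Set (c ⊔ ℓ)
  IsFrobenius = ∃ IsRightModuleIsomorphism × ∃ IsLeftModuleIsomorphism

module Coding {c ℓ} (R : Ring c ℓ) {q} (enum : Enumeration R q) where
  open Ring R renaming (refl to ≈-refl; sym to ≈-sym; trans to ≈-trans)
  open RawMonoidDefs +-rawMonoid using (sum) renaming (_×_ to _·_)
  open Inverse enum using (to; from; to-cong; strictlyInverseʳ)

  infix 4 _≟_ _≋_ _≋?_

  _≟_ : ∀ a b → Dec (a ≈ b)
  a ≟ b = map′
    (λ eq → ≈-trans (≈-sym (strictlyInverseʳ a))
      (≈-trans (reflexive (cong from eq)) (strictlyInverseʳ b)))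
    to-cong (to a Fin.≟ to b)

  V : ℕ → Set c
  V n = Vector Carrier n

  _≋_ : ∀ {n} → V n → V n → Set ℓ
  u ≋ v = ∀ i → u i ≈ v i

  _≋?_ : ∀ {n} (u v : V n) → Dec (u ≋ v)
  u ≋? v = Fin.all? (λ i → u i ≟ v i)

  vector : ∀ {n} → Fin (q ^ n) → V n
  vector k i = from (finToFun k i)

  position : ∀ {n} → V n → Fin (q ^ n)
  position v = funToFin (to ∘ v)

  vector-position : ∀ {n} (v : V n) → vector (position v) ≋ v
  vector-position v i =
    ≈-trans (reflexive (cong from (Fin.finToFun-funToFin (to ∘ v) i))) (strictlyInverseʳ (v i))

  allVectors : ∀ n → List (V n)
  allVectors n = tabulate (vector {n})

  -- V n is finite, so subsets are taken to be decidable.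
  record DecSubset (n : ℕ) (p : Level) : Set (c ⊔ ℓ ⊔ lsuc p) where
    field
      mem  : Pred (V n) p
      mem? : Decidable mem
      resp : ∀ {u v} → u ≋ v → mem u → mem v

  open DecSubset

  card : ∀ {n p} → DecSubset n p → ℕ
  card {n} D = length (filter (mem? D) (allVectors n))

  card-nonZero : ∀ {n p} (D : DecSubset n p) v → mem D v → ℕ.NonZero (card D)
  card-nonZero D v v∈D = ℕ.>-nonZero (filter-some (mem? D)
    (Any.tabulate⁺ (position v) (resp D (λ i → ≈-sym (vector-position v i)) v∈D)))

  whole : ∀ {n} → DecSubset n 0ℓ
  whole = record { mem = λ _ → ⊤ ; mem? = λ _ → yes tt ; resp = λ _ _ → tt }

  image : ∀ {n p} (g : V n → V n) → (∀ {u v} → u ≋ v → g u ≋ g v) →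
    DecSubset n p → DecSubset n (c ⊔ ℓ ⊔ p)
  image g g-cong D = record
    { mem = λ v → ∃ λ u → mem D u × v ≋ g u
    ; mem? = λ v → map′
        (λ (k , k∈D , v≋) → vector k , k∈D , v≋)
        (λ (u , u∈D , v≋) → position u
          , resp D (λ i → ≈-sym (vector-position u i)) u∈D
          , λ i → ≈-trans (v≋ i) (≈-sym (g-cong (vector-position u) i)))
        (Fin.any? λ k → mem? D (vector k) ×-dec (v ≋? g (vector k)))
    ; resp = λ v≋w (u , u∈D , v≋) → u , u∈D , λ i → ≈-trans (≈-sym (v≋w i)) (v≋ i)
    }

  ⟨_,_⟩ : ∀ {n} → V n → V n → Carrier
  ⟨ u , v ⟩ = sum (λ i → u i * v i)

  private
    sum-cong : ∀ {n} {u v : V n} → u ≋ v → sum u ≈ sum v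
    sum-cong {zero}  _   = ≈-refl
    sum-cong {suc n} u≋v = +-cong (u≋v Fin.zero) (sum-cong (λ i → u≋v (Fin.suc i)))

    ⟨,⟩-cong : ∀ {n} {u u′ v v′ : V n} → u ≋ u′ → v ≋ v′ → ⟨ u , v ⟩ ≈ ⟨ u′ , v′ ⟩
    ⟨,⟩-cong u≋ v≋ = sum-cong (λ i → *-cong (u≋ i) (v≋ i))

  _^⊥ : ∀ {n p} → DecSubset n p → DecSubset n (c ⊔ ℓ ⊔ p)
  C ^⊥ = record
    { mem = λ u → ∀ v → mem C v → ⟨ v , u ⟩ ≈ 0#
    ; mem? = λ u → map′
        (λ h v v∈C → ≈-trans
          (⟨,⟩-cong (λ i → ≈-sym (vector-position v i)) (λ _ → ≈-refl))
          (h (position v) (resp C (λ i → ≈-sym (vector-position v i)) v∈C)))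
        (λ h k → h (vector k))
        (Fin.all? λ k → mem? C (vector k) →-dec (⟨ vector k , u ⟩ ≟ 0#))
    ; resp = λ u≋w u⊥ v v∈C →
        ≈-trans (⟨,⟩-cong (λ _ → ≈-refl) (λ i → ≈-sym (u≋w i))) (u⊥ v v∈C)
    }

  infixl 7 _∙_

  _∙_ : ∀ {n} → V n → Permutation′ n → V n
  (v ∙ π) i = v (π ⟨$⟩ˡ i)

  record IsLeftGCode {n p} (G : PermutationGroup n) (C : DecSubset n p) : Set (c ⊔ p) where
    open PermutationGroup G using (_∈ᴳ)
    field
      0-∈ : mem C (λ _ → 0#)
      +-∈ : ∀ {u v} → mem C u → mem C v → mem C (λ i → u i + v i)
      *-∈ : ∀ r {v} → mem C v → mem C (λ i → r * v i)
      ∙-∈ : ∀ {v π} → π ∈ᴳ → mem C v → mem C (v ∙ π)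

  record HasInverse (a : Carrier) : Set (c ⊔ ℓ) where
    field
      inverse  : Carrier
      inverseˡ : inverse * a ≈ 1#
      inverseʳ : a * inverse ≈ 1#

  OrderInvertible : ∀ {n} → PermutationGroup n → Set (c ⊔ ℓ)
  OrderInvertible H = HasInverse (PermutationGroup.order H · 1#)

  module _ {n} (H : PermutationGroup n) where
    open PermutationGroup H

    orbitLengthMatrix : Fin n → Fin n → Carrier
    orbitLengthMatrix i j with i Fin.≟ j
    ... | yes _ = orbitSize j · 1#
    ... | no  _ = 0#

    infixl 7 _·M

    _·M : ∀ {p} → DecSubset n p → DecSubset n (c ⊔ ℓ ⊔ p)
    _·M = image (λ v j → sum (λ i → v i * orbitLengthMatrix i j))
      (λ u≋v j → sum-cong (λ i → *-congʳ (u≋v i)))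

  module Average {n} (H : PermutationGroup n) (∣H∣⁻¹ : OrderInvertible H) where
    open PermutationGroup H
    open HasInverse ∣H∣⁻¹

    θ : V n → V n
    θ v i = inverse * foldr _+_ 0# (map (λ π → (v ∙ π) i) elements)

    θ-cong : ∀ {u v} → u ≋ v → θ u ≋ θ v
    θ-cong {u} {v} u≋v i = *-congˡ (go elements)
      where
      go : ∀ πs → foldr _+_ 0# (map (λ π → (u ∙ π) i) πs) ≈ foldr _+_ 0# (map (λ π → (v ∙ π) i) πs)
      go []       = ≈-refl
      go (π ∷ πs) = +-cong (u≋v (π ⟨$⟩ˡ i)) (go πs)

    _⟨θ⟩ : ∀ {p} → DecSubset n p → DecSubset n (c ⊔ ℓ ⊔ p)
    _⟨θ⟩ = image θ θ-cong

    Vθ : DecSubset n (c ⊔ ℓ)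
    Vθ = whole ⟨θ⟩

    ⟨θ⟩-nonZero : ∀ {p G} {C : DecSubset n p} → IsLeftGCode G C → ℕ.NonZero (card (C ⟨θ⟩))
    ⟨θ⟩-nonZero {C = C} isCode =
      card-nonZero (C ⟨θ⟩) _ (_ , IsLeftGCode.0-∈ isCode , λ _ → ≈-refl)

    module Enumerator {t} (orbits : Orbits H t) where
      open Orbits orbits

      -- An element u of Vθ is constant on orbits, so its coefficient at the
      -- indicator vector of the i-th orbit is the entry u (α i).
      supp : V n → Subset t
      supp u = Vec.tabulate (λ i → not (does (u (α i) ≟ 0#)))

      wt : V n → ℕ
      wt u = ∣ supp u ∣

      tilde : ∀ {d} → ℝ[ t ] d → V n → ℝ
      tilde {d} f u = sumOver (allVectors n)
        (λ v → mem? Vθ v ×-dec (wt v ℕ.≟ d) ×-dec (supp v ⊆? supp u))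
        (λ v (_ , wt≡d , _) → f (supp v , wt≡d))

      W : ∀ {d p} → DecSubset n p → ℝ[ t ] d → Poly
      W D f = map (λ u → tilde f u , t ∸ wt u , wt u) (filter (mem? D) (allVectors n))

-- Averaging over H and restricting to one coordinate per orbit identifies C θ_H with a
-- code A of length t, and ((C⊥) θ_H) M_H with its dual A′: the orbit matrix compensates
-- for summing over representatives, and orbit sizes divide |H|, hence are units. From
-- R/Rad(R) ≅ Soc(R) one obtains g with Rad(R) = ann(g); a maximal left ideal I and its
-- right annihilator then satisfy |ann(I)| |I| ≤ |R|, and climbing a chain of codes by
-- simple steps gives |A| |A′| = |R|^t. Applied to shortened codes this relates, for every
-- T ⊆ [t], the numbers of words of A′ supported in T and of A supported outside T.
--
-- A harmonic f, regarded as a multilinear form f(w) = Σ f(z) ∏_{i ∈ z} w_i, is invariant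
-- under adding a constant to w; so passing from S to its complement multiplies f̃(S) by
-- (-1)^d, which turns the relations between the numbers of words into the MacWilliams
-- identity times a product of powers of linear forms. Linear forms cancel in ℝ[x,y].

module Submission where

open import Algebra.Bundles using (AbelianGroup; CommutativeMonoid; Ring; CommutativeRing)
import Algebra.Construct.Flip.Op as Flip
import Algebra.Definitions.RawMonoid as RawMonoidDefs
open import Algebra.Module.Bundles using (LeftModule)
import Algebra.Module.Construct.TensorUnit as TensorUnit
open import Algebra.Module.Morphism.Structures using (module LeftModuleMorphisms)
import Algebra.Properties.AbelianGroup as AbelianGroupProperties
import Algebra.Properties.CommutativeMonoid.Mult as CommutativeMonoidMult
import Algebra.Properties.CommutativeMonoid.Sum as CommutativeMonoidSum
import Algebra.Properties.CommutativeSemiring.Exp as CommutativeSemiringExp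
import Algebra.Properties.Monoid.Mult as MonoidMult
import Algebra.Properties.Ring as RingProperties
import Algebra.Properties.Semiring.Exp as SemiringExp
import Algebra.Properties.Semiring.Mult as SemiringMult
import Algebra.Properties.Semiring.Sum as SemiringSum
import Algebra.Solver.Ring.NaturalCoefficients.Default as NaturalSolver
open import Data.Bool using (Bool; true; false; if_then_else_; not)
open import Data.Empty using (⊥-elim)
open import Data.Fin as Fin using (Fin; zero; suc; _↑ˡ_; _↑ʳ_; combine; punchOut; funToFin)
open import Data.Fin.Permutation using (Permutation′; _⟨$⟩ʳ_)
import Data.Fin.Properties as Fin
open import Data.Fin.Subset as Subset using (Subset; inside; outside; ∣_∣; ⁅_⁆; ∁; _∩_)
import Data.Fin.Subset.Properties as Subset
open import Data.Integer as ℤ using (ℤ; +_)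
import Data.Integer.Properties as ℤ
open import Data.List as List using ([]; _∷_; List; _++_; map; filter; foldr)
open import Data.List.Membership.Propositional.Properties using (∈-lookup)
open import Data.List.Relation.Unary.All as All using ([]; _∷_; All)
open import Data.List.Relation.Unary.AllPairs using (AllPairs; []; _∷_)
open import Data.List.Relation.Unary.Any as Any using (Any; here; there)
import Data.List.Relation.Unary.Any.Properties as Any
open import Data.Nat as ℕ using (ℕ; zero; suc; z≤n; s≤s)
import Data.Nat.Properties as ℕ
open import Data.Nat.Solver using (module +-*-Solver)
open import Data.Product using (∃; _×_; _,_; proj₁; proj₂; Σ-syntax)
open import Data.Rational as ℚ using (ℚ; 0ℚ; 1ℚ; ½; Positive)
import Data.Rational.Properties as ℚ
open import Data.Rational.Solver using ()
  renaming (module +-*-Solver to ℚ-Solver)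
open import Data.Rational.Unnormalised as ℚᵘ using (mkℚᵘ; *≡*)
import Data.Rational.Unnormalised.Properties as ℚᵘ
open import Data.Sum using (_⊎_; inj₁; inj₂)
open import Data.Unit using (⊤; tt)
open import Data.Vec as Vec using ([]; _∷_)
import Data.Vec.Properties as Vec
open import Function using (_∘_; Inverse)
open import Function.Definitions using (Injective)
open import Level using (Level; _⊔_; 0ℓ)
  renaming (suc to lsuc)
open import Relation.Binary using (Setoid; _Respects_)
open import Relation.Binary.PropositionalEquality as ≡ using (_≡_; refl; cong; cong₂; subst; _≢_)
import Relation.Binary.Reasoning.Setoid as SetoidReasoning
open import Relation.Nullary using (¬_; Dec; yes; no; does; contradiction)
open import Relation.Nullary.Decidable using (_×-dec_; map′; dec-true; dec-false; _→-dec_; ¬?; decidable-stable)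
open import Relation.Unary using (Pred; Decidable)
open import Defs

-- Sums and finite abelian groups

-- The bound for a maximal left ideal I uses neither characters nor the structure theorem for
-- semisimple rings. Right multiplication by g carries the x with Ix in Rad(R) onto ann(I), so
-- ann(I) is measured inside R/Rad(R). There the product modulo I is a pairing with values in the
-- division ring E/I, where E is the idealizer of I. Each comparison of sizes is a double count of a
-- relation between two finite groups. Along a chain of codes this yields only inequalities; they
-- are equalities because the ends of the chain, the zero code and the whole space, both give q to
-- the length.
--
-- The condition γ f = 0 says that the multilinear form has zero derivative along (1,...,1). Higher
-- derivatives then vanish after division by k + 1, which is where invariance under shifts comes
-- from and why torsion has to be excluded.
--
-- The polynomial identity arises with a = x - y as parameter, multiplied by d-th powers of x, y, x
-- - y and x + (q-1)y; this is why linear forms must be cancelled. Since each d-subset is the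
-- support of (q-1)^d vectors, f̃ carries that factor too. It is multiplied through and never
-- cancelled, as it can be zero when q = 1.

module Sums {c ℓ} (M : CommutativeMonoid c ℓ) where
  open CommutativeMonoid M renaming (refl to ≈-refl; sym to ≈-sym; trans to ≈-trans)
  private module Std = CommutativeMonoidSum M
  open SetoidReasoning setoid

  -- Opaque, so that the length and the summand can be inferred by unification.
  opaque
    sum : ∀ {n} → (Fin n → Carrier) → Carrier
    sum = Std.sum

    sum≡ : ∀ {n} (f : Fin n → Carrier) → sum f ≡ Std.sum f
    sum≡ f = refl

    sum-zero : (f : Fin 0 → Carrier) → sum f ≈ ε
    sum-zero f = ≈-refl

    sum-suc : ∀ {n} (f : Fin (suc n) → Carrier) → sum f ≈ f zero ∙ sum (f ∘ suc)
    sum-suc f = ≈-refl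

    sum-cong : ∀ {n} {f g : Fin n → Carrier} → (∀ k → f k ≈ g k) → sum f ≈ sum g
    sum-cong {n} = Std.sum-cong-≋ {n}

    sum-ε : ∀ {n} {f : Fin n → Carrier} → (∀ k → f k ≈ ε) → sum f ≈ ε
    sum-ε {n} f≈ε = ≈-trans (Std.sum-cong-≋ {n} f≈ε) (Std.sum-replicate-zero n)

    sum-∙ : ∀ {n} (f g : Fin n → Carrier) → sum (λ k → f k ∙ g k) ≈ sum f ∙ sum g
    sum-∙ = Std.∑-distrib-+

    sum-permute : ∀ {n} (f : Fin n → Carrier) (π : Permutation′ n) → sum f ≈ sum (λ k → f (π ⟨$⟩ʳ k))
    sum-permute f π = Std.sum-permute f π

    sum-comm : ∀ {m n} (f : Fin m → Fin n → Carrier) →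
      sum (λ k → sum (f k)) ≈ sum (λ l → sum (λ k → f k l))
    sum-comm = Std.∑-comm

  infixl 5 _when_

  _when_ : Carrier → Bool → Carrier
  x when true  = x
  x when false = ε

  when-cong : ∀ {p q} {P : Set p} {Q : Set q} (P? : Dec P) (Q? : Dec Q) {x y} →
    (P → Q) → (Q → P) → (P → x ≈ y) → x when does P? ≈ y when does Q?
  when-cong (yes p) (yes q) _   _   x≈y = x≈y p
  when-cong (yes p) (no ¬q) P⇒Q _   _   = contradiction (P⇒Q p) ¬q
  when-cong (no ¬p) (yes q) _   Q⇒P _   = contradiction (Q⇒P q) ¬p
  when-cong (no ¬p) (no ¬q) _   _   _   = ≈-refl

  when-congˡ : ∀ b {x y} → x ≈ y → x when b ≈ y when b
  when-congˡ true  x≈y = x≈y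
  when-congˡ false x≈y = ≈-refl

  sum-when : ∀ {n} (f : Fin n → Carrier) b → sum (λ k → f k when b) ≈ sum f when b
  sum-when f true  = ≈-refl
  sum-when f false = sum-ε λ _ → ≈-refl

  sum-single : ∀ {n} (f : Fin n → Carrier) k → sum (λ l → f l when does (l Fin.≟ k)) ≈ f k
  sum-single {suc n} f zero    =
    ≈-trans (sum-suc _) (≈-trans (∙-congˡ (sum-ε λ _ → ≈-refl)) (identityʳ _))
  sum-single {suc n} f (suc k) = ≈-trans (sum-suc _) (≈-trans (identityˡ _) (begin
    sum (λ l → f (suc l) when does (suc l Fin.≟ suc k))
      ≈⟨ sum-cong (λ l → when-cong (suc l Fin.≟ suc k) (l Fin.≟ k)
           Fin.suc-injective (cong suc) (λ _ → ≈-refl)) ⟩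
    sum (λ l → f (suc l) when does (l Fin.≟ k))  ≈⟨ sum-single (f ∘ suc) k ⟩
    f (suc k)                                    ∎))

  sum-unique : ∀ {n p} {P : Pred (Fin n) p} (P? : Decidable P) f k →
    P k → (∀ {l} → P l → l ≡ k) → sum (λ l → f l when does (P? l)) ≈ f k
  sum-unique P? f k Pk unique = ≈-trans
    (sum-cong λ l → when-cong (P? l) (l Fin.≟ k) unique (λ { refl → Pk }) (λ _ → ≈-refl))
    (sum-single f k)

  -- Both sides count the graph of the bijection.
  sum-bijection : ∀ {m n p q} {P : Pred (Fin m) p} {Q : Pred (Fin n) q}
    (P? : Decidable P) (Q? : Decidable Q) {g : Fin m → Carrier} {h : Fin n → Carrier}
    (f : Fin m → Fin n) (f⁻¹ : Fin n → Fin m) →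
    (∀ {k} → P k → Q (f k)) → (∀ {l} → Q l → P (f⁻¹ l)) →
    (∀ {k} → P k → f⁻¹ (f k) ≡ k) → (∀ {l} → Q l → f (f⁻¹ l) ≡ l) →
    (∀ {k} → P k → g k ≈ h (f k)) →
    sum (λ k → g k when does (P? k)) ≈ sum (λ l → h l when does (Q? l))
  sum-bijection {P = P} {Q} P? Q? {g} {h} f f⁻¹ P⇒Q Q⇒P invˡ invʳ g≈h = begin
    sum (λ k → g k when does (P? k))
      ≈⟨ sum-cong (λ k → when-congˡ (does (P? k)) (≈-sym (sum-single (λ _ → g k) (f k)))) ⟩
    sum (λ k → sum (λ l → g k when does (l Fin.≟ f k)) when does (P? k))
      ≈⟨ sum-cong (λ k → sum-when _ (does (P? k))) ⟨
    sum (λ k → sum (λ l → g k when does (l Fin.≟ f k) when does (P? k)))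
      ≈⟨ sum-comm _ ⟩
    sum (λ l → sum (λ k → g k when does (l Fin.≟ f k) when does (P? k)))
      ≈⟨ sum-cong (λ l → sum-cong (λ k → swap k l)) ⟩
    sum (λ l → sum (λ k → h l when does (k Fin.≟ f⁻¹ l) when does (Q? l)))
      ≈⟨ sum-cong (λ l → sum-when _ (does (Q? l))) ⟩
    sum (λ l → sum (λ k → h l when does (k Fin.≟ f⁻¹ l)) when does (Q? l))
      ≈⟨ sum-cong (λ l → when-congˡ (does (Q? l)) (sum-single (λ _ → h l) (f⁻¹ l))) ⟩
    sum (λ l → h l when does (Q? l)) ∎
    where
    swap : ∀ k l → (g k when does (l Fin.≟ f k) when does (P? k)) ≈
      (h l when does (k Fin.≟ f⁻¹ l) when does (Q? l))
    swap k l with P? k | Q? l | l Fin.≟ f k | k Fin.≟ f⁻¹ l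
    ... | yes p | yes q | yes refl | yes _    = g≈h p
    ... | yes p | yes q | yes refl | no k≢    = contradiction (≡.sym (invˡ p)) k≢
    ... | yes p | yes q | no l≢    | yes refl = contradiction (≡.sym (invʳ q)) l≢
    ... | yes p | yes q | no _     | no _     = ≈-refl
    ... | yes p | no ¬q | yes refl | _        = contradiction (P⇒Q p) ¬q
    ... | yes p | no ¬q | no _     | _        = ≈-refl
    ... | no ¬p | yes q | _        | yes refl = contradiction (Q⇒P q) ¬p
    ... | no ¬p | yes q | _        | no _     = ≈-refl
    ... | no ¬p | no ¬q | _        | _        = ≈-refl

  sum-++ : ∀ m {n} (f : Fin (m ℕ.+ n) → Carrier) →
    sum f ≈ sum (λ k → f (k ↑ˡ n)) ∙ sum (λ k → f (m ↑ʳ k))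
  sum-++ zero    f = ≈-sym (≈-trans (∙-congʳ (sum-zero _)) (identityˡ _))
  sum-++ (suc m) f = begin
    sum f                                  ≈⟨ sum-suc f ⟩
    f zero ∙ sum (f ∘ suc)                 ≈⟨ ∙-congˡ (sum-++ m (f ∘ suc)) ⟩
    f zero ∙ (sum (λ k → f (suc k ↑ˡ _)) ∙ sum (λ k → f (suc m ↑ʳ k)))
      ≈⟨ assoc _ _ _ ⟨
    (f zero ∙ sum (λ k → f (suc k ↑ˡ _))) ∙ sum (λ k → f (suc m ↑ʳ k))
      ≈⟨ ∙-congʳ (sum-suc _) ⟨
    sum (λ k → f (k ↑ˡ _)) ∙ sum (λ k → f (suc m ↑ʳ k))  ∎

  sum-combine : ∀ m {n} (f : Fin (m ℕ.* n) → Carrier) →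
    sum f ≈ sum (λ (k : Fin m) → sum (λ (l : Fin n) → f (combine k l)))
  sum-combine zero    f = ≈-trans (sum-zero _) (≈-sym (sum-zero _))
  sum-combine (suc m) {n} f = ≈-trans (sum-++ n f)
    (≈-trans (∙-congˡ (sum-combine m (λ k → f (n ↑ʳ k)))) (≈-sym (sum-suc _)))

  module _ {a r b s} {A : Setoid a r} {B : Setoid b s} {m n}
           (eA : Inverse A (≡.setoid (Fin m))) (eB : Inverse B (≡.setoid (Fin n))) where
    private
      module A = Setoid A
      module B = Setoid B
      module eA = Inverse eA
      module eB = Inverse eB

    sum-setoid-bijection : ∀ {p q} {P : Pred A.Carrier p} {Q : Pred B.Carrier q}
      (P? : Decidable P) (Q? : Decidable Q) {g : A.Carrier → Carrier} {h : B.Carrier → Carrier}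
      (f : A.Carrier → B.Carrier) (f⁻¹ : B.Carrier → A.Carrier) →
      P Respects A._≈_ → Q Respects B._≈_ →
      (∀ {x y} → x A.≈ y → f x B.≈ f y) → (∀ {x y} → x B.≈ y → f⁻¹ x A.≈ f⁻¹ y) →
      (∀ {x y} → x B.≈ y → h x ≈ h y) →
      (∀ {x} → P x → Q (f x)) → (∀ {y} → Q y → P (f⁻¹ y)) →
      (∀ {x} → P x → f⁻¹ (f x) A.≈ x) → (∀ {y} → Q y → f (f⁻¹ y) B.≈ y) →
      (∀ {x} → P x → g x ≈ h (f x)) →
      sum (λ k → g (eA.from k) when does (P? (eA.from k))) ≈
      sum (λ l → h (eB.from l) when does (Q? (eB.from l)))
    sum-setoid-bijection P? Q? f f⁻¹ P-resp Q-resp f-cong f⁻¹-cong h-cong P⇒Q Q⇒P invˡ invʳ g≈h =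
      sum-bijection (P? ∘ eA.from) (Q? ∘ eB.from)
        (eB.to ∘ f ∘ eA.from) (eA.to ∘ f⁻¹ ∘ eB.from)
        (λ p → Q-resp (B.sym (eB.strictlyInverseʳ _)) (P⇒Q p))
        (λ q → P-resp (A.sym (eA.strictlyInverseʳ _)) (Q⇒P q))
        (λ p → ≡.trans (eA.to-cong (A.trans (f⁻¹-cong (eB.strictlyInverseʳ _)) (invˡ p)))
                 (eA.strictlyInverseˡ _))
        (λ q → ≡.trans (eB.to-cong (B.trans (f-cong (eA.strictlyInverseʳ _)) (invʳ q)))
                 (eB.strictlyInverseˡ _))
        (λ p → ≈-trans (g≈h p) (h-cong (B.sym (eB.strictlyInverseʳ _))))

module ℕ-Sums = Sums ℕ.+-0-commutativeMonoid
open ℕ-Sums using () renaming (sum to sumℕ; _when_ to _whenℕ_)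

module _ {c ℓ} (M : CommutativeMonoid c ℓ) where
  open CommutativeMonoid M renaming (refl to ≈-refl; sym to ≈-sym; trans to ≈-trans)
  open MonoidMult monoid using (×-homo-+) renaming (_×_ to _·_)
  open Sums M

  sum-when-· : ∀ {n} (b : Fin n → Bool) x → sumℕ (λ k → 1 whenℕ b k) · x ≈ sum (λ k → x when b k)
  sum-when-· {zero}  b x rewrite ℕ-Sums.sum-zero (λ k → 1 whenℕ b k) = ≈-sym (sum-zero _)
  sum-when-· {suc n} b x rewrite ℕ-Sums.sum-suc (λ k → 1 whenℕ b k) =
    ≈-trans (×-homo-+ x (1 whenℕ b zero) _)
      (≈-trans (∙-cong (head (b zero)) (sum-when-· (b ∘ suc) x)) (≈-sym (sum-suc _)))
    where
    head : ∀ b → (1 whenℕ b) · x ≈ (x when b)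
    head true  = identityʳ x
    head false = ≈-refl

sum-mono-≤ : ∀ {n} {f g : Fin n → ℕ} → (∀ k → f k ℕ.≤ g k) → sumℕ f ℕ.≤ sumℕ g
sum-mono-≤ {zero} {f} {g} f≤g = ℕ.≤-reflexive
  (≡.trans (ℕ-Sums.sum-zero f) (≡.sym (ℕ-Sums.sum-zero g)))
sum-mono-≤ {suc n} {f} {g} f≤g = ≡.subst₂ ℕ._≤_
  (≡.sym (ℕ-Sums.sum-suc f)) (≡.sym (ℕ-Sums.sum-suc g))
  (ℕ.+-mono-≤ (f≤g zero) (sum-mono-≤ (f≤g ∘ suc)))

when-mono-≤ : ∀ {p q} {P : Set p} {Q : Set q} (P? : Dec P) (Q? : Dec Q) {x} →
  (P → Q) → (x whenℕ does P?) ℕ.≤ (x whenℕ does Q?)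
when-mono-≤ (yes p) (yes q) P⇒Q = ℕ.≤-refl
when-mono-≤ (yes p) (no ¬q) P⇒Q = contradiction (P⇒Q p) ¬q
when-mono-≤ (no ¬p) Q?      P⇒Q = z≤n

sum-when-const : ∀ {n} (b : Fin n → Bool) m →
  sumℕ (λ k → m whenℕ b k) ≡ sumℕ (λ k → 1 whenℕ b k) ℕ.* m
sum-when-const {zero}  b m = ≡.trans (ℕ-Sums.sum-zero _)
  (≡.sym (cong (ℕ._* m) (ℕ-Sums.sum-zero _)))
sum-when-const {suc n} b m
  rewrite ℕ-Sums.sum-suc (λ k → m whenℕ b k) | ℕ-Sums.sum-suc (λ k → 1 whenℕ b k)
  with b zero
... | true  = cong (m ℕ.+_) (sum-when-const (b ∘ suc) m)
... | false = sum-when-const (b ∘ suc) m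

∣-∣≡sum : ∀ {n} (p : Subset n) → ∣ p ∣ ≡ sumℕ (λ k → 1 whenℕ does (k Subset.∈? p))
∣-∣≡sum Vec.[]            = ≡.sym (ℕ-Sums.sum-zero _)
∣-∣≡sum (inside  Vec.∷ p) = ≡.trans (cong suc (∣-∣≡sum p)) (≡.sym (ℕ-Sums.sum-suc _))
∣-∣≡sum (outside Vec.∷ p) = ≡.trans (∣-∣≡sum p) (≡.sym (ℕ-Sums.sum-suc _))

does-∈?-tabulate : ∀ {n} (f : Fin n → Bool) k → does (k Subset.∈? Vec.tabulate f) ≡ f k
does-∈?-tabulate f zero    with f zero
... | true  = refl
... | false = refl
does-∈?-tabulate f (suc k) = does-∈?-tabulate (f ∘ suc) k

∣tabulate∣≡sum : ∀ {n} (f : Fin n → Bool) → ∣ Vec.tabulate f ∣ ≡ sumℕ (λ k → 1 whenℕ f k)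
∣tabulate∣≡sum f = ≡.trans (∣-∣≡sum (Vec.tabulate f))
  (ℕ-Sums.sum-cong λ k → cong (1 whenℕ_) (does-∈?-tabulate f k))

module _ {n p} {P : Pred (Fin n) p} (P? : Decidable P) where

  ⟦_⟧ : Subset n
  ⟦_⟧ = Vec.tabulate (does ∘ P?)

  ∈⟦⟧⁺ : ∀ {k} → P k → k Subset.∈ ⟦_⟧
  ∈⟦⟧⁺ {k} pk = Vec.lookup⇒[]= k ⟦_⟧
    (≡.trans (Vec.lookup∘tabulate (does ∘ P?) k) (dec-true (P? k) pk))

  ∈⟦⟧⁻ : ∀ {k} → k Subset.∈ ⟦_⟧ → P k
  ∈⟦⟧⁻ {k} k∈ with P? k | ≡.trans (≡.sym (Vec.lookup∘tabulate (does ∘ P?) k)) (Vec.[]=⇒lookup k∈)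
  ... | yes pk | _ = pk

record FiniteAbelianGroup c ℓ : Set (lsuc (c ⊔ ℓ)) where
  field
    abelianGroup : AbelianGroup c ℓ
    size         : ℕ
    enumeration  : Inverse (AbelianGroup.setoid abelianGroup) (≡.setoid (Fin size))

  open AbelianGroup abelianGroup public
    renaming (refl to ≈-refl; sym to ≈-sym; trans to ≈-trans)
  open AbelianGroupProperties abelianGroup public using (⁻¹-anti-homo-//)
  open Inverse enumeration public using (to; from; to-cong; strictlyInverseˡ; strictlyInverseʳ)

  infix 4 _∈_ _∈?_

  _∈_ : Carrier → Subset size → Set
  x ∈ A = to x Subset.∈ A

  _∈?_ : ∀ x A → Dec (x ∈ A)
  x ∈? A = to x Subset.∈? A

  ∈-resp : ∀ {A x y} → x ≈ y → x ∈ A → y ∈ A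
  ∈-resp {A} x≈y = subst (Subset._∈ A) (to-cong x≈y)

  record Property p : Set (c ⊔ ℓ ⊔ lsuc p) where
    field
      holds  : Pred Carrier p
      holds? : Decidable holds
      resp   : holds Respects _≈_

  module _ {p} (P : Property p) where
    open Property P

    comprehension : Subset size
    comprehension = ⟦ holds? ∘ from ⟧

    ∈-comprehension⁺ : ∀ {x} → holds x → x ∈ comprehension
    ∈-comprehension⁺ px = ∈⟦⟧⁺ (holds? ∘ from) (resp (≈-sym (strictlyInverseʳ _)) px)

    ∈-comprehension⁻ : ∀ {x} → x ∈ comprehension → holds x
    ∈-comprehension⁻ x∈ = resp (strictlyInverseʳ _) (∈⟦⟧⁻ (holds? ∘ from) x∈)

  ∈-from : ∀ {A k} → k Subset.∈ A → from k ∈ A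
  ∈-from {A} = subst (Subset._∈ A) (≡.sym (strictlyInverseˡ _))

  ∈-from⁻ : ∀ {A k} → from k ∈ A → k Subset.∈ A
  ∈-from⁻ {A} = subst (Subset._∈ A) (strictlyInverseˡ _)

  ⊆⁺ : ∀ {A B} → (∀ {x} → x ∈ A → x ∈ B) → A Subset.⊆ B
  ⊆⁺ A⇒B = ∈-from⁻ ∘ A⇒B ∘ ∈-from

  infix 4 _≈?_

  to-injective : ∀ {x y} → to x ≡ to y → x ≈ y
  to-injective {x} {y} eq = ≈-trans (≈-sym (strictlyInverseʳ x))
    (≈-trans (reflexive (cong from eq)) (strictlyInverseʳ y))

  _≈?_ : ∀ x y → Dec (x ≈ y)
  x ≈? y = map′ to-injective to-cong (to x Fin.≟ to y)

  any? : ∀ {p} {P : Pred Carrier p} → Decidable P → P Respects _≈_ → Dec (∃ P)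
  any? P? P-resp = map′ (λ (k , p) → from k , p)
    (λ (x , p) → to x , P-resp (≈-sym (strictlyInverseʳ x)) p) (Fin.any? (P? ∘ from))

  all? : ∀ {p} {P : Pred Carrier p} → Decidable P → P Respects _≈_ → Dec (∀ x → P x)
  all? P? P-resp = map′ (λ h x → P-resp (strictlyInverseʳ x) (h (to x))) (λ h k → h (from k))
    (Fin.all? (P? ∘ from))

  translate-count : ∀ A x₀ →
    sumℕ (λ k → 1 whenℕ does ((from k ∙ x₀ ⁻¹) ∈? A)) ≡ ∣ A ∣
  translate-count A x₀ = ≡.trans
    (ℕ-Sums.sum-setoid-bijection enumeration enumeration (λ x → (x ∙ x₀ ⁻¹) ∈? A) (_∈? A)
      {g = λ _ → 1} {h = λ _ → 1} (_∙ x₀ ⁻¹) (_∙ x₀)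
      (λ x≈y → ∈-resp (∙-congʳ x≈y)) ∈-resp ∙-congʳ ∙-congʳ (λ _ → refl)
      (λ p → p) (∈-resp (≈-sym (≈-trans (assoc _ _ _) (≈-trans (∙-congˡ (inverseʳ x₀)) (identityʳ _)))))
      (λ _ → ≈-trans (assoc _ _ _) (≈-trans (∙-congˡ (inverseˡ x₀)) (identityʳ _)))
      (λ _ → ≈-trans (assoc _ _ _) (≈-trans (∙-congˡ (inverseʳ x₀)) (identityʳ _)))
      (λ _ → refl))
    (≡.trans (ℕ-Sums.sum-cong λ k → ℕ-Sums.when-cong (from k ∈? A) (k Subset.∈? A) ∈-from⁻ ∈-from (λ _ → refl))
      (≡.sym (∣-∣≡sum A)))

module _ {c₁ ℓ₁ c₂ ℓ₂} (G : FiniteAbelianGroup c₁ ℓ₁) (H : FiniteAbelianGroup c₂ ℓ₂) where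
  private
    module G = FiniteAbelianGroup G
    module H = FiniteAbelianGroup H

  -- Double counting of the pairs (x , y) ∈ Q × T related by ρ: the fibre over
  -- each x contains a translate of U, the fibre over each y lies in one of P.
  relation-bound : ∀ {r} {ρ : G.Carrier → H.Carrier → Set r} (ρ? : ∀ x y → Dec (ρ x y))
    (Q P : Subset G.size) (T U : Subset H.size) →
    (∀ x → x G.∈ Q → ∃ λ y₀ → ∀ y → (y H.∙ y₀ H.⁻¹) H.∈ U → y H.∈ T × ρ x y) →
    (∀ x x′ y → x G.∈ Q → x′ G.∈ Q → y H.∈ T → ρ x y → ρ x′ y → (x G.∙ x′ G.⁻¹) G.∈ P) →
    ∣ Q ∣ ℕ.* ∣ U ∣ ℕ.≤ ∣ T ∣ ℕ.* ∣ P ∣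
  relation-bound ρ? Q P T U fibre⊇ fibre⊆ = begin
    ∣ Q ∣ ℕ.* ∣ U ∣
      ≡⟨ cong (ℕ._* ∣ U ∣) (∣-∣≡sum Q) ⟩
    sumℕ (λ k → 1 whenℕ does (k Subset.∈? Q)) ℕ.* ∣ U ∣
      ≡⟨ sum-when-const (λ k → does (k Subset.∈? Q)) ∣ U ∣ ⟨
    sumℕ (λ k → ∣ U ∣ whenℕ does (k Subset.∈? Q))
      ≤⟨ sum-mono-≤ row ⟩
    sumℕ (λ k → sumℕ (λ l → 1 whenℕ does (pair? k l)))
      ≡⟨ ℕ-Sums.sum-comm (λ k l → 1 whenℕ does (pair? k l)) ⟩
    sumℕ (λ l → sumℕ (λ k → 1 whenℕ does (pair? k l)))
      ≤⟨ sum-mono-≤ column ⟩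
    sumℕ (λ l → ∣ P ∣ whenℕ does (l Subset.∈? T))
      ≡⟨ sum-when-const (λ l → does (l Subset.∈? T)) ∣ P ∣ ⟩
    sumℕ (λ l → 1 whenℕ does (l Subset.∈? T)) ℕ.* ∣ P ∣
      ≡⟨ cong (ℕ._* ∣ P ∣) (∣-∣≡sum T) ⟨
    ∣ T ∣ ℕ.* ∣ P ∣ ∎
    where
    open ℕ.≤-Reasoning
    pair? = λ k l → (k Subset.∈? Q) ×-dec (l Subset.∈? T) ×-dec ρ? (G.from k) (H.from l)

    row : ∀ k → (∣ U ∣ whenℕ does (k Subset.∈? Q)) ℕ.≤ sumℕ (λ l → 1 whenℕ does (pair? k l))
    row k with k Subset.∈? Q
    ... | no _  = z≤n
    ... | yes k∈Q with fibre⊇ (G.from k) (G.∈-from k∈Q)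
    ... | y₀ , h = begin
      ∣ U ∣  ≡⟨ H.translate-count U y₀ ⟨
      sumℕ (λ l → 1 whenℕ does ((H.from l H.∙ y₀ H.⁻¹) H.∈? U))
        ≤⟨ sum-mono-≤ (λ l → when-mono-≤ ((H.from l H.∙ y₀ H.⁻¹) H.∈? U)
             ((l Subset.∈? T) ×-dec ρ? (G.from k) (H.from l))
             (λ y∈ → H.∈-from⁻ (proj₁ (h _ y∈)) , proj₂ (h _ y∈))) ⟩
      sumℕ (λ l → 1 whenℕ does ((l Subset.∈? T) ×-dec ρ? (G.from k) (H.from l))) ∎

    column : ∀ l → sumℕ (λ k → 1 whenℕ does (pair? k l)) ℕ.≤ (∣ P ∣ whenℕ does (l Subset.∈? T))
    column l with Fin.any? (λ k → pair? k l)
    ... | no none = subst (ℕ._≤ _) (≡.sym (ℕ-Sums.sum-ε λ k →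
            cong (1 whenℕ_) (dec-false (pair? k l) (λ h → none (k , h))))) z≤n
    ... | yes (k₀ , k₀∈ , l∈ , ρ₀) = begin
      sumℕ (λ k → 1 whenℕ does (pair? k l))
        ≤⟨ sum-mono-≤ (λ k → when-mono-≤ (pair? k l) ((G.from k G.∙ G.from k₀ G.⁻¹) G.∈? P)
             λ (k∈ , _ , ρk) → fibre⊆ _ _ _ (G.∈-from k∈) (G.∈-from k₀∈) (H.∈-from l∈) ρk ρ₀) ⟩
      sumℕ (λ k → 1 whenℕ does ((G.from k G.∙ G.from k₀ G.⁻¹) G.∈? P))
        ≡⟨ G.translate-count P (G.from k₀) ⟩
      ∣ P ∣
        ≡⟨ cong (∣ P ∣ whenℕ_) (dec-true (l Subset.∈? T) l∈) ⟨
      (∣ P ∣ whenℕ does (l Subset.∈? T)) ∎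

-- Submodules of finite modules

module Differences {c ℓ} (G : AbelianGroup c ℓ) where
  open AbelianGroup G
  open AbelianGroupProperties G
  open SetoidReasoning setoid

  private
    interchange : ∀ a b c d → (a ∙ b) ∙ (c ∙ d) ≈ (a ∙ c) ∙ (b ∙ d)
    interchange a b c d = begin
      (a ∙ b) ∙ (c ∙ d)  ≈⟨ assoc a b _ ⟩
      a ∙ (b ∙ (c ∙ d))  ≈⟨ ∙-congˡ (assoc b c d) ⟨
      a ∙ ((b ∙ c) ∙ d)  ≈⟨ ∙-congˡ (∙-congʳ (comm b c)) ⟩
      a ∙ ((c ∙ b) ∙ d)  ≈⟨ ∙-congˡ (assoc c b d) ⟩
      a ∙ (c ∙ (b ∙ d))  ≈⟨ assoc a c _ ⟨
      (a ∙ c) ∙ (b ∙ d)  ∎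

  difference-∙ : ∀ a b c d → (a ∙ b) ∙ (c ∙ d) ⁻¹ ≈ (a ∙ c ⁻¹) ∙ (b ∙ d ⁻¹)
  difference-∙ a b c d = trans (∙-congˡ (sym (⁻¹-∙-comm c d))) (interchange a b (c ⁻¹) (d ⁻¹))

  difference-⁻¹ : ∀ a b → a ⁻¹ ∙ (b ⁻¹) ⁻¹ ≈ (a ∙ b ⁻¹) ⁻¹
  difference-⁻¹ a b = ⁻¹-∙-comm a (b ⁻¹)

  difference-cancel : ∀ a b → (a ∙ b ⁻¹) ∙ b ≈ a
  difference-cancel a b =
    trans (assoc a _ b) (trans (∙-congˡ (inverseˡ b)) (identityʳ a))

  difference-trans : ∀ a b c → (a ∙ b ⁻¹) ∙ (b ∙ c ⁻¹) ≈ a ∙ c ⁻¹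
  difference-trans a b c =
    trans (sym (assoc _ b _)) (∙-congʳ (difference-cancel a b))

  difference-cancelʳ : ∀ a b c → (a ∙ c ⁻¹) ∙ (b ∙ c ⁻¹) ⁻¹ ≈ a ∙ b ⁻¹
  difference-cancelʳ a b c = trans (∙-congˡ (⁻¹-anti-homo-// b c)) (difference-trans a c b)

  difference-cancelˡ : ∀ a b c → (c ∙ b ⁻¹) ∙ (c ∙ a ⁻¹) ⁻¹ ≈ a ∙ b ⁻¹
  difference-cancelˡ a b c = trans (∙-congˡ (⁻¹-anti-homo-// c a))
    (trans (comm _ _) (difference-trans a c b))

  difference-ε : ∀ a → a ∙ ε ⁻¹ ≈ a
  difference-ε a = trans (∙-congˡ ε⁻¹≈ε) (identityʳ a)

  difference-self : ∀ a b → a ∙ (a ∙ b ⁻¹) ⁻¹ ≈ b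
  difference-self a b = trans (∙-congˡ (⁻¹-anti-homo-// a b))
    (trans (comm a _) (difference-cancel b a))

⊤-cardinality-≤ : ∀ {n} (A : Subset n) → (∀ k → k Subset.∈ A) → n ℕ.≤ ∣ A ∣
⊤-cardinality-≤ A all = ℕ.≤-trans (ℕ.≤-reflexive (≡.sym (Subset.∣⊤∣≡n _)))
  (Subset.p⊆q⇒∣p∣≤∣q∣ {p = Subset.⊤} {q = A} (λ {k} _ → all k))

member⇒nonZero : ∀ {n} {A : Subset n} {k} → k Subset.∈ A → ℕ.NonZero ∣ A ∣
member⇒nonZero {A = A} {k} k∈A = ℕ.>-nonZero (ℕ.≤-trans (ℕ.≤-reflexive (≡.sym (Subset.∣⁅x⁆∣≡1 k)))
  (Subset.p⊆q⇒∣p∣≤∣q∣ {p = ⁅ k ⁆} {q = A} λ x∈ → subst (Subset._∈ A) (≡.sym (Subset.x∈⁅y⁆⇒x≡y k x∈)) k∈A))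

proper⇒∣-∣< : ∀ {n} {A B : Subset n} {k} → A Subset.⊆ B → k Subset.∈ B → k Subset.∉ A →
  ∣ A ∣ ℕ.< ∣ B ∣
proper⇒∣-∣< {k = k} A⊆B k∈B k∉A = Subset.p⊂q⇒∣p∣<∣q∣ (A⊆B , k , k∈B , k∉A)

injective⇒surjective : ∀ {n} {f : Fin n → Fin n} → Injective _≡_ _≡_ f → ∀ l → ∃ λ k → f k ≡ l
injective⇒surjective {suc n} {f} f-inj l with Fin.any? (λ k → f k Fin.≟ l)
... | yes hit = hit
... | no miss = contradiction (Fin.injective⇒≤ {f = λ k → punchOut (λ eq → miss (k , ≡.sym eq))}
  λ eq → f-inj (Fin.punchOut-injective {i = l} _ _ eq)) (ℕ.<⇒≱ ℕ.≤-refl)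

-- A left module over a finite ring S, with scalars restricted to a subset E of S.
module Submodules {c ℓ m ℓm} {S : Ring c ℓ} {q} (enum : Enumeration S q)
    (M : LeftModule S m ℓm) {N} (enumᴹ : Inverse (LeftModule.≈ᴹ-setoid M) (≡.setoid (Fin N)))
    (E : Subset q) where
  private module S = Ring S
  open LeftModule M

  scalars : FiniteAbelianGroup c ℓ
  scalars = record { abelianGroup = S.+-abelianGroup ; enumeration = enum }

  group : FiniteAbelianGroup m ℓm
  group = record { abelianGroup = +ᴹ-abelianGroup ; enumeration = enumᴹ }

  private module G = FiniteAbelianGroup group
  private module SG = FiniteAbelianGroup scalars
  open Differences +ᴹ-abelianGroup
  open FiniteAbelianGroup group using (_∈_; _∈?_; ∈-resp)

  *ₗ-neg : ∀ s x → s *ₗ (-ᴹ x) ≈ᴹ -ᴹ (s *ₗ x)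
  *ₗ-neg s x = AbelianGroupProperties.inverseʳ-unique +ᴹ-abelianGroup (s *ₗ x) (s *ₗ (-ᴹ x))
    (G.≈-trans (G.≈-sym (*ₗ-distribˡ s x (-ᴹ x)))
      (G.≈-trans (*ₗ-congˡ (-ᴹ‿inverseʳ x)) (*ₗ-zeroʳ s)))

  neg-*ₗ : ∀ s x → (S.- s) *ₗ x ≈ᴹ -ᴹ (s *ₗ x)
  neg-*ₗ s x = AbelianGroupProperties.inverseʳ-unique +ᴹ-abelianGroup (s *ₗ x) ((S.- s) *ₗ x)
    (G.≈-trans (G.≈-sym (*ₗ-distribʳ x s (S.- s)))
      (G.≈-trans (*ₗ-congʳ (S.-‿inverseʳ s)) (*ₗ-zeroˡ x)))

  *ₗ-distribˡ-difference : ∀ s x y → s *ₗ (x +ᴹ -ᴹ y) ≈ᴹ s *ₗ x +ᴹ -ᴹ (s *ₗ y)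
  *ₗ-distribˡ-difference s x y = G.≈-trans (*ₗ-distribˡ s x (-ᴹ y)) (+ᴹ-congˡ (*ₗ-neg s y))

  record IsSubmodule (A : Subset N) : Set (c Level.⊔ m) where
    field
      0-∈   : 0ᴹ ∈ A
      +-∈   : ∀ {x y} → x ∈ A → y ∈ A → (x +ᴹ y) ∈ A
      neg-∈ : ∀ {x} → x ∈ A → (-ᴹ x) ∈ A
      *-∈   : ∀ {s x} → s SG.∈ E → x ∈ A → (s *ₗ x) ∈ A

    difference-∈ : ∀ {x y} → x ∈ A → y ∈ A → (x +ᴹ -ᴹ y) ∈ A
    difference-∈ x∈ y∈ = +-∈ x∈ (neg-∈ y∈)

    ∈-from-difference : ∀ {x y} → (x +ᴹ -ᴹ y) ∈ A → y ∈ A → x ∈ A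
    ∈-from-difference x-y∈ y∈ = ∈-resp (difference-cancel _ _) (+-∈ x-y∈ y∈)

  open IsSubmodule

  private
    ∈-sum : Subset N → Subset N → G.Property m
    ∈-sum A X = record
      { holds  = λ y → ∃ λ x → x ∈ X × (y +ᴹ -ᴹ x) ∈ A
      ; holds? = λ y → G.any? (λ x → (x ∈? X) ×-dec ((y +ᴹ -ᴹ x) ∈? A))
          (λ x≈ (p , r) → ∈-resp x≈ p , ∈-resp (+ᴹ-congˡ (-ᴹ‿cong x≈)) r)
      ; resp   = λ y≈ (x , p , r) → x , p , ∈-resp (+ᴹ-congʳ y≈) r
      }

    ∈-multiples : Carrierᴹ → G.Property (c Level.⊔ ℓm)
    ∈-multiples v = record
      { holds  = λ y → ∃ λ s → s SG.∈ E × y ≈ᴹ s *ₗ v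
      ; holds? = λ y → SG.any? (λ s → (s SG.∈? E) ×-dec (y G.≈? s *ₗ v))
          (λ s≈ (p , r) → SG.∈-resp s≈ p , G.≈-trans r (*ₗ-congʳ s≈))
      ; resp   = λ y≈ (s , p , r) → s , p , G.≈-trans (G.≈-sym y≈) r
      }

  _⊕_ : Subset N → Subset N → Subset N
  A ⊕ X = G.comprehension (∈-sum A X)

  module _ {A X : Subset N} where

    ∈-⊕⁺ : ∀ {y} x → x ∈ X → (y +ᴹ -ᴹ x) ∈ A → y ∈ (A ⊕ X)
    ∈-⊕⁺ x x∈ d∈ = G.∈-comprehension⁺ (∈-sum A X) (x , x∈ , d∈)

    ∈-⊕⁻ : ∀ {y} → y ∈ (A ⊕ X) → ∃ λ x → x ∈ X × (y +ᴹ -ᴹ x) ∈ A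
    ∈-⊕⁻ = G.∈-comprehension⁻ (∈-sum A X)

    ⊕-isSubmodule : IsSubmodule A → IsSubmodule X → IsSubmodule (A ⊕ X)
    ⊕-isSubmodule A-sub X-sub = record
      { 0-∈ = ∈-⊕⁺ 0ᴹ (0-∈ X-sub) (difference-∈ A-sub (0-∈ A-sub) (0-∈ A-sub))
      ; +-∈ = λ y∈ z∈ →
          let x , x∈ , d∈ = ∈-⊕⁻ y∈
              w , w∈ , e∈ = ∈-⊕⁻ z∈
          in ∈-⊕⁺ (x +ᴹ w) (+-∈ X-sub x∈ w∈)
               (∈-resp (G.≈-sym (difference-∙ _ _ x w)) (+-∈ A-sub d∈ e∈))
      ; neg-∈ = λ y∈ →
          let x , x∈ , d∈ = ∈-⊕⁻ y∈
          in ∈-⊕⁺ (-ᴹ x) (neg-∈ X-sub x∈)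
               (∈-resp (G.≈-sym (difference-⁻¹ _ x)) (neg-∈ A-sub d∈))
      ; *-∈ = λ {s} s∈ y∈ →
          let x , x∈ , d∈ = ∈-⊕⁻ y∈
          in ∈-⊕⁺ (s *ₗ x) (*-∈ X-sub s∈ x∈)
               (∈-resp (*ₗ-distribˡ-difference s _ x) (*-∈ A-sub s∈ d∈))
      }

    ⊆-⊕ˡ : IsSubmodule X → ∀ {x} → x ∈ A → x ∈ (A ⊕ X)
    ⊆-⊕ˡ X-sub x∈ = ∈-⊕⁺ 0ᴹ (0-∈ X-sub) (∈-resp (G.≈-sym (difference-ε _)) x∈)

    ⊆-⊕ʳ : IsSubmodule A → ∀ {x} → x ∈ X → x ∈ (A ⊕ X)
    ⊆-⊕ʳ A-sub x∈ = ∈-⊕⁺ _ x∈ (∈-resp (G.≈-sym (-ᴹ‿inverseʳ _)) (0-∈ A-sub))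

    ⊕-least : ∀ {B} → IsSubmodule B → (∀ {x} → x ∈ A → x ∈ B) → (∀ {x} → x ∈ X → x ∈ B) →
      ∀ {x} → x ∈ (A ⊕ X) → x ∈ B
    ⊕-least B-sub A⊆B X⊆B y∈ =
      let x , x∈ , d∈ = ∈-⊕⁻ y∈ in ∈-from-difference B-sub (A⊆B d∈) (X⊆B x∈)

  span : Carrierᴹ → Subset N
  span v = G.comprehension (∈-multiples v)

  ∈-span⁺ : ∀ {v} s → s SG.∈ E → (s *ₗ v) ∈ span v
  ∈-span⁺ {v} s s∈ = G.∈-comprehension⁺ (∈-multiples v) (s , s∈ , G.≈-refl)

  ∈-span⁻ : ∀ {v y} → y ∈ span v → ∃ λ s → s SG.∈ E × y ≈ᴹ s *ₗ v
  ∈-span⁻ {v} = G.∈-comprehension⁻ (∈-multiples v)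

  record IsSubring : Set c where
    field
      0#-∈  : S.0# SG.∈ E
      1#-∈  : S.1# SG.∈ E
      +-∈   : ∀ {s r} → s SG.∈ E → r SG.∈ E → (s S.+ r) SG.∈ E
      neg-∈ : ∀ {s} → s SG.∈ E → (S.- s) SG.∈ E
      *-∈   : ∀ {s r} → s SG.∈ E → r SG.∈ E → (s S.* r) SG.∈ E

  whole-isSubring : (∀ s → s SG.∈ E) → IsSubring
  whole-isSubring all∈E = record
    { 0#-∈ = all∈E _ ; 1#-∈ = all∈E _ ; +-∈ = λ _ _ → all∈E _
    ; neg-∈ = λ _ → all∈E _ ; *-∈ = λ _ _ → all∈E _ }

  module Cyclic (E-subring : IsSubring) (v : Carrierᴹ) where
    private module E = IsSubring E-subring

    span-isSubmodule : IsSubmodule (span v)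
    span-isSubmodule = record
      { 0-∈ = ∈-resp (*ₗ-zeroˡ v) (∈-span⁺ S.0# E.0#-∈)
      ; +-∈ = λ x∈ y∈ →
          let s , s∈ , x≈ = ∈-span⁻ x∈
              r , r∈ , y≈ = ∈-span⁻ y∈
          in ∈-resp (G.≈-trans (*ₗ-distribʳ v s r) (G.≈-sym (+ᴹ-cong x≈ y≈)))
               (∈-span⁺ (s S.+ r) (E.+-∈ s∈ r∈))
      ; neg-∈ = λ x∈ →
          let s , s∈ , x≈ = ∈-span⁻ x∈
          in ∈-resp (G.≈-trans (neg-*ₗ s v) (G.≈-sym (-ᴹ‿cong x≈))) (∈-span⁺ (S.- s) (E.neg-∈ s∈))
      ; *-∈ = λ {r} r∈ x∈ →
          let s , s∈ , x≈ = ∈-span⁻ x∈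
          in ∈-resp (G.≈-trans (*ₗ-assoc r s v) (G.≈-sym (*ₗ-congˡ x≈)))
               (∈-span⁺ (r S.* s) (E.*-∈ r∈ s∈))
      }

    generator-∈ : v ∈ span v
    generator-∈ = ∈-resp (*ₗ-identityˡ v) (∈-span⁺ S.1# E.1#-∈)

    span-least : ∀ {B} → IsSubmodule B → v ∈ B → ∀ {x} → x ∈ span v → x ∈ B
    span-least B-sub v∈B x∈ =
      let s , s∈ , x≈ = ∈-span⁻ x∈ in ∈-resp (G.≈-sym x≈) (*-∈ B-sub s∈ v∈B)

-- Finite Frobenius rings

-- The recursions below climb strictly increasing chains of submodules. Their fuel is any upper
-- bound for the room `n - a` that is left, so one unit pays for each strict enlargement.
+-fuel : ∀ {n a b f} → a ℕ.< b → n ℕ.≤ a ℕ.+ suc f → n ℕ.≤ b ℕ.+ f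
+-fuel {n} {a} {b} {f} a<b n≤ = ℕ.≤-trans n≤ (ℕ.≤-trans (ℕ.≤-reflexive (ℕ.+-suc a f)) (ℕ.+-monoˡ-≤ f a<b))

module FiniteRing {c ℓ} (R : Ring c ℓ) {q} (enum : Enumeration R q) where
  open Ring R renaming (refl to ≈-refl; sym to ≈-sym; trans to ≈-trans)
  open RingProperties R using ([y-z]x≈yx-zx; x[y-z]≈xy-xz)
  open Frobenius R enum
  open SetoidReasoning setoid
  open Differences +-abelianGroup public

  private
    Rᵒᵖ : Ring c ℓ
    Rᵒᵖ = Flip.ring R

  additive : FiniteAbelianGroup c ℓ
  additive = record { abelianGroup = +-abelianGroup ; enumeration = enum }

  open FiniteAbelianGroup additive public
    using (_∈_; _∈?_; ∈-resp; to; from; ∈-from; ∈-from⁻; _≈?_; to-injective; Property;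
      comprehension; ∈-comprehension⁺; ∈-comprehension⁻; any?; all?)
    renaming (⊆⁺ to ⊆-intro)

  module LeftIdeals = Submodules {S = R} enum TensorUnit.leftModule enum Subset.⊤
  -- Right modules are left modules over the opposite ring. Besides the right ideals, the case
  -- needed is that of `E` the idealizer of a maximal left ideal, with R as a right module over it.
  module RightModules (E : Subset q) =
    Submodules {S = Rᵒᵖ} enum (TensorUnit.leftModule {R = Rᵒᵖ}) enum E
  module RightIdeals = RightModules Subset.⊤

  private
    left-whole : LeftIdeals.IsSubring
    left-whole = LeftIdeals.whole-isSubring (λ _ → Subset.∈⊤)

    right-whole : RightIdeals.IsSubring
    right-whole = RightIdeals.whole-isSubring (λ _ → Subset.∈⊤)

  module LeftCyclic  = LeftIdeals.Cyclic left-whole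
  module RightCyclic = RightIdeals.Cyclic right-whole

  toRightIdeal : ∀ {I} → RightIdeals.IsSubmodule I → IsRightIdeal I
  toRightIdeal I-sub = record
    { 0-∈ = 0-∈ ; +-∈ = +-∈ ; neg-∈ = neg-∈ ; *-∈ = λ _ → *-∈ Subset.∈⊤ }
    where open RightIdeals.IsSubmodule I-sub

  fromRightIdeal : ∀ {I} → IsRightIdeal I → RightIdeals.IsSubmodule I
  fromRightIdeal I-ideal = record
    { 0-∈ = 0-∈ ; +-∈ = +-∈ ; neg-∈ = neg-∈ ; *-∈ = λ _ → *-∈ _ }
    where open IsRightIdeal I-ideal

  toLeftIdeal : ∀ {I} → LeftIdeals.IsSubmodule I → IsLeftIdeal I
  toLeftIdeal I-sub = record
    { 0-∈ = 0-∈ ; +-∈ = +-∈ ; neg-∈ = neg-∈ ; *-∈ = λ _ → *-∈ Subset.∈⊤ }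
    where open LeftIdeals.IsSubmodule I-sub

  fromLeftIdeal : ∀ {I} → IsLeftIdeal I → LeftIdeals.IsSubmodule I
  fromLeftIdeal I-ideal = record
    { 0-∈ = 0-∈ ; +-∈ = +-∈ ; neg-∈ = neg-∈ ; *-∈ = λ _ → *-∈ _ }
    where open IsLeftIdeal I-ideal

  right-1∈⇒⊤ : ∀ {I} → RightIdeals.IsSubmodule I → 1# ∈ I → ∀ {x} → x ∈ I
  right-1∈⇒⊤ I-sub 1∈I = ∈-resp (*-identityˡ _) (RightIdeals.IsSubmodule.*-∈ I-sub Subset.∈⊤ 1∈I)

  -- Finiteness replaces Zorn's lemma: generators are added as long as 1 stays outside. Once every
  -- further generator brings in 1, each strictly larger right ideal contains 1, so the ideal
  -- reached is maximal.
  maximal-above : ∀ fuel N → q ℕ.≤ ∣ N ∣ ℕ.+ fuel → RightIdeals.IsSubmodule N → ¬ (1# ∈ N) →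
    ∃ λ M → (∀ {x} → x ∈ N → x ∈ M) × IsMaximal IsRightIdeal M
  maximal-above fuel N q≤ N-sub 1∉N
    with Fin.any? (λ k → ¬? (from k ∈? N) ×-dec ¬? (1# ∈? (N RightIdeals.⊕ RightIdeals.span (from k))))
  ... | no none = N , (λ x∈ → x∈) , toRightIdeal N-sub
      , (λ { refl → 1∉N Subset.∈⊤ }) , above
    where
    above : ∀ J → IsRightIdeal J → N Subset.⊆ J → J ≡ N ⊎ J ≡ Subset.⊤
    above J J-ideal N⊆J with Fin.any? (λ k → (k Subset.∈? J) ×-dec ¬? (k Subset.∈? N))
    ... | no none′ = inj₁ (Subset.⊆-antisym
            (λ {k} k∈J → decidable-stable (k Subset.∈? N) (λ k∉N → none′ (k , k∈J , k∉N))) N⊆J)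
    ... | yes (k , k∈J , k∉N) = inj₂ (Subset.⊆-antisym Subset.⊆⊤ (⊆-intro (λ _ → right-1∈⇒⊤ J-sub 1∈J)))
      where
      J-sub = fromRightIdeal J-ideal
      1∈J : 1# ∈ J
      1∈J = RightIdeals.⊕-least J-sub N⊆J (RightCyclic.span-least (from k) J-sub (∈-from k∈J))
        (decidable-stable (1# ∈? _) (λ 1∉ → none (k , k∉N ∘ ∈-from⁻ , 1∉)))
  ... | yes (k , k∉N , 1∉N′) = go fuel q≤
    where
    N′ = N RightIdeals.⊕ RightIdeals.span (from k)
    N⊆N′ : ∀ {x} → x ∈ N → x ∈ N′
    N⊆N′ = RightIdeals.⊆-⊕ˡ (RightCyclic.span-isSubmodule (from k))
    N<N′ : ∣ N ∣ ℕ.< ∣ N′ ∣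
    N<N′ = proper⇒∣-∣< (⊆-intro N⊆N′)
      (∈-from⁻ (RightIdeals.⊆-⊕ʳ N-sub (RightCyclic.generator-∈ (from k)))) (k∉N ∘ ∈-from)
    go : ∀ fuel → q ℕ.≤ ∣ N ∣ ℕ.+ fuel → ∃ λ M → (∀ {x} → x ∈ N → x ∈ M) × IsMaximal IsRightIdeal M
    go zero q≤ = contradiction (ℕ.≤-trans N<N′ (Subset.∣p∣≤n N′))
      (ℕ.≤⇒≯ (ℕ.≤-trans q≤ (ℕ.≤-reflexive (ℕ.+-identityʳ _))))
    go (suc fuel) q≤ =
      let M , N′⊆M , M-max = maximal-above fuel N′ (+-fuel N<N′ q≤)
            (RightIdeals.⊕-isSubmodule N-sub (RightCyclic.span-isSubmodule (from k))) 1∉N′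
      in M , N′⊆M ∘ N⊆N′ , M-max

  maximal-proper : ∀ {M} → IsMaximal IsRightIdeal M → ¬ (1# ∈ M)
  maximal-proper (M-ideal , M≢⊤ , _) 1∈M = M≢⊤ (Subset.⊆-antisym Subset.⊆⊤
    (⊆-intro (λ _ → right-1∈⇒⊤ (fromRightIdeal M-ideal) 1∈M)))

  maximal-coprime : ∀ {M} → IsMaximal IsRightIdeal M → ∀ {x} → ¬ (x ∈ M) → ∃ λ r → (1# - x * r) ∈ M
  maximal-coprime {M} (M-ideal , M≢⊤ , max) {x} x∉M
    with max (M RightIdeals.⊕ RightIdeals.span x)
           (toRightIdeal (RightIdeals.⊕-isSubmodule (fromRightIdeal M-ideal) (RightCyclic.span-isSubmodule x)))
           (⊆-intro (RightIdeals.⊆-⊕ˡ (RightCyclic.span-isSubmodule x)))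
  ... | inj₁ eq = contradiction
          (subst (x ∈_) eq (RightIdeals.⊆-⊕ʳ (fromRightIdeal M-ideal) (RightCyclic.generator-∈ x))) x∉M
  ... | inj₂ eq =
    let y , y∈ , d∈ = RightIdeals.∈-⊕⁻ (subst (1# ∈_) (≡.sym eq) Subset.∈⊤)
        r , _ , y≈ = RightIdeals.∈-span⁻ y∈
    in r , ∈-resp (+-congˡ (-‿cong y≈)) d∈

  Rad-resp : ∀ {a b} → a ≈ b → Rad a → Rad b
  Rad-resp a≈b a∈ M M-max = ∈-resp a≈b (a∈ M M-max)

  Rad-0 : Rad 0#
  Rad-0 M (M-ideal , _) = IsRightIdeal.0-∈ M-ideal

  Rad-* : ∀ {a} r → Rad a → Rad (a * r)
  Rad-* r a∈ M M-max = IsRightIdeal.*-∈ (proj₁ M-max) r (a∈ M M-max)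

  -- Suppose a maximal right ideal M misses x, and take r with 1 - xr in M. Then (1 - xr)xr lies in
  -- M, and so does xrxr because xrx is in the radical. Hence xr is in M, and with it 1.
  Rad-semiprime : ∀ {x} → (∀ r → Rad (x * r * x)) → Rad x
  Rad-semiprime {x} xRx⊆ M M-max@(M-ideal , _) with x ∈? M
  ... | yes x∈M = x∈M
  ... | no  x∉M =
    let open RightIdeals.IsSubmodule (fromRightIdeal M-ideal)
        r , 1-xr∈M = maximal-coprime M-max x∉M
        xr = x * r
        xrxr∈M : xr * xr ∈ M
        xrxr∈M = ∈-resp (*-assoc xr x r) (*-∈ Subset.∈⊤ (xRx⊆ r M M-max))
        xr-xrxr∈M : xr - xr * xr ∈ M
        xr-xrxr∈M = ∈-resp (≈-trans ([y-z]x≈yx-zx xr 1# xr) (+-congʳ (*-identityˡ xr)))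
          (*-∈ Subset.∈⊤ 1-xr∈M)
    in contradiction (∈-from-difference 1-xr∈M (∈-from-difference xr-xrxr∈M xrxr∈M))
         (maximal-proper M-max)

  -- A maximal right ideal containing 1 - ar would also contain ar, hence 1. So the right ideal
  -- generated by 1 - ar is everything.
  Rad-quasiregular : ∀ {a} → Rad a → ∀ r → ∃ λ b → (1# - a * r) * b ≈ 1#
  Rad-quasiregular {a} a∈ r with 1# ∈? RightIdeals.span (1# - a * r)
  ... | yes 1∈ = let b , _ , 1≈ = RightIdeals.∈-span⁻ 1∈ in b , ≈-sym 1≈
  ... | no  1∉ =
    let M , ⊆M , M-max = maximal-above q _ (ℕ.m≤n+m q _)
          (RightCyclic.span-isSubmodule (1# - a * r)) 1∉
        open RightIdeals.IsSubmodule (fromRightIdeal (proj₁ M-max))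
    in contradiction
         (∈-from-difference (⊆M (RightCyclic.generator-∈ (1# - a * r))) (*-∈ Subset.∈⊤ (a∈ M M-max)))
         (maximal-proper M-max)

  -- Left multiplication by y is injective because x undoes it, hence surjective on a finite ring.
  -- So yu = 1 for some u, and x = x(yu) = u.
  right-inverse⇒left-inverse : ∀ {x y} → x * y ≈ 1# → y * x ≈ 1#
  right-inverse⇒left-inverse {x} {y} xy≈1 = ≈-trans (*-congˡ x≈u) yu≈1
    where
    cancel : ∀ {u v} → y * u ≈ y * v → u ≈ v
    cancel {u} {v} yu≈yv = begin
      u            ≈⟨ *-identityˡ u ⟨
      1# * u       ≈⟨ *-congʳ xy≈1 ⟨
      (x * y) * u  ≈⟨ *-assoc x y u ⟩
      x * (y * u)  ≈⟨ *-congˡ yu≈yv ⟩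
      x * (y * v)  ≈⟨ *-assoc x y v ⟨
      (x * y) * v  ≈⟨ *-congʳ xy≈1 ⟩
      1# * v       ≈⟨ *-identityˡ v ⟩
      v            ∎
    preimage = injective⇒surjective {f = λ k → to (y * from k)}
      (λ eq → ≡.trans (≡.sym (Inverse.strictlyInverseˡ enum _))
        (≡.trans (Inverse.to-cong enum (cancel (to-injective eq))) (Inverse.strictlyInverseˡ enum _)))
      (to 1#)
    u = from (proj₁ preimage)
    yu≈1 : y * u ≈ 1#
    yu≈1 = to-injective (proj₂ preimage)
    x≈u : x ≈ u
    x≈u = begin
      x            ≈⟨ *-identityʳ x ⟨
      x * 1#       ≈⟨ *-congˡ yu≈1 ⟨
      x * (y * u)  ≈⟨ *-assoc x y u ⟨
      (x * y) * u  ≈⟨ *-congʳ xy≈1 ⟩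
      1# * u       ≈⟨ *-identityˡ u ⟩
      u            ∎

  -- If b is a right inverse of 1 - ar, then 1 + rba is one of 1 - ra.
  quasi-inverse : ∀ {a r b} → (1# - a * r) * b ≈ 1# → (1# - r * a) * (1# + r * b * a) ≈ 1#
  quasi-inverse {a} {r} {b} eq = begin
    (1# - r * a) * (1# + r * b * a)                 ≈⟨ distribˡ _ _ _ ⟩
    (1# - r * a) * 1# + (1# - r * a) * (r * b * a)  ≈⟨ +-cong (*-identityʳ _) step ⟩
    (1# - r * a) + r * a                            ≈⟨ difference-cancel 1# (r * a) ⟩
    1#                                              ∎
    where
    slide : (1# - r * a) * r ≈ r * (1# - a * r)
    slide = begin
      (1# - r * a) * r    ≈⟨ [y-z]x≈yx-zx r 1# (r * a) ⟩
      1# * r - r * a * r  ≈⟨ +-cong (≈-trans (*-identityˡ r) (≈-sym (*-identityʳ r))) (-‿cong (*-assoc r a r)) ⟩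
      r * 1# - r * (a * r)  ≈⟨ x[y-z]≈xy-xz r 1# (a * r) ⟨
      r * (1# - a * r)    ∎
    step : (1# - r * a) * (r * b * a) ≈ r * a
    step = begin
      (1# - r * a) * (r * b * a)    ≈⟨ *-assoc _ (r * b) a ⟨
      (1# - r * a) * (r * b) * a    ≈⟨ *-congʳ (*-assoc _ r b) ⟨
      (1# - r * a) * r * b * a      ≈⟨ *-congʳ (*-congʳ slide) ⟩
      r * (1# - a * r) * b * a      ≈⟨ *-congʳ (*-assoc r _ b) ⟩
      r * ((1# - a * r) * b) * a    ≈⟨ *-congʳ (*-congˡ eq) ⟩
      r * 1# * a                    ≈⟨ *-congʳ (*-identityʳ r) ⟩
      r * a                         ∎

  -- Maximality is given as Rx + I = R for every x outside I. This is the form in which it arises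
  -- from a simple quotient of codes, and the form in which it is applied.
  record MaximalLeftIdeal (I : Subset q) : Set (c Level.⊔ ℓ) where
    field
      ideal    : LeftIdeals.IsSubmodule I
      proper   : ¬ (1# ∈ I)
      coprime  : ∀ {x} → ¬ (x ∈ I) → ∃ λ r → (1# - r * x) ∈ I
    open LeftIdeals.IsSubmodule ideal public

  -- This is the passage from right to left, `Rad` being the intersection of the maximal right
  -- ideals. If a were outside I, some 1 - ra would lie in I. That element has a right inverse by
  -- `quasi-inverse`, which is also a left inverse in a finite ring, so 1 would lie in I.
  Rad⊆maximal : ∀ {I} → MaximalLeftIdeal I → ∀ {a} → Rad a → a ∈ I
  Rad⊆maximal {I} I-max {a} a∈ with a ∈? I
  ... | yes a∈I = a∈I
  ... | no  a∉I =
    let open MaximalLeftIdeal I-max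
        r , 1-ra∈I = coprime a∉I
        b , eq = Rad-quasiregular a∈ r
    in contradiction (∈-resp (right-inverse⇒left-inverse (quasi-inverse eq)) (*-∈ Subset.∈⊤ 1-ra∈I)) proper

  private
    ∈-annihilator : Subset q → Property (c Level.⊔ ℓ)
    ∈-annihilator I = record
      { holds  = λ s → ∀ i → i ∈ I → i * s ≈ 0#
      ; holds? = λ s → all? (λ i → (i ∈? I) →-dec (i * s ≈? 0#))
          (λ i≈j h j∈I → ≈-trans (*-congʳ (≈-sym i≈j)) (h (∈-resp (≈-sym i≈j) j∈I)))
      ; resp   = λ s≈t h i i∈I → ≈-trans (*-congˡ (≈-sym s≈t)) (h i i∈I)
      }

  annihilator : Subset q → Subset q
  annihilator I = comprehension (∈-annihilator I)

  ∈-annihilator⁺ : ∀ {I s} → (∀ i → i ∈ I → i * s ≈ 0#) → s ∈ annihilator I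
  ∈-annihilator⁺ {I} = ∈-comprehension⁺ (∈-annihilator I)

  ∈-annihilator⁻ : ∀ {I s} → s ∈ annihilator I → ∀ i → i ∈ I → i * s ≈ 0#
  ∈-annihilator⁻ {I} = ∈-comprehension⁻ (∈-annihilator I)

  -- For nonzero s the map r ↦ rs identifies R/I with Rs, so Rs is a minimal left ideal. Concretely,
  -- a nonzero rs has r outside I; with 1 - r′r in I this gives s = r′(rs), so any nonzero left
  -- ideal inside Rs contains s.
  annihilator⊆Soc : ∀ {I} → MaximalLeftIdeal I → ∀ {s} → (∀ i → i ∈ I → i * s ≈ 0#) → Soc IsLeftIdeal s
  annihilator⊆Soc {I} I-max {s} Is≈0 with s ≈? 0#
  ... | yes s≈0 = [] , [] , s≈0
  ... | no  s≉0 = s ∷ [] , (Rs , minimal , LeftCyclic.generator-∈ s) ∷ [] , ≈-sym (+-identityʳ s)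
    where
    open MaximalLeftIdeal I-max
    Rs = LeftIdeals.span s
    zero⊆ : ∀ {J} → IsLeftIdeal J → ⁅ to 0# ⁆ Subset.⊆ J
    zero⊆ {J} J-ideal x∈ = subst (Subset._∈ J) (≡.sym (Subset.x∈⁅y⁆⇒x≡y _ x∈)) (IsLeftIdeal.0-∈ J-ideal)
    minimal : IsMinimal IsLeftIdeal Rs
    minimal = toLeftIdeal (LeftCyclic.span-isSubmodule s)
      , (λ Rs≡0 → s≉0 (to-injective (Subset.x∈⁅y⁆⇒x≡y _ (subst (s ∈_) Rs≡0 (LeftCyclic.generator-∈ s)))))
      , below
      where
      below : ∀ J → IsLeftIdeal J → J Subset.⊆ Rs → J ≡ ⁅ to 0# ⁆ ⊎ J ≡ Rs
      below J J-ideal J⊆Rs with Fin.any? (λ k → (k Subset.∈? J) ×-dec ¬? (from k ≈? 0#))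
      ... | no none = inj₁ (Subset.⊆-antisym
              (λ {k} k∈J → subst (Subset._∈ ⁅ to 0# ⁆)
                (≡.trans (Inverse.to-cong enum (≈-sym (decidable-stable (from k ≈? 0#) (λ k≉0 → none (k , k∈J , k≉0)))))
                  (Inverse.strictlyInverseˡ enum k)) (Subset.x∈⁅x⁆ (to 0#)))
              (zero⊆ J-ideal))
      ... | yes (k , k∈J , k≉0) = inj₂ (Subset.⊆-antisym J⊆Rs
              (⊆-intro (LeftCyclic.span-least s (fromLeftIdeal J-ideal) s∈J)))
        where
        decomposition = LeftIdeals.∈-span⁻ (∈-from (J⊆Rs k∈J))
        r = proj₁ decomposition
        y≈rs : from k ≈ r * s
        y≈rs = proj₂ (proj₂ decomposition)
        r∉I : ¬ (r ∈ I)
        r∉I r∈I = k≉0 (≈-trans y≈rs (Is≈0 r r∈I))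
        r′ = proj₁ (coprime r∉I)
        s≈ : r′ * from k ≈ s
        s≈ = ≈-sym (begin
          s                               ≈⟨ *-identityˡ s ⟨
          1# * s                          ≈⟨ *-congʳ (difference-cancel 1# (r′ * r)) ⟨
          ((1# - r′ * r) + r′ * r) * s    ≈⟨ distribʳ s _ _ ⟩
          (1# - r′ * r) * s + r′ * r * s  ≈⟨ +-congʳ (Is≈0 _ (proj₂ (coprime r∉I))) ⟩
          0# + r′ * r * s                 ≈⟨ +-identityˡ _ ⟩
          r′ * r * s                      ≈⟨ *-assoc r′ r s ⟩
          r′ * (r * s)                    ≈⟨ *-congˡ y≈rs ⟨
          r′ * from k                     ∎)
        s∈J : s ∈ J
        s∈J = ∈-resp s≈ (IsLeftIdeal.*-∈ J-ideal r′ (∈-from k∈J))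

  -- An isomorphism of left modules from R/Rad(R) to the socle is x ↦ xg, where g is the image of 1.
  -- Its well-definedness, injectivity and surjectivity are the three fields.
  record SocleGenerator (g : Carrier) : Set (c Level.⊔ ℓ) where
    field
      Rad⇒kills : ∀ {x} → Rad x → x * g ≈ 0#
      kills⇒Rad : ∀ {x} → x * g ≈ 0# → Rad x
      generates : ∀ {s} → Soc IsLeftIdeal s → ∃ λ x → x * g ≈ s

  open LeftModuleMorphisms R/Rad-left Soc-left using (IsLeftModuleIsomorphism)

  socle-generator : ∃ IsLeftModuleIsomorphism → ∃ SocleGenerator
  socle-generator (φ , iso) = g , record
    { Rad⇒kills = λ {x} x∈ → ≈-trans (≈-sym (φ≈ x))
        (≈-trans (⟦⟧-cong (Rad-resp (≈-sym (difference-ε x)) x∈)) (≈-trans (φ≈ 0#) (zeroˡ g)))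
    ; kills⇒Rad = λ {x} xg≈0 → Rad-resp (difference-ε x)
        (injective (≈-trans (φ≈ x) (≈-trans xg≈0 (≈-trans (≈-sym (zeroˡ g)) (≈-sym (φ≈ 0#))))))
    ; generates = λ {s} s∈ →
        let x , x↦s = surjective (s , s∈)
        in x , ≈-trans (≈-sym (φ≈ x)) (x↦s (Rad-resp (≈-sym (-‿inverseʳ x)) Rad-0))
    }
    where
    open IsLeftModuleIsomorphism iso
    g = proj₁ (φ 1#)
    φ≈ : ∀ x → proj₁ (φ x) ≈ x * g
    φ≈ x = ≈-trans
      (⟦⟧-cong (Rad-resp (≈-sym (≈-trans (+-congˡ (-‿cong (*-identityʳ x))) (-‿inverseʳ x))) Rad-0))
      (*ₗ-homo x 1#)

-- `J` is Rad(R), written as the left annihilator of g. `K` consists of the x with Ix inside Rad(R),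
-- and `E` is the idealizer of I. Since x ↦ xg has kernel `J`, the order of ann(I) is at most |K| /
-- |J|, and what remains is |K| |I| ≤ |J| q. For this, `K` is paired with R by the product modulo I,
-- whose values lie in E/I. A submodule `Y` climbs from I to R one generator at a time while
-- `perp Y` shrinks from `K` to `J`.
module MaximalLeftIdealBound {c ℓ} (R : Ring c ℓ) {q} (enum : Enumeration R q)
    {g} (generator : FiniteRing.SocleGenerator R enum g)
    {I : Subset q} (I-maximal : FiniteRing.MaximalLeftIdeal R enum I) where
  open Ring R renaming (refl to ≈-refl; sym to ≈-sym; trans to ≈-trans)
  open RingProperties R using ([y-z]x≈yx-zx; x[y-z]≈xy-xz)
  open FiniteRing R enum
  open Frobenius R enum using (Rad)
  open SocleGenerator generator
  private module I = MaximalLeftIdeal I-maximal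
  open SetoidReasoning setoid

  private
    ∈-J : Property ℓ
    ∈-J = record
      { holds = λ x → x * g ≈ 0# ; holds? = λ x → x * g ≈? 0#
      ; resp = λ x≈y xg≈0 → ≈-trans (*-congʳ (≈-sym x≈y)) xg≈0 }

    ∈-E : Property c
    ∈-E = record
      { holds  = λ b → ∀ i → i ∈ I → i * b ∈ I
      ; holds? = λ b → all? (λ i → (i ∈? I) →-dec (i * b ∈? I))
          (λ i≈j h j∈I → ∈-resp (*-congʳ i≈j) (h (∈-resp (≈-sym i≈j) j∈I)))
      ; resp   = λ b≈b′ h i i∈I → ∈-resp (*-congˡ b≈b′) (h i i∈I)
      }

    ∈-K : Property (c Level.⊔ ℓ)
    ∈-K = record
      { holds  = λ x → ∀ i → i ∈ I → i * x * g ≈ 0#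
      ; holds? = λ x → all? (λ i → (i ∈? I) →-dec (i * x * g ≈? 0#))
          (λ i≈j h j∈I → ≈-trans (*-congʳ (*-congʳ (≈-sym i≈j))) (h (∈-resp (≈-sym i≈j) j∈I)))
      ; resp   = λ x≈y h i i∈I → ≈-trans (*-congʳ (*-congˡ (≈-sym x≈y))) (h i i∈I)
      }

    J E K : Subset q
    J = comprehension ∈-J
    E = comprehension ∈-E
    K = comprehension ∈-K

    ∈-perp : Subset q → Property c
    ∈-perp Y = record
      { holds  = λ x → x ∈ K × (∀ y → y ∈ Y → x * y ∈ I)
      ; holds? = λ x → (x ∈? K) ×-dec all? (λ y → (y ∈? Y) →-dec (x * y ∈? I))
          (λ y≈z h z∈Y → ∈-resp (*-congˡ y≈z) (h (∈-resp (≈-sym y≈z) z∈Y)))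
      ; resp   = λ x≈x′ (x∈K , h) → ∈-resp x≈x′ x∈K , λ y y∈Y → ∈-resp (*-congʳ x≈x′) (h y y∈Y)
      }

    perp : Subset q → Subset q
    perp Y = comprehension (∈-perp Y)

    module EM = RightModules E

    I⊆E : ∀ {x} → x ∈ I → x ∈ E
    I⊆E x∈I = ∈-comprehension⁺ ∈-E λ i _ → I.*-∈ Subset.∈⊤ x∈I

    I-isSubmodule : EM.IsSubmodule I
    I-isSubmodule = record
      { 0-∈ = I.0-∈ ; +-∈ = I.+-∈ ; neg-∈ = I.neg-∈
      ; *-∈ = λ s∈E x∈I → ∈-comprehension⁻ ∈-E s∈E _ x∈I }

    E-isSubring : EM.IsSubring
    E-isSubring = record
      { 0#-∈ = I⊆E I.0-∈
      ; 1#-∈ = ∈-comprehension⁺ ∈-E λ i i∈I → ∈-resp (≈-sym (*-identityʳ i)) i∈I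
      ; +-∈ = λ s∈ r∈ → ∈-comprehension⁺ ∈-E λ i i∈I → ∈-resp (≈-sym (distribˡ i _ _))
          (I.+-∈ (EM.IsSubmodule.*-∈ I-isSubmodule s∈ i∈I) (EM.IsSubmodule.*-∈ I-isSubmodule r∈ i∈I))
      ; neg-∈ = λ s∈ → ∈-comprehension⁺ ∈-E λ i i∈I → ∈-resp (-‿distribʳ-* i _)
          (I.neg-∈ (EM.IsSubmodule.*-∈ I-isSubmodule s∈ i∈I))
      ; *-∈ = λ s∈ r∈ → ∈-comprehension⁺ ∈-E λ i i∈I → ∈-resp (*-assoc i _ _)
          (EM.IsSubmodule.*-∈ I-isSubmodule s∈ (EM.IsSubmodule.*-∈ I-isSubmodule r∈ i∈I))
      }
      where open RingProperties R using (-‿distribʳ-*)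

    module EC = EM.Cyclic E-isSubring

    -- E/I is the endomorphism ring of the simple module R/I, hence a division ring.
    E-inverse : ∀ {b} → b ∈ E → ¬ (b ∈ I) → ∃ λ r → r ∈ E × b * r - 1# ∈ I
    E-inverse {b} b∈E b∉I = r , ∈-comprehension⁺ ∈-E ir∈I , cancel (∈-resp (≈-sym brb-b) (I.*-∈ Subset.∈⊤ rb-1∈I))
      where
      r = proj₁ (I.coprime b∉I)
      rb-1∈I : r * b - 1# ∈ I
      rb-1∈I = ∈-resp (AbelianGroupProperties.⁻¹-anti-homo-// +-abelianGroup 1# (r * b))
        (I.neg-∈ (proj₂ (I.coprime b∉I)))
      -- Right multiplication by b is a nonzero endomorphism of the simple module R/I, hence
      -- injective. This puts r into `E` and turns the left inverse r of b modulo I into a right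
      -- inverse.
      cancel : ∀ {a} → a * b ∈ I → a ∈ I
      cancel {a} ab∈I with a ∈? I
      ... | yes a∈I = a∈I
      ... | no  a∉I =
        let s , 1-sa∈I = I.coprime a∉I
        in contradiction
             (I.∈-from-difference
               (∈-resp (≈-trans ([y-z]x≈yx-zx b 1# (s * a)) (+-cong (*-identityˡ b) (-‿cong (*-assoc s a b))))
                 (EM.IsSubmodule.*-∈ I-isSubmodule b∈E 1-sa∈I))
               (I.*-∈ Subset.∈⊤ ab∈I))
             b∉I
      ir∈I : ∀ i → i ∈ I → i * r ∈ I
      ir∈I i i∈I = cancel (I.∈-from-difference
        (∈-resp (≈-trans (x[y-z]≈xy-xz i (r * b) 1#) (+-cong (≈-sym (*-assoc i r b)) (-‿cong (*-identityʳ i))))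
          (I.*-∈ Subset.∈⊤ rb-1∈I)) i∈I)
      brb-b : (b * r - 1#) * b ≈ b * (r * b - 1#)
      brb-b = begin
        (b * r - 1#) * b      ≈⟨ [y-z]x≈yx-zx b (b * r) 1# ⟩
        b * r * b - 1# * b    ≈⟨ +-cong (*-assoc b r b) (-‿cong (≈-trans (*-identityˡ b) (≈-sym (*-identityʳ b)))) ⟩
        b * (r * b) - b * 1#  ≈⟨ x[y-z]≈xy-xz b (r * b) 1# ⟨
        b * (r * b - 1#)      ∎

    -- The map x ↦ xy modulo I sends `perp Y` into E/I, because Ix lies in Rad(R) and therefore Ixy
    -- lies in I. If xy is in I, then so is xyE by definition of `E`, so the kernel is the `perp` of
    -- Y + yE.
    perp-shrink : ∀ Y y → EM.IsSubmodule Y →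
      ∣ perp Y ∣ ℕ.* ∣ I ∣ ℕ.≤ ∣ E ∣ ℕ.* ∣ perp (Y EM.⊕ EM.span y) ∣
    perp-shrink Y y Y-sub = relation-bound additive additive (λ x e → e - x * y ∈? I) (perp Y) _ E I
      (λ x x∈ → x * y , λ e e-xy∈I → E-difference e-xy∈I (xy∈E (proj₁ (∈-comprehension⁻ (∈-perp Y) x∈))) , e-xy∈I)
      (λ x x′ e x∈ x′∈ _ ρ ρ′ → ∈-comprehension⁺ (∈-perp _)
        ( K-difference (proj₁ (∈-comprehension⁻ (∈-perp Y) x∈)) (proj₁ (∈-comprehension⁻ (∈-perp Y) x′∈))
        , kills (proj₂ (∈-comprehension⁻ (∈-perp Y) x∈)) (proj₂ (∈-comprehension⁻ (∈-perp Y) x′∈))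
            (∈-resp (≈-trans (difference-cancelˡ (x * y) (x′ * y) e) (≈-sym ([y-z]x≈yx-zx y x x′)))
              (I.difference-∈ ρ′ ρ))))
      where
      E-difference : ∀ {e z} → e - z ∈ I → z ∈ E → e ∈ E
      E-difference e-z∈I z∈E = ∈-resp (difference-cancel _ _) (EM.IsSubring.+-∈ E-isSubring (I⊆E e-z∈I) z∈E)
      xy∈E : ∀ {x} → x ∈ K → x * y ∈ E
      xy∈E {x} x∈K = ∈-comprehension⁺ ∈-E λ i i∈I → ∈-resp (*-assoc i x y)
        (Rad⊆maximal I-maximal (Rad-* y (kills⇒Rad (∈-comprehension⁻ ∈-K x∈K i i∈I))))
      K-difference : ∀ {x x′} → x ∈ K → x′ ∈ K → x - x′ ∈ K
      K-difference {x} {x′} x∈ x′∈ = ∈-comprehension⁺ ∈-K λ i i∈I → begin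
        i * (x - x′) * g         ≈⟨ *-congʳ (x[y-z]≈xy-xz i x x′) ⟩
        (i * x - i * x′) * g     ≈⟨ [y-z]x≈yx-zx g (i * x) (i * x′) ⟩
        i * x * g - i * x′ * g   ≈⟨ +-cong (∈-comprehension⁻ ∈-K x∈ i i∈I) (-‿cong (∈-comprehension⁻ ∈-K x′∈ i i∈I)) ⟩
        0# - 0#                  ≈⟨ -‿inverseʳ 0# ⟩
        0#                       ∎
      kills : ∀ {x x′} → (∀ z → z ∈ Y → x * z ∈ I) → (∀ z → z ∈ Y → x′ * z ∈ I) →
        (x - x′) * y ∈ I → ∀ z → z ∈ (Y EM.⊕ EM.span y) → (x - x′) * z ∈ I
      kills {x} {x′} xY⊆I x′Y⊆I dy∈I z z∈ =
        let w , w∈ , z-w∈Y = EM.∈-⊕⁻ z∈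
            e , e∈ , w≈ye = EM.∈-span⁻ w∈
        in I.∈-from-difference
             (∈-resp (x[y-z]≈xy-xz (x - x′) z w)
               (∈-resp (≈-sym ([y-z]x≈yx-zx (z - w) x x′)) (I.difference-∈ (xY⊆I _ z-w∈Y) (x′Y⊆I _ z-w∈Y))))
             (∈-resp (≈-trans (*-assoc _ y e) (*-congˡ (≈-sym w≈ye)))
               (EM.IsSubmodule.*-∈ I-isSubmodule e∈ dy∈I))

    -- The map e ↦ ye from `E` to (Y + yE)/Y has its kernel inside I: an e outside I is invertible
    -- modulo I, and ye in Y would then bring y itself into Y.
    extension-bound : ∀ Y y → EM.IsSubmodule Y → (∀ {x} → x ∈ I → x ∈ Y) → ¬ (y ∈ Y) →
      ∣ E ∣ ℕ.* ∣ Y ∣ ℕ.≤ ∣ Y EM.⊕ EM.span y ∣ ℕ.* ∣ I ∣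
    extension-bound Y y Y-sub I⊆Y y∉Y = relation-bound additive additive (λ e z → z - y * e ∈? Y) E I _ Y
      (λ e e∈E → y * e , λ z z-ye∈Y → EM.∈-⊕⁺ (y * e) (EM.∈-span⁺ e e∈E) z-ye∈Y , z-ye∈Y)
      (λ e e′ z e∈ e′∈ _ ρ ρ′ → in-I (EM.IsSubring.+-∈ E-isSubring e∈ (EM.IsSubring.neg-∈ E-isSubring e′∈))
        (∈-resp (≈-trans (difference-cancelˡ (y * e) (y * e′) z) (≈-sym (x[y-z]≈xy-xz y e e′)))
          (Y.difference-∈ ρ′ ρ)))
      where
      module Y = EM.IsSubmodule Y-sub
      in-I : ∀ {b} → b ∈ E → y * b ∈ Y → b ∈ I
      in-I {b} b∈E yb∈Y with b ∈? I
      ... | yes b∈I = b∈I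
      ... | no  b∉I =
        let r , r∈E , br-1∈I = E-inverse b∈E b∉I
        in contradiction
          (∈-resp (≈-trans (+-congˡ (-‿cong (≈-trans (x[y-z]≈xy-xz y (b * r) 1#) (+-congˡ (-‿cong (*-identityʳ y))))))
              (difference-self (y * (b * r)) y))
            (Y.difference-∈ (∈-resp (*-assoc y b r) (Y.*-∈ r∈E yb∈Y)) (I⊆Y (I.*-∈ Subset.∈⊤ br-1∈I))))
          y∉Y

    rearrange : ∀ p y i e p′ y′ → p ℕ.* i ℕ.≤ e ℕ.* p′ → e ℕ.* y ℕ.≤ y′ ℕ.* i →
      .{{ℕ.NonZero (e ℕ.* i)}} → p ℕ.* y ℕ.≤ p′ ℕ.* y′
    rearrange p y i e p′ y′ pi≤ep′ ey≤y′i = ℕ.*-cancelʳ-≤ _ _ (e ℕ.* i) (ℕ.≤-trans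
      (ℕ.≤-reflexive (solve 4 (λ p y e i → p :* y :* (e :* i) := p :* i :* (e :* y)) refl p y e i))
      (ℕ.≤-trans (ℕ.*-mono-≤ pi≤ep′ ey≤y′i)
        (ℕ.≤-reflexive (solve 4 (λ e p′ y′ i → e :* p′ :* (y′ :* i) := p′ :* y′ :* (e :* i)) refl e p′ y′ i))))
      where open +-*-Solver

    instance
      I-nonZero : ℕ.NonZero ∣ I ∣
      I-nonZero = member⇒nonZero I.0-∈

      E-nonZero : ℕ.NonZero ∣ E ∣
      E-nonZero = member⇒nonZero (EM.IsSubring.0#-∈ E-isSubring)

      J-nonZero : ℕ.NonZero ∣ J ∣
      J-nonZero = member⇒nonZero (∈-comprehension⁺ ∈-J (zeroˡ g))

    -- Here xR lies in I and Ix lies in Rad(R), so xRx lies in Rad(R) and `Rad-semiprime` applies.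
    perp-⊤⊆J : ∀ {Y} → (∀ y → y ∈ Y) → ∀ {x} → x ∈ perp Y → x ∈ J
    perp-⊤⊆J {Y} all∈Y {x} x∈ =
      let x∈K , xY⊆I = ∈-comprehension⁻ (∈-perp Y) x∈
      in ∈-comprehension⁺ ∈-J (Rad⇒kills (Rad-semiprime λ r →
           kills⇒Rad (∈-comprehension⁻ ∈-K x∈K (x * r) (xY⊆I r (all∈Y r)))))

    -- Adding a generator multiplies |Y| by at least |E/I| and divides |perp Y| by at most that
    -- number. So the product does not decrease on the way up to Y = R, where it is bounded by |J|
    -- q.
    perp-bound : ∀ fuel Y → q ℕ.≤ ∣ Y ∣ ℕ.+ fuel → EM.IsSubmodule Y → (∀ {x} → x ∈ I → x ∈ Y) →
      ∣ perp Y ∣ ℕ.* ∣ Y ∣ ℕ.≤ ∣ J ∣ ℕ.* q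
    perp-bound fuel Y q≤ Y-sub I⊆Y with Fin.any? (λ k → ¬? (k Subset.∈? Y))
    ... | no none = ℕ.*-mono-≤
            (Subset.p⊆q⇒∣p∣≤∣q∣ (⊆-intro {B = J} (perp-⊤⊆J λ y → decidable-stable (y ∈? Y) (λ y∉ → none (to y , y∉)))))
            (Subset.∣p∣≤n Y)
    ... | yes (k , k∉Y) = go fuel q≤
      where
      y = from k
      y∉Y : ¬ (y ∈ Y)
      y∉Y = k∉Y ∘ ∈-from⁻
      Y′ = Y EM.⊕ EM.span y
      Y⊆Y′ : ∀ {x} → x ∈ Y → x ∈ Y′
      Y⊆Y′ = EM.⊆-⊕ˡ (EC.span-isSubmodule y)
      Y<Y′ : ∣ Y ∣ ℕ.< ∣ Y′ ∣
      Y<Y′ = proper⇒∣-∣< (⊆-intro Y⊆Y′) (∈-from⁻ (EM.⊆-⊕ʳ Y-sub (EC.generator-∈ y))) k∉Y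
      go : ∀ fuel → q ℕ.≤ ∣ Y ∣ ℕ.+ fuel → ∣ perp Y ∣ ℕ.* ∣ Y ∣ ℕ.≤ ∣ J ∣ ℕ.* q
      go zero q≤ = contradiction (ℕ.≤-trans Y<Y′ (Subset.∣p∣≤n Y′))
        (ℕ.≤⇒≯ (ℕ.≤-trans q≤ (ℕ.≤-reflexive (ℕ.+-identityʳ _))))
      go (suc fuel) q≤ = ℕ.≤-trans
        (rearrange (∣ perp Y ∣) (∣ Y ∣) (∣ I ∣) (∣ E ∣) (∣ perp Y′ ∣) (∣ Y′ ∣)
          (perp-shrink Y y Y-sub) (extension-bound Y y Y-sub I⊆Y y∉Y)
          {{ℕ.m*n≢0 (∣ E ∣) (∣ I ∣)}})
        (perp-bound fuel Y′ (+-fuel Y<Y′ q≤)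
          (EM.⊕-isSubmodule Y-sub (EC.span-isSubmodule y)) (Y⊆Y′ ∘ I⊆Y))

    K-bound : ∣ K ∣ ℕ.* ∣ I ∣ ℕ.≤ ∣ J ∣ ℕ.* q
    K-bound = ℕ.≤-trans
      (ℕ.*-monoˡ-≤ (∣ I ∣) (Subset.p⊆q⇒∣p∣≤∣q∣ {p = K} {q = perp I} (⊆-intro {B = perp I} λ x∈K →
        ∈-comprehension⁺ (∈-perp I) (x∈K , λ _ → I.*-∈ Subset.∈⊤))))
      (perp-bound q I (ℕ.m≤n+m q _) I-isSubmodule (λ x∈I → x∈I))

    -- Every s in ann(I) lies in the socle, so s = x₀g for some x₀, and the whole coset x₀ + J maps
    -- to s. Its members belong to `K` because Is = 0.
    annihilator-bound : ∣ annihilator I ∣ ℕ.* ∣ J ∣ ℕ.≤ ∣ K ∣ ℕ.* ∣ ⁅ to 0# ⁆ ∣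
    annihilator-bound = relation-bound additive additive (λ s x → x * g ≈? s) (annihilator I) ⁅ to 0# ⁆ K J
      (λ s s∈ →
        let Is≈0 = ∈-annihilator⁻ s∈
            x₀ , x₀g≈s = generates (annihilator⊆Soc I-maximal Is≈0)
        in x₀ , λ y y-x₀∈J →
          let yg≈s = begin
                y * g                    ≈⟨ *-congʳ (difference-cancel y x₀) ⟨
                ((y - x₀) + x₀) * g      ≈⟨ distribʳ g _ _ ⟩
                (y - x₀) * g + x₀ * g    ≈⟨ +-cong (∈-comprehension⁻ ∈-J y-x₀∈J) x₀g≈s ⟩
                0# + s                   ≈⟨ +-identityˡ s ⟩
                s                        ∎
          in ∈-comprehension⁺ ∈-K (λ i i∈I →
               ≈-trans (*-assoc i y g) (≈-trans (*-congˡ yg≈s) (Is≈0 i i∈I))) , yg≈s)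
      (λ s s′ x _ _ _ xg≈s xg≈s′ → subst (Subset._∈ ⁅ to 0# ⁆)
        (Inverse.to-cong enum (≈-sym (≈-trans (+-congʳ (≈-trans (≈-sym xg≈s) xg≈s′)) (-‿inverseʳ s′))))
        (Subset.x∈⁅x⁆ (to 0#)))

  annihilator-size : ∣ annihilator I ∣ ℕ.* ∣ I ∣ ℕ.≤ q
  annihilator-size = ℕ.*-cancelˡ-≤ (∣ J ∣) (ℕ.≤-trans
    (ℕ.≤-reflexive (solve 3 (λ j r i → j :* (r :* i) := r :* j :* i) refl (∣ J ∣) (∣ annihilator I ∣) (∣ I ∣)))
    (ℕ.≤-trans (ℕ.*-monoˡ-≤ (∣ I ∣) annihilator≤K) K-bound))
    where
    open +-*-Solver
    annihilator≤K : ∣ annihilator I ∣ ℕ.* ∣ J ∣ ℕ.≤ ∣ K ∣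
    annihilator≤K = ℕ.≤-trans annihilator-bound
      (ℕ.≤-reflexive (≡.trans (cong (∣ K ∣ ℕ.*_) (Subset.∣⁅x⁆∣≡1 (to 0#))) (ℕ.*-identityʳ _)))

-- Duality of codes

funToFin-cong : ∀ {m n} {f g : Fin m → Fin n} → (∀ k → f k ≡ g k) → funToFin f ≡ funToFin g
funToFin-cong {zero}  f≗g = refl
funToFin-cong {suc m} f≗g = cong₂ combine (f≗g Fin.zero) (funToFin-cong (f≗g ∘ Fin.suc))

module Vectors {c ℓ} (R : Ring c ℓ) {q} (enum : Enumeration R q) where
  open Ring R renaming (refl to ≈-refl; sym to ≈-sym; trans to ≈-trans)
  open Coding R enum public
  open FiniteRing R enum using (additive; annihilator; ∈-annihilator⁺; MaximalLeftIdeal; SocleGenerator)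
  module R-Sums = Sums +-commutativeMonoid
  open R-Sums public using (sum)
  open SetoidReasoning setoid

  vectorModule : ℕ → LeftModule R c ℓ
  vectorModule n = record
    { Carrierᴹ = V n ; _≈ᴹ_ = _≋_ ; _+ᴹ_ = λ u v i → u i + v i ; _*ₗ_ = λ r v i → r * v i
    ; 0ᴹ = λ _ → 0# ; -ᴹ_ = λ v i → - v i
    ; isLeftModule = record
      { isLeftSemimodule = record
        { +ᴹ-isCommutativeMonoid = record
          { isMonoid = record
            { isSemigroup = record
              { isMagma = record
                { isEquivalence = record
                  { refl = λ _ → ≈-refl ; sym = λ p i → ≈-sym (p i) ; trans = λ p r i → ≈-trans (p i) (r i) }
                ; ∙-cong = λ p r i → +-cong (p i) (r i) }
              ; assoc = λ u v w i → +-assoc (u i) (v i) (w i) }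
            ; identity = (λ u i → +-identityˡ (u i)) , (λ u i → +-identityʳ (u i)) }
          ; comm = λ u v i → +-comm (u i) (v i) }
        ; isPreleftSemimodule = record
          { *ₗ-cong = λ p r i → *-cong p (r i)
          ; *ₗ-zeroˡ = λ u i → zeroˡ (u i)
          ; *ₗ-distribʳ = λ u r s i → distribʳ (u i) r s
          ; *ₗ-identityˡ = λ u i → *-identityˡ (u i)
          ; *ₗ-assoc = λ r s u i → *-assoc r s (u i)
          ; *ₗ-zeroʳ = λ r i → zeroʳ r
          ; *ₗ-distribˡ = λ r u v i → distribˡ r (u i) (v i) } }
      ; -ᴹ‿cong = λ p i → -‿cong (p i)
      ; -ᴹ‿inverse = (λ u i → -‿inverseˡ (u i)) , (λ u i → -‿inverseʳ (u i)) } }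

  enumerationⱽ : ∀ n → Inverse (LeftModule.≈ᴹ-setoid (vectorModule n)) (≡.setoid (Fin (q ℕ.^ n)))
  enumerationⱽ n = record
    { to = position ; from = vector
    ; to-cong = λ u≋v → funToFin-cong (λ i → Inverse.to-cong enum (u≋v i))
    ; from-cong = λ { refl i → ≈-refl }
    ; inverse = (λ {k} v≋ → ≡.trans (funToFin-cong (λ i → Inverse.to-cong enum (v≋ i))) (position-vector k))
              , (λ { {v} refl → vector-position v }) }
    where
    position-vector : ∀ k → position (vector {n} k) ≡ k
    position-vector k = ≡.trans (funToFin-cong {n} (λ i → Inverse.strictlyInverseˡ enum _))
      (Fin.funToFin-finToFin {n} {q} k)

  ⟨⟩≡sum : ∀ {n} (u v : V n) → ⟨ u , v ⟩ ≡ sum (λ i → u i * v i)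
  ⟨⟩≡sum u v = ≡.sym (R-Sums.sum≡ _)

  opaque
    unfolding R-Sums.sum
    *-distribˡ-sum : ∀ {n} r (f : Fin n → Carrier) → r * sum f ≈ sum (λ i → r * f i)
    *-distribˡ-sum {n} r f = SemiringSum.*-distribˡ-sum semiring {n} r f

    *-distribʳ-sum : ∀ {n} r (f : Fin n → Carrier) → sum f * r ≈ sum (λ i → f i * r)
    *-distribʳ-sum {n} r f = SemiringSum.*-distribʳ-sum semiring {n} r f

  module _ {n : ℕ} where
    private
      via : ∀ {u v : V n} {x} → sum (λ i → u i * v i) ≈ x → ⟨ u , v ⟩ ≈ x
      via {u} {v} = ≈-trans (reflexive (⟨⟩≡sum u v))

      unvia : ∀ {u v : V n} → sum (λ i → u i * v i) ≈ ⟨ u , v ⟩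
      unvia {u} {v} = reflexive (≡.sym (⟨⟩≡sum u v))

    ⟨⟩-cong : ∀ {u u′ v v′ : V n} → u ≋ u′ → v ≋ v′ → ⟨ u , v ⟩ ≈ ⟨ u′ , v′ ⟩
    ⟨⟩-cong u≋ v≋ = via (≈-trans (R-Sums.sum-cong (λ i → *-cong (u≋ i) (v≋ i))) unvia)

    ⟨⟩-+ˡ : ∀ (u u′ v : V n) → ⟨ (λ i → u i + u′ i) , v ⟩ ≈ ⟨ u , v ⟩ + ⟨ u′ , v ⟩
    ⟨⟩-+ˡ u u′ v = via (≈-trans (R-Sums.sum-cong (λ i → distribʳ (v i) (u i) (u′ i)))
      (≈-trans (R-Sums.sum-∙ _ _) (+-cong unvia unvia)))

    ⟨⟩-+ʳ : ∀ (u v v′ : V n) → ⟨ u , (λ i → v i + v′ i) ⟩ ≈ ⟨ u , v ⟩ + ⟨ u , v′ ⟩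
    ⟨⟩-+ʳ u v v′ = via (≈-trans (R-Sums.sum-cong (λ i → distribˡ (u i) (v i) (v′ i)))
      (≈-trans (R-Sums.sum-∙ _ _) (+-cong unvia unvia)))

    ⟨⟩-*ˡ : ∀ r (u v : V n) → ⟨ (λ i → r * u i) , v ⟩ ≈ r * ⟨ u , v ⟩
    ⟨⟩-*ˡ r u v = via (≈-trans (R-Sums.sum-cong (λ i → *-assoc r (u i) (v i)))
      (≈-trans (≈-sym (*-distribˡ-sum r _)) (*-congˡ unvia)))

    ⟨⟩-0ʳ : ∀ (u : V n) → ⟨ u , (λ _ → 0#) ⟩ ≈ 0#
    ⟨⟩-0ʳ u = via (R-Sums.sum-ε (λ i → zeroʳ (u i)))

    ⟨⟩-0ˡ : ∀ (u : V n) → ⟨ (λ _ → 0#) , u ⟩ ≈ 0#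
    ⟨⟩-0ˡ u = via (R-Sums.sum-ε (λ i → zeroˡ (u i)))

    ⟨⟩-negʳ : ∀ (u v : V n) → ⟨ u , (λ i → - v i) ⟩ ≈ - ⟨ u , v ⟩
    ⟨⟩-negʳ u v = AbelianGroupProperties.inverseʳ-unique +-abelianGroup ⟨ u , v ⟩ ⟨ u , (λ i → - v i) ⟩
      (≈-trans (≈-sym (⟨⟩-+ʳ u v (λ i → - v i)))
        (≈-trans (⟨⟩-cong (λ _ → ≈-refl) (λ i → -‿inverseʳ (v i))) (⟨⟩-0ʳ u)))

    ⟨⟩-differenceʳ : ∀ (u v v′ : V n) → ⟨ u , (λ i → v i - v′ i) ⟩ ≈ ⟨ u , v ⟩ - ⟨ u , v′ ⟩
    ⟨⟩-differenceʳ u v v′ = ≈-trans (⟨⟩-+ʳ u v (λ i → - v′ i)) (+-congˡ (⟨⟩-negʳ u v′))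

    basis : Fin n → V n
    basis i j = R-Sums._when_ 1# (does (j Fin.≟ i))

    ⟨basis,⟩ : ∀ i (v : V n) → ⟨ basis i , v ⟩ ≈ v i
    ⟨basis,⟩ i v = via (≈-trans
      (R-Sums.sum-cong {g = λ j → R-Sums._when_ (v j) (does (j Fin.≟ i))}
        (λ j → pull (does (j Fin.≟ i)) (v j)))
      (R-Sums.sum-single v i))
      where
      pull : ∀ b x → R-Sums._when_ 1# b * x ≈ R-Sums._when_ x b
      pull true  x = *-identityˡ x
      pull false x = zeroˡ x

  module Subcodes (n : ℕ) = Submodules {S = R} enum (vectorModule n) (enumerationⱽ n) Subset.⊤

module VectorDuality {c ℓ} (R : Ring c ℓ) {q} (enum : Enumeration R q)
    {g} (generator : FiniteRing.SocleGenerator R enum g) (n : ℕ) where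
  open Ring R renaming (refl to ≈-refl; sym to ≈-sym; trans to ≈-trans)
  open Vectors R enum
  open FiniteRing R enum using (additive; annihilator; ∈-annihilator⁺; MaximalLeftIdeal)
  open Subcodes n
  private
    module RG = FiniteAbelianGroup additive
    module D  = Differences +-abelianGroup
    module DV = Differences (LeftModule.+ᴹ-abelianGroup (vectorModule n))
  open FiniteAbelianGroup group
    using (_∈_; _∈?_; ∈-resp; to; from; Property; comprehension; ∈-comprehension⁺; ∈-comprehension⁻;
      all?; any?; ⊆⁺; ∈-from; ∈-from⁻; to-injective)
  open SetoidReasoning setoid

  private
    N = q ℕ.^ n

    infixl 6 _-ⱽ_
    _-ⱽ_ : V n → V n → V n
    (u -ⱽ v) i = u i - v i

    scalars-whole : IsSubring
    scalars-whole = whole-isSubring (λ _ → Subset.∈⊤)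

    module C = Cyclic scalars-whole

    ∈-dual : Subset N → Property (c Level.⊔ ℓ)
    ∈-dual A = record
      { holds  = λ u → ∀ v → v ∈ A → ⟨ v , u ⟩ ≈ 0#
      ; holds? = λ u → all? (λ v → (v ∈? A) →-dec (⟨ v , u ⟩ ≟ 0#))
          (λ v≋w h w∈A → ≈-trans (⟨⟩-cong (λ i → ≈-sym (v≋w i)) (λ _ → ≈-refl))
            (h (∈-resp (λ i → ≈-sym (v≋w i)) w∈A)))
      ; resp   = λ u≋w h v v∈A → ≈-trans (⟨⟩-cong (λ _ → ≈-refl) (λ i → ≈-sym (u≋w i))) (h v v∈A)
      }

  dual : Subset N → Subset N
  dual A = comprehension (∈-dual A)

  ∈-dual⁺ : ∀ {A u} → (∀ v → v ∈ A → ⟨ v , u ⟩ ≈ 0#) → u ∈ dual A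
  ∈-dual⁺ {A} = ∈-comprehension⁺ (∈-dual A)

  ∈-dual⁻ : ∀ {A u} → u ∈ dual A → ∀ v → v ∈ A → ⟨ v , u ⟩ ≈ 0#
  ∈-dual⁻ {A} = ∈-comprehension⁻ (∈-dual A)

  private
    combine-bounds : ∀ dA a r dB b i → dA ℕ.≤ r ℕ.* dB → q ℕ.* a ℕ.≤ b ℕ.* i → r ℕ.* i ℕ.≤ q →
      .{{ℕ.NonZero i}} → dA ℕ.* a ℕ.≤ dB ℕ.* b
    combine-bounds dA a r dB b i dA≤ qa≤ ri≤ = ℕ.*-cancelʳ-≤ _ _ i
      (ℕ.≤-trans (ℕ.*-monoˡ-≤ i (ℕ.*-monoˡ-≤ a dA≤))
      (ℕ.≤-trans (ℕ.≤-reflexive (solve 4 (λ r dB a i → r :* dB :* a :* i := dB :* (r :* i :* a)) refl r dB a i))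
      (ℕ.≤-trans (ℕ.*-monoʳ-≤ dB (ℕ.≤-trans (ℕ.*-monoˡ-≤ a ri≤) qa≤))
        (ℕ.≤-reflexive (≡.sym (ℕ.*-assoc dB b i))))))
      where open +-*-Solver

    -- For B/A simple and generated by w, let I be the left ideal of all r with rw in A, so that B/A
    -- is R/I. The map u ↦ (w,u) sends the dual of A into ann(I) with kernel the dual of B, since B
    -- = A + Rw. Together with the bound |ann(I)| |I| ≤ q, the dual shrinks at most by the factor by
    -- which the code grows.
    module SimpleStep {A B : Subset N} (A-sub : IsSubmodule A) (B-sub : IsSubmodule B)
        (A⊆B : ∀ {x} → x ∈ A → x ∈ B) {w : V n} (w∈B : w ∈ B) (w∉A : ¬ (w ∈ A))
        (simple : ∀ {v} → v ∈ B → ¬ (v ∈ A) → ∀ {x} → x ∈ B → x ∈ (A ⊕ span v)) where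
      private
        module A = IsSubmodule A-sub
        module B = IsSubmodule B-sub

        ∈-I : RG.Property Level.zero
        ∈-I = record
          { holds = λ r → (λ i → r * w i) ∈ A ; holds? = λ r → (λ i → r * w i) ∈? A
          ; resp = λ r≈s → ∈-resp (λ i → *-congʳ r≈s) }

      I : Subset q
      I = RG.comprehension ∈-I

      I⁺ : ∀ {r} → (λ i → r * w i) ∈ A → r RG.∈ I
      I⁺ = RG.∈-comprehension⁺ ∈-I

      I⁻ : ∀ {r} → r RG.∈ I → (λ i → r * w i) ∈ A
      I⁻ = RG.∈-comprehension⁻ ∈-I

      I-maximal : MaximalLeftIdeal I
      I-maximal = record
        { ideal = record
          { 0-∈ = I⁺ (∈-resp (λ i → ≈-sym (zeroˡ (w i))) A.0-∈)
          ; +-∈ = λ r∈ s∈ → I⁺ (∈-resp (λ i → ≈-sym (distribʳ (w i) _ _)) (A.+-∈ (I⁻ r∈) (I⁻ s∈)))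
          ; neg-∈ = λ {r} r∈ → I⁺ (∈-resp (λ i → RingProperties.-‿distribˡ-* R r (w i)) (A.neg-∈ (I⁻ r∈)))
          ; *-∈ = λ {s} {r} _ r∈ → I⁺ (∈-resp (λ i → ≈-sym (*-assoc s r (w i))) (A.*-∈ {s} Subset.∈⊤ (I⁻ r∈)))
          }
        ; proper = λ 1∈ → w∉A (∈-resp (λ i → *-identityˡ (w i)) (I⁻ 1∈))
        ; coprime = λ {x} x∉I →
            let v , v∈ , w-v∈A = ∈-⊕⁻ (simple (B.*-∈ {x} Subset.∈⊤ w∈B) (x∉I ∘ I⁺) w∈B)
                r , _ , v≋ = ∈-span⁻ v∈
            in r , I⁺ (∈-resp (λ i → ≈-trans
                 (+-cong (≈-sym (*-identityˡ (w i))) (-‿cong (≈-trans (v≋ i) (≈-sym (*-assoc r x (w i))))))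
                 (≈-sym (RingProperties.[y-z]x≈yx-zx R (w i) 1# (r * x)))) w-v∈A)
        }

      dual-bound : ∣ dual A ∣ ℕ.* ∣ ⁅ RG.to 0# ⁆ ∣ ℕ.≤ ∣ annihilator I ∣ ℕ.* ∣ dual B ∣
      dual-bound = relation-bound group additive (λ u s → ⟨ w , u ⟩ ≟ s) (dual A) (dual B) (annihilator I) _
        (λ u u∈ → ⟨ w , u ⟩ , λ s s-wu∈0 →
          let s≈wu = begin
                s                                 ≈⟨ D.difference-cancel s ⟨ w , u ⟩ ⟨
                (s - ⟨ w , u ⟩) + ⟨ w , u ⟩        ≈⟨ +-congʳ (RG.to-injective (Subset.x∈⁅y⁆⇒x≡y _ s-wu∈0)) ⟩
                0# + ⟨ w , u ⟩                    ≈⟨ +-identityˡ _ ⟩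
                ⟨ w , u ⟩                         ∎
          in ∈-annihilator⁺ (λ r r∈I → ≈-trans (*-congˡ s≈wu)
               (≈-trans (≈-sym (⟨⟩-*ˡ r w u)) (∈-dual⁻ u∈ _ (I⁻ r∈I)))) , ≈-sym s≈wu)
        (λ u u′ s u∈ u′∈ _ wu≈s wu′≈s → ∈-dual⁺ λ v v∈B →
          let x , x∈ , v-x∈A = ∈-⊕⁻ (simple w∈B w∉A v∈B)
              r , _ , x≋ = ∈-span⁻ x∈
              z = u -ⱽ u′
              kills : ∀ y → ⟨ y , u ⟩ ≈ ⟨ y , u′ ⟩ → ⟨ y , z ⟩ ≈ 0#
              kills y eq = ≈-trans (⟨⟩-differenceʳ y u u′) (≈-trans (+-congʳ eq) (-‿inverseʳ _))
          in begin
            ⟨ v , z ⟩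
              ≈⟨ ⟨⟩-cong (DV.difference-cancel v x) (λ _ → ≈-refl) ⟨
            ⟨ (λ i → (v i - x i) + x i) , z ⟩
              ≈⟨ ⟨⟩-+ˡ (v -ⱽ x) x z ⟩
            ⟨ v -ⱽ x , z ⟩ + ⟨ x , z ⟩
              ≈⟨ +-cong (kills (v -ⱽ x) (≈-trans (∈-dual⁻ u∈ _ v-x∈A) (≈-sym (∈-dual⁻ u′∈ _ v-x∈A))))
                   (⟨⟩-cong x≋ (λ _ → ≈-refl)) ⟩
            0# + ⟨ (λ i → r * w i) , z ⟩
              ≈⟨ +-identityˡ _ ⟩
            ⟨ (λ i → r * w i) , z ⟩
              ≈⟨ ⟨⟩-*ˡ r w z ⟩
            r * ⟨ w , z ⟩
              ≈⟨ *-congˡ (kills w (≈-trans wu≈s (≈-sym wu′≈s))) ⟩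
            r * 0#
              ≈⟨ zeroʳ r ⟩
            0# ∎)

      index-bound : ∣ Subset.⊤ {q} ∣ ℕ.* ∣ A ∣ ℕ.≤ ∣ B ∣ ℕ.* ∣ I ∣
      index-bound = relation-bound additive group (λ r z → (z -ⱽ (λ i → r * w i)) ∈? A) Subset.⊤ I B A
        (λ r _ → (λ i → r * w i) , λ z d∈A → B.∈-from-difference (A⊆B d∈A) (B.*-∈ {r} Subset.∈⊤ w∈B) , d∈A)
        (λ r r′ z _ _ _ ρ ρ′ → I⁺ (∈-resp (λ i → ≈-trans (DV.difference-cancelˡ (λ i → r * w i) (λ i → r′ * w i) z i)
            (≈-sym (RingProperties.[y-z]x≈yx-zx R (w i) r r′))) (A.difference-∈ ρ′ ρ)))

      step : ∣ dual A ∣ ℕ.* ∣ A ∣ ℕ.≤ ∣ dual B ∣ ℕ.* ∣ B ∣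
      step = combine-bounds (∣ dual A ∣) (∣ A ∣) (∣ annihilator I ∣) (∣ dual B ∣) (∣ B ∣) (∣ I ∣)
        (≡.subst (ℕ._≤ ∣ annihilator I ∣ ℕ.* ∣ dual B ∣) (≡.trans (cong (∣ dual A ∣ ℕ.*_) (Subset.∣⁅x⁆∣≡1 (RG.to 0#))) (ℕ.*-identityʳ _)) dual-bound)
        (≡.subst (λ m → m ℕ.* ∣ A ∣ ℕ.≤ ∣ B ∣ ℕ.* ∣ I ∣) (Subset.∣⊤∣≡n q) index-bound)
        (MaximalLeftIdealBound.annihilator-size R enum generator I-maximal)
        {{member⇒nonZero (MaximalLeftIdeal.0-∈ I-maximal)}}

  -- If B/A is neither zero nor simple, some A + Rv lies strictly between A and B, and the claim
  -- composes from the two shorter intervals. The fuel bounds |B| - |A|, which drops for both.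
  dual-size-mono : ∀ fuel {A B} → ∣ B ∣ ℕ.≤ ∣ A ∣ ℕ.+ fuel → IsSubmodule A → IsSubmodule B →
    (∀ {x} → x ∈ A → x ∈ B) → ∣ dual A ∣ ℕ.* ∣ A ∣ ℕ.≤ ∣ dual B ∣ ℕ.* ∣ B ∣
  dual-size-mono fuel {A} {B} B≤ A-sub B-sub A⊆B
    with Fin.any? (λ k → (k Subset.∈? B) ×-dec ¬? (k Subset.∈? A))
  ... | no none = ℕ.≤-reflexive (cong (λ X → ∣ dual X ∣ ℕ.* ∣ X ∣) (Subset.⊆-antisym (⊆⁺ A⊆B)
          (λ {k} k∈B → decidable-stable (k Subset.∈? A) (λ k∉A → none (k , k∈B , k∉A)))))
  ... | yes (k , k∈B , k∉A)
    with Fin.any? (λ l → (l Subset.∈? B) ×-dec ¬? (l Subset.∈? A) ×-dec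
           Fin.any? (λ m → (m Subset.∈? B) ×-dec ¬? (m Subset.∈? (A ⊕ span (from l)))))
  ...   | no none = SimpleStep.step A-sub B-sub A⊆B (∈-from k∈B) (k∉A ∘ ∈-from⁻)
            λ {v} v∈B v∉A {x} x∈B → decidable-stable (x ∈? (A ⊕ span v)) λ x∉ →
              none (to v , v∈B , v∉A , to x , x∈B , λ x∈ → x∉ (⊕-least (⊕-isSubmodule A-sub (C.span-isSubmodule v))
                (⊆-⊕ˡ (C.span-isSubmodule v))
                (λ y∈ → ⊆-⊕ʳ A-sub (C.span-least (from (to v)) (C.span-isSubmodule v)
                  (∈-resp (λ i → ≈-sym (vector-position v i)) (C.generator-∈ v)) y∈))
                x∈))
  ...   | yes (l , l∈B , l∉A , m , m∈B , m∉C) = go fuel B≤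
    where
    C′ = A ⊕ span (from l)
    C-sub : IsSubmodule C′
    C-sub = ⊕-isSubmodule A-sub (C.span-isSubmodule (from l))
    A⊆C : ∀ {x} → x ∈ A → x ∈ C′
    A⊆C = ⊆-⊕ˡ (C.span-isSubmodule (from l))
    C⊆B : ∀ {x} → x ∈ C′ → x ∈ B
    C⊆B = ⊕-least B-sub A⊆B (C.span-least (from l) B-sub (∈-from l∈B))
    A<C : ∣ A ∣ ℕ.< ∣ C′ ∣
    A<C = proper⇒∣-∣< (⊆⁺ A⊆C) (∈-from⁻ (⊆-⊕ʳ A-sub (C.generator-∈ (from l)))) l∉A
    C<B : ∣ C′ ∣ ℕ.< ∣ B ∣
    C<B = proper⇒∣-∣< (⊆⁺ C⊆B) m∈B m∉C
    go : ∀ fuel → ∣ B ∣ ℕ.≤ ∣ A ∣ ℕ.+ fuel → ∣ dual A ∣ ℕ.* ∣ A ∣ ℕ.≤ ∣ dual B ∣ ℕ.* ∣ B ∣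
    go zero B≤ = contradiction (ℕ.≤-trans (ℕ.<-trans A<C C<B) (ℕ.≤-trans B≤ (ℕ.≤-reflexive (ℕ.+-identityʳ _))))
      (ℕ.<-irrefl refl)
    go (suc fuel) B≤ = ℕ.≤-trans
      (dual-size-mono fuel (ℕ.s≤s⁻¹ (ℕ.≤-trans C<B (ℕ.≤-trans B≤ (ℕ.≤-reflexive (ℕ.+-suc _ fuel))))) A-sub C-sub A⊆C)
      (dual-size-mono fuel (+-fuel A<C B≤) C-sub B-sub C⊆B)

  -- Monotonicity is pinned from both sides: the product is at least q^n for the zero code and at
  -- most q^n for the whole space, so it equals q^n in between.
  dual-size : ∀ {A} → IsSubmodule A → ∣ dual A ∣ ℕ.* ∣ A ∣ ≡ q ℕ.^ n
  dual-size {A} A-sub = ℕ.≤-antisym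
    (ℕ.≤-trans (dual-size-mono N (ℕ.≤-trans (Subset.∣p∣≤n Subset.⊤) (ℕ.m≤n+m N (∣ A ∣))) A-sub ⊤-sub (λ _ → Subset.∈⊤)) top)
    (ℕ.≤-trans bottom (dual-size-mono N (ℕ.≤-trans (Subset.∣p∣≤n A) (ℕ.m≤n+m N (∣ Z ∣))) Z-sub A-sub
      (λ x∈ → subst (Subset._∈ A) (≡.sym (Subset.x∈⁅y⁆⇒x≡y _ x∈)) (IsSubmodule.0-∈ A-sub))))
    where
    Z = ⁅ to (λ _ → 0#) ⁆
    Z⁺ : ∀ {x : V n} → x ≋ (λ _ → 0#) → x ∈ Z
    Z⁺ x≋0 = ∈-resp (λ i → ≈-sym (x≋0 i)) (Subset.x∈⁅x⁆ _)
    Z⁻ : ∀ {x : V n} → x ∈ Z → x ≋ (λ _ → 0#)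
    Z⁻ x∈ = to-injective (Subset.x∈⁅y⁆⇒x≡y _ x∈)
    Z-sub : IsSubmodule Z
    Z-sub = record
      { 0-∈ = Z⁺ (λ _ → ≈-refl)
      ; +-∈ = λ x∈ y∈ → Z⁺ λ i → ≈-trans (+-cong (Z⁻ x∈ i) (Z⁻ y∈ i)) (+-identityˡ 0#)
      ; neg-∈ = λ x∈ → Z⁺ λ i → ≈-trans (-‿cong (Z⁻ x∈ i)) (RingProperties.-0#≈0# R)
      ; *-∈ = λ {s} _ x∈ → Z⁺ λ i → ≈-trans (*-congˡ (Z⁻ x∈ i)) (zeroʳ s)
      }
    ⊤-sub : IsSubmodule Subset.⊤
    ⊤-sub = record { 0-∈ = Subset.∈⊤ ; +-∈ = λ _ _ → Subset.∈⊤ ; neg-∈ = λ _ → Subset.∈⊤ ; *-∈ = λ _ _ → Subset.∈⊤ }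
    top : ∣ dual Subset.⊤ ∣ ℕ.* ∣ Subset.⊤ {N} ∣ ℕ.≤ N
    top = ℕ.≤-trans (ℕ.*-mono-≤
      (ℕ.≤-trans (Subset.p⊆q⇒∣p∣≤∣q∣ (⊆⁺ {B = Z} λ {u} u∈ → Z⁺ λ i →
          ≈-trans (≈-sym (⟨basis,⟩ i u)) (∈-dual⁻ u∈ (basis i) Subset.∈⊤)))
        (ℕ.≤-reflexive (Subset.∣⁅x⁆∣≡1 (to (λ _ → 0#)))))
      (ℕ.≤-reflexive (Subset.∣⊤∣≡n N)))
      (ℕ.≤-reflexive (ℕ.*-identityˡ N))
    bottom : N ℕ.≤ ∣ dual Z ∣ ℕ.* ∣ Z ∣
    bottom = ℕ.≤-trans (⊤-cardinality-≤ (dual Z) (λ k → ∈-from⁻ (∈-dual⁺ λ v v∈ →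
        ≈-trans (⟨⟩-cong (Z⁻ v∈) (λ _ → ≈-refl)) (⟨⟩-0ˡ (from k)))))
      (ℕ.≤-reflexive (≡.sym (≡.trans (cong (∣ dual Z ∣ ℕ.*_) (Subset.∣⁅x⁆∣≡1 (to (λ _ → 0#)))) (ℕ.*-identityʳ _))))

-- Harmonic functions on subsets

-- Used over two rings: over ℝ, to compare with `γ`, and over ℝ[x,y], where enumerators are
-- evaluated at linear forms.
module SubsetFunctions {c ℓ} (𝓡 : CommutativeRing c ℓ) where
  open CommutativeRing 𝓡 renaming (refl to ≈-refl)
  open SemiringExp semiring using (_^_; ^-congˡ)
  open CommutativeSemiringExp commutativeSemiring using (^-distrib-*)
  open SemiringMult semiring using (×-congʳ; ×-homo-+; ×-assocˡ; ×-assoc-*; ×-comm-*)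
    renaming (_×_ to _·_)
  open CommutativeMonoidMult +-commutativeMonoid using (×-distrib-+)
  open RingProperties ring using (-1*x≈-x)
  module 𝓡-Sums = Sums +-commutativeMonoid
  open 𝓡-Sums using (sum; _when_)
  open SetoidReasoning setoid
  open NaturalSolver commutativeSemiring using (solve; _:+_; _:*_; _:=_; con)

  Weight : ℕ → Set c
  Weight t = Subset t → Carrier

  private
    variable
      t : ℕ

  -- The sum over all z of F z ∏_{i ∉ z} p i ∏_{i ∈ z} w i.
  evaluate : Weight t → (p w : Fin t → Carrier) → Carrier
  evaluate {zero}  F p w = F []
  evaluate {suc t} F p w =
    p Fin.zero * evaluate (F ∘ (outside ∷_)) (p ∘ Fin.suc) (w ∘ Fin.suc) +
    w Fin.zero * evaluate (F ∘ (inside  ∷_)) (p ∘ Fin.suc) (w ∘ Fin.suc)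

  evaluate₁ : Weight t → (Fin t → Carrier) → Carrier
  evaluate₁ F = evaluate F (λ _ → 1#)

  evaluate-cong : {F F′ : Weight t} {p p′ w w′ : Fin t → Carrier} → (∀ z → F z ≈ F′ z) →
    (∀ i → p i ≈ p′ i) → (∀ i → w i ≈ w′ i) → evaluate F p w ≈ evaluate F′ p′ w′
  evaluate-cong {zero}  F≈ p≈ w≈ = F≈ []
  evaluate-cong {suc t} F≈ p≈ w≈ = +-cong
    (*-cong (p≈ Fin.zero) (evaluate-cong (F≈ ∘ (outside ∷_)) (p≈ ∘ Fin.suc) (w≈ ∘ Fin.suc)))
    (*-cong (w≈ Fin.zero) (evaluate-cong (F≈ ∘ (inside  ∷_)) (p≈ ∘ Fin.suc) (w≈ ∘ Fin.suc)))

  evaluate-weight : {F F′ : Weight t} {p w : Fin t → Carrier} → (∀ z → F z ≈ F′ z) →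
    evaluate F p w ≈ evaluate F′ p w
  evaluate-weight F≈ = evaluate-cong F≈ (λ _ → ≈-refl) (λ _ → ≈-refl)

  evaluate₁-point : {F : Weight t} {w w′ : Fin t → Carrier} → (∀ i → w i ≈ w′ i) →
    evaluate₁ F w ≈ evaluate₁ F w′
  evaluate₁-point {F = F} w≈ = evaluate-cong {F = F} (λ _ → ≈-refl) (λ _ → ≈-refl) w≈

  evaluate-*ˡ : ∀ r (F : Weight t) p w → evaluate (λ z → r * F z) p w ≈ r * evaluate F p w
  evaluate-*ˡ {zero}  r F p w = ≈-refl
  evaluate-*ˡ {suc t} r F p w = trans
    (+-cong (*-congˡ (evaluate-*ˡ r (F ∘ (outside ∷_)) _ _)) (*-congˡ (evaluate-*ˡ r (F ∘ (inside ∷_)) _ _)))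
    (solve 5 (λ p r x w y → p :* (r :* x) :+ w :* (r :* y) := r :* (p :* x :+ w :* y)) ≈-refl
      (p Fin.zero) r _ (w Fin.zero) _)

  evaluate-+ : ∀ (F F′ : Weight t) p w →
    evaluate (λ z → F z + F′ z) p w ≈ evaluate F p w + evaluate F′ p w
  evaluate-+ {zero}  F F′ p w = ≈-refl
  evaluate-+ {suc t} F F′ p w = trans
    (+-cong (*-congˡ (evaluate-+ (F ∘ (outside ∷_)) (F′ ∘ (outside ∷_)) _ _))
            (*-congˡ (evaluate-+ (F ∘ (inside ∷_)) (F′ ∘ (inside ∷_)) _ _)))
    (solve 6 (λ p x x′ w y y′ → p :* (x :+ x′) :+ w :* (y :+ y′) :=
        (p :* x :+ w :* y) :+ (p :* x′ :+ w :* y′)) ≈-refl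
      (p Fin.zero) _ _ (w Fin.zero) _ _)

  evaluate₁-scale : ∀ r (F : Weight t) w →
    evaluate₁ F (λ i → r * w i) ≈ evaluate₁ (λ z → r ^ ∣ z ∣ * F z) w
  evaluate₁-scale {zero}  r F w = sym (*-identityˡ _)
  evaluate₁-scale {suc t} r F w = +-cong (*-congˡ (evaluate₁-scale r (F ∘ (outside ∷_)) _)) (begin
    r * w Fin.zero * evaluate₁ (F ∘ (inside ∷_)) _
      ≈⟨ *-congˡ (evaluate₁-scale r (F ∘ (inside ∷_)) _) ⟩
    r * w Fin.zero * evaluate₁ (λ z → r ^ ∣ z ∣ * F (inside ∷ z)) _
      ≈⟨ solve 3 (λ r w x → r :* w :* x := w :* (r :* x)) ≈-refl r _ _ ⟩
    w Fin.zero * (r * evaluate₁ (λ z → r ^ ∣ z ∣ * F (inside ∷ z)) _)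
      ≈⟨ *-congˡ (evaluate-*ˡ {t} r (λ z → r ^ ∣ z ∣ * F (inside ∷ z)) _ _) ⟨
    w Fin.zero * evaluate₁ (λ z → r * (r ^ ∣ z ∣ * F (inside ∷ z))) _
      ≈⟨ *-congˡ (evaluate-weight {t} (λ z → sym (*-assoc r (r ^ ∣ z ∣) (F (inside ∷ z))))) ⟩
    w Fin.zero * evaluate₁ (λ z → r ^ ∣ inside ∷ z ∣ * F (inside ∷ z)) _  ∎)

  -- up r F y is the sum over z ⊇ y of r^∣ z ∖ y ∣ F z, and the sum up-layer k F y
  -- is restricted to ∣ z ∖ y ∣ = k, so that up-layer 1 extends γ.
  up : Carrier → Weight t → Weight t
  up r F []            = F []
  up r F (inside  ∷ y) = up r (F ∘ (inside ∷_)) y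
  up r F (outside ∷ y) = up r (F ∘ (outside ∷_)) y + r * up r (F ∘ (inside ∷_)) y

  up-layer : ℕ → Weight t → Weight t
  up-layer zero    F y             = F y
  up-layer (suc k) F []            = 0#
  up-layer (suc k) F (inside  ∷ y) = up-layer (suc k) (F ∘ (inside ∷_)) y
  up-layer (suc k) F (outside ∷ y) = up-layer (suc k) (F ∘ (outside ∷_)) y + up-layer k (F ∘ (inside ∷_)) y

  -- Expanding the product of the w_i + r over z distributes F z over all y inside z, with one
  -- factor r for each element of z outside y.
  evaluate₁-shift : ∀ r (F : Weight t) w → evaluate₁ F (λ i → w i + r) ≈ evaluate₁ (up r F) w
  evaluate₁-shift {zero}  r F w = ≈-refl
  evaluate₁-shift {suc t} r F w = begin
    1# * evaluate₁ (F ∘ (outside ∷_)) _ + (w Fin.zero + r) * evaluate₁ (F ∘ (inside ∷_)) _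
      ≈⟨ +-cong (*-congˡ (evaluate₁-shift r (F ∘ (outside ∷_)) _)) (*-congˡ (evaluate₁-shift r (F ∘ (inside ∷_)) _)) ⟩
    1# * evaluate₁ (up r (F ∘ (outside ∷_))) _ + (w Fin.zero + r) * evaluate₁ (up r (F ∘ (inside ∷_))) _
      ≈⟨ solve 4 (λ x w r y → con 1 :* x :+ (w :+ r) :* y := con 1 :* (x :+ r :* y) :+ w :* y) ≈-refl _ _ r _ ⟩
    1# * (evaluate₁ (up r (F ∘ (outside ∷_))) _ + r * evaluate₁ (up r (F ∘ (inside ∷_))) _)
      + w Fin.zero * evaluate₁ (up r (F ∘ (inside ∷_))) _
      ≈⟨ +-congʳ (*-congˡ (trans
           (+-congˡ (sym (evaluate-*ˡ {t} r (up r (F ∘ (inside ∷_))) _ _)))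
           (sym (evaluate-+ {t} (up r (F ∘ (outside ∷_))) _ _ _)))) ⟩
    1# * evaluate₁ (up r F ∘ (outside ∷_)) _ + w Fin.zero * evaluate₁ (up r F ∘ (inside ∷_)) _  ∎

  up-layer-cong : ∀ k {F F′ : Weight t} → (∀ z → F z ≈ F′ z) → ∀ y → up-layer k F y ≈ up-layer k F′ y
  up-layer-cong zero    F≈ y             = F≈ y
  up-layer-cong (suc k) F≈ []            = ≈-refl
  up-layer-cong (suc k) F≈ (inside  ∷ y) = up-layer-cong (suc k) (F≈ ∘ (inside ∷_)) y
  up-layer-cong (suc k) F≈ (outside ∷ y) =
    +-cong (up-layer-cong (suc k) (F≈ ∘ (outside ∷_)) y) (up-layer-cong k (F≈ ∘ (inside ∷_)) y)

  up-layer-0 : ∀ k {F : Weight t} → (∀ z → F z ≈ 0#) → ∀ y → up-layer k F y ≈ 0#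
  up-layer-0 zero    F≈0 y             = F≈0 y
  up-layer-0 (suc k) F≈0 []            = ≈-refl
  up-layer-0 (suc k) F≈0 (inside  ∷ y) = up-layer-0 (suc k) (F≈0 ∘ (inside ∷_)) y
  up-layer-0 (suc k) F≈0 (outside ∷ y) =
    trans (+-cong (up-layer-0 (suc k) (F≈0 ∘ (outside ∷_)) y) (up-layer-0 k (F≈0 ∘ (inside ∷_)) y)) (+-identityˡ 0#)

  up-layer-+ : ∀ k (F F′ : Weight t) y →
    up-layer k (λ z → F z + F′ z) y ≈ up-layer k F y + up-layer k F′ y
  up-layer-+ zero    F F′ y             = ≈-refl
  up-layer-+ (suc k) F F′ []            = sym (+-identityˡ 0#)
  up-layer-+ (suc k) F F′ (inside  ∷ y) = up-layer-+ (suc k) (F ∘ (inside ∷_)) (F′ ∘ (inside ∷_)) y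
  up-layer-+ (suc k) F F′ (outside ∷ y) = trans
    (+-cong (up-layer-+ (suc k) (F ∘ (outside ∷_)) (F′ ∘ (outside ∷_)) y)
            (up-layer-+ k (F ∘ (inside ∷_)) (F′ ∘ (inside ∷_)) y))
    (solve 4 (λ x y z w → (x :+ y) :+ (z :+ w) := (x :+ z) :+ (y :+ w)) ≈-refl _ _ _ _)

  -- On the right, a set z with k + 1 elements more than y is reached once through each of the k + 1
  -- intermediate sets that lack a single element of z outside y.
  up-layer-suc : ∀ k (F : Weight t) y →
    suc k · up-layer (suc k) F y ≈ up-layer k (up-layer 1 F) y
  up-layer-suc zero    F y             = +-identityʳ _
  up-layer-suc (suc k) F []            = trans (+-cong ≈-refl (trans (+-cong ≈-refl (·-0 k)) (+-identityʳ 0#))) (+-identityʳ 0#)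
    where
    ·-0 : ∀ k → k · 0# ≈ 0#
    ·-0 zero    = ≈-refl
    ·-0 (suc k) = trans (+-identityˡ _) (·-0 k)
  up-layer-suc (suc k) F (inside  ∷ y) = up-layer-suc (suc k) (F ∘ (inside ∷_)) y
  up-layer-suc (suc k) F (outside ∷ y) = begin
    suc (suc k) · (up-layer (suc (suc k)) F₀ y + up-layer (suc k) F₁ y)
      ≈⟨ ×-distrib-+ _ _ (suc (suc k)) ⟩
    suc (suc k) · up-layer (suc (suc k)) F₀ y + suc (suc k) · up-layer (suc k) F₁ y
      ≈⟨ +-cong (up-layer-suc (suc k) F₀ y) (+-congˡ (up-layer-suc k F₁ y)) ⟩
    up-layer (suc k) (up-layer 1 F₀) y + (up-layer (suc k) F₁ y + up-layer k (up-layer 1 F₁) y)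
      ≈⟨ +-assoc _ _ _ ⟨
    (up-layer (suc k) (up-layer 1 F₀) y + up-layer (suc k) F₁ y) + up-layer k (up-layer 1 F₁) y
      ≈⟨ +-congʳ (up-layer-+ (suc k) (up-layer 1 F₀) F₁ y) ⟨
    up-layer (suc k) (up-layer 1 F) (outside ∷ y)  ∎
    where
    F₀ = F ∘ (outside ∷_)
    F₁ = F ∘ (inside ∷_)

  -- up-tail r m k F y is the sum of r^j up-layer (k + j) F y over j < m.
  up-tail : Carrier → ℕ → ℕ → Weight t → Weight t
  up-tail r zero    k F y = 0#
  up-tail r (suc m) k F y = up-layer k F y + r * up-tail r m (suc k) F y

  up-tail-[] : ∀ r m k (F : Weight 0) → up-tail r m (suc k) F [] ≈ 0#
  up-tail-[] r zero    k F = ≈-refl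
  up-tail-[] r (suc m) k F = trans (+-identityˡ _) (trans (*-congˡ (up-tail-[] r m (suc k) F)) (zeroʳ r))

  up-tail-inside : ∀ r m k (F : Weight (suc t)) y →
    up-tail r m k F (inside ∷ y) ≈ up-tail r m k (F ∘ (inside ∷_)) y
  up-tail-inside r zero    k       F y = ≈-refl
  up-tail-inside r (suc m) zero    F y = +-congˡ (*-congˡ (up-tail-inside r m 1 F y))
  up-tail-inside r (suc m) (suc k) F y = +-congˡ (*-congˡ (up-tail-inside r m (suc (suc k)) F y))

  up-tail-outside : ∀ r m k (F : Weight (suc t)) y → up-tail r m (suc k) F (outside ∷ y) ≈
    up-tail r m (suc k) (F ∘ (outside ∷_)) y + up-tail r m k (F ∘ (inside ∷_)) y
  up-tail-outside r zero    k F y = sym (+-identityˡ 0#)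
  up-tail-outside r (suc m) k F y = trans (+-congˡ (*-congˡ (up-tail-outside r m (suc k) F y)))
    (solve 5 (λ x y r z w → (x :+ y) :+ r :* (z :+ w) := (x :+ r :* z) :+ (y :+ r :* w)) ≈-refl _ _ r _ _)

  -- The Taylor expansion of the shifted form. Any m ≥ t is allowed because the two recursive calls
  -- in the `outside` case need different numbers of terms for the same length.
  up-taylor : ∀ r m (F : Weight t) y → t ℕ.≤ m → up r F y ≈ up-tail r (suc m) 0 F y
  up-taylor r m F [] t≤m = sym (trans (+-congˡ (trans (*-congˡ (up-tail-[] r m 0 F)) (zeroʳ r))) (+-identityʳ _))
  up-taylor r m F (inside ∷ y) t≤m =
    trans (up-taylor r m (F ∘ (inside ∷_)) y (ℕ.<⇒≤ t≤m)) (sym (up-tail-inside r (suc m) 0 F y))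
  up-taylor r (suc m) F (outside ∷ y) (s≤s t≤m) = begin
    up r (F ∘ (outside ∷_)) y + r * up r (F ∘ (inside ∷_)) y
      ≈⟨ +-cong (up-taylor r (suc m) _ y (ℕ.m≤n⇒m≤1+n t≤m)) (*-congˡ (up-taylor r m _ y t≤m)) ⟩
    (F (outside ∷ y) + r * up-tail r (suc m) 1 (F ∘ (outside ∷_)) y) + r * up-tail r (suc m) 0 (F ∘ (inside ∷_)) y
      ≈⟨ solve 4 (λ x r y z → (x :+ r :* y) :+ r :* z := x :+ r :* (y :+ z)) ≈-refl _ r _ _ ⟩
    F (outside ∷ y) + r * (up-tail r (suc m) 1 (F ∘ (outside ∷_)) y + up-tail r (suc m) 0 (F ∘ (inside ∷_)) y)
      ≈⟨ +-congˡ (*-congˡ (up-tail-outside r (suc m) 0 F y)) ⟨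
    F (outside ∷ y) + r * up-tail r (suc m) 1 F (outside ∷ y) ∎

  up-tail-0 : ∀ r m k (F : Weight t) y → (∀ k → up-layer (suc k) F y ≈ 0#) → up-tail r m (suc k) F y ≈ 0#
  up-tail-0 r zero    k F y h = ≈-refl
  up-tail-0 r (suc m) k F y h =
    trans (+-cong (h k) (trans (*-congˡ (up-tail-0 r m (suc k) F y h)) (zeroʳ r))) (+-identityˡ 0#)

  TorsionFree : Set _
  TorsionFree = ∀ k x → suc k · x ≈ 0# → x ≈ 0#

  Harmonic : Weight t → Set _
  Harmonic F = ∀ y → up-layer 1 F y ≈ 0#

  Homogeneous-of : ℕ → Weight t → Set _
  Homogeneous-of d F = ∀ z → ∣ z ∣ ≢ d → F z ≈ 0#

  -- Only the term of order 0 of the Taylor expansion survives: layer k + 1, taken k + 1 times, is a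
  -- layer of the vanishing first layer.
  harmonic⇒up : TorsionFree → {F : Weight t} → Harmonic F → ∀ r y → up r F y ≈ F y
  harmonic⇒up {t} torsionFree {F} F-harmonic r y = begin
    up r F y                          ≈⟨ up-taylor r t F y ℕ.≤-refl ⟩
    F y + r * up-tail r t 1 F y       ≈⟨ +-congˡ (*-congˡ (up-tail-0 r t 0 F y layers)) ⟩
    F y + r * 0#                      ≈⟨ +-congˡ (zeroʳ r) ⟩
    F y + 0#                          ≈⟨ +-identityʳ _ ⟩
    F y                               ∎
    where
    layers : ∀ k → up-layer (suc k) F y ≈ 0#
    layers k = torsionFree k _ (trans (up-layer-suc k F y) (up-layer-0 k F-harmonic y))

  pick : Subset t → Carrier → Carrier → Fin t → Carrier
  pick S x y i = if Vec.lookup S i then x else y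

  pick-map : ∀ (S : Subset t) {x y x′ y′} (f : Carrier → Carrier) → x ≈ f x′ → y ≈ f y′ →
    ∀ i → pick S x y i ≈ f (pick S x′ y′ i)
  pick-map S f x≈ y≈ i with Vec.lookup S i
  ... | true  = x≈
  ... | false = y≈

  pick-∁ : ∀ (S : Subset t) x y i → pick (∁ S) x y i ≈ pick S y x i
  pick-∁ (inside  ∷ S) x y Fin.zero    = ≈-refl
  pick-∁ (outside ∷ S) x y Fin.zero    = ≈-refl
  pick-∁ (_ ∷ S)       x y (Fin.suc i) = pick-∁ S x y i

  -- This is b^|S| a^(t-|S|), built coordinate by coordinate so that inductions on S meet no
  -- truncated subtraction.
  monomial : Subset t → Carrier → Carrier → Carrier
  monomial []            b a = 1#
  monomial (inside  ∷ S) b a = b * monomial S b a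
  monomial (outside ∷ S) b a = a * monomial S b a

  monomial-∁ : ∀ (S : Subset t) b a → monomial (∁ S) b a ≈ monomial S a b
  monomial-∁ []            b a = ≈-refl
  monomial-∁ (inside  ∷ S) b a = *-congˡ (monomial-∁ S b a)
  monomial-∁ (outside ∷ S) b a = *-congˡ (monomial-∁ S b a)

  monomial-scale : ∀ (S : Subset t) r b a → r ^ ∣ S ∣ * monomial S b a ≈ monomial S (r * b) a
  monomial-scale []            r b a = *-identityˡ 1#
  monomial-scale (inside  ∷ S) r b a = trans
    (solve 4 (λ r x b y → (r :* x) :* (b :* y) := (r :* b) :* (x :* y)) ≈-refl r (r ^ ∣ S ∣) b (monomial S b a))
    (*-congˡ (monomial-scale S r b a))
  monomial-scale (outside ∷ S) r b a = trans
    (solve 3 (λ x a y → x :* (a :* y) := a :* (x :* y)) ≈-refl (r ^ ∣ S ∣) a (monomial S b a))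
    (*-congˡ (monomial-scale S r b a))

  -- The sum of F over the subsets of S, which is f̃ up to a constant factor.
  subset-sum : Weight t → Subset t → Carrier
  subset-sum F S = evaluate₁ F (pick S 1# 0#)

  subset-sum-0 : ∀ {F : Weight t} (S : Subset t) → (∀ {z} → z Subset.⊆ S → F z ≈ 0#) → subset-sum F S ≈ 0#
  subset-sum-0 []            h = h (λ ())
  subset-sum-0 (inside  ∷ S) h = trans (+-cong
    (trans (*-congˡ (subset-sum-0 S (h ∘ Subset.out⊆))) (zeroʳ _))
    (trans (*-congˡ (subset-sum-0 S (h ∘ Subset.in⊆in))) (zeroʳ _))) (+-identityˡ 0#)
  subset-sum-0 (outside ∷ S) h = trans (+-cong
    (trans (*-congˡ (subset-sum-0 S (h ∘ Subset.out⊆))) (zeroʳ _))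
    (zeroˡ _)) (+-identityˡ 0#)

  sum-above : Subset t → (Subset t → Carrier) → Carrier
  sum-above []            f = f []
  sum-above (inside  ∷ U) f = sum-above U (f ∘ (inside ∷_))
  sum-above (outside ∷ U) f = sum-above U (f ∘ (outside ∷_)) + sum-above U (f ∘ (inside ∷_))

  sum-above-cong : ∀ (U : Subset t) {f f′} → (∀ S → f S ≈ f′ S) → sum-above U f ≈ sum-above U f′
  sum-above-cong []            f≈ = f≈ []
  sum-above-cong (inside  ∷ U) f≈ = sum-above-cong U (f≈ ∘ (inside ∷_))
  sum-above-cong (outside ∷ U) f≈ = +-cong (sum-above-cong U (f≈ ∘ (outside ∷_))) (sum-above-cong U (f≈ ∘ (inside ∷_)))

  sum-above-+ : ∀ (U : Subset t) f f′ → sum-above U (λ S → f S + f′ S) ≈ sum-above U f + sum-above U f′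
  sum-above-+ []            f f′ = ≈-refl
  sum-above-+ (inside  ∷ U) f f′ = sum-above-+ U (f ∘ (inside ∷_)) (f′ ∘ (inside ∷_))
  sum-above-+ (outside ∷ U) f f′ = trans
    (+-cong (sum-above-+ U (f ∘ (outside ∷_)) (f′ ∘ (outside ∷_))) (sum-above-+ U (f ∘ (inside ∷_)) (f′ ∘ (inside ∷_))))
    (solve 4 (λ x y z w → (x :+ y) :+ (z :+ w) := (x :+ z) :+ (y :+ w)) ≈-refl _ _ _ _)

  sum-above-*ˡ : ∀ (U : Subset t) r f → sum-above U (λ S → r * f S) ≈ r * sum-above U f
  sum-above-*ˡ []            r f = ≈-refl
  sum-above-*ˡ (inside  ∷ U) r f = sum-above-*ˡ U r (f ∘ (inside ∷_))
  sum-above-*ˡ (outside ∷ U) r f =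
    trans (+-cong (sum-above-*ˡ U r (f ∘ (outside ∷_))) (sum-above-*ˡ U r (f ∘ (inside ∷_)))) (sym (distribˡ r _ _))

  -- Exchange the sums: F z is counted for every S containing both U and z. Coordinates in U or z
  -- contribute b, and each remaining one is free to lie in S or not, contributing a + b.
  sum-above-subset-sum : ∀ (U : Subset t) F b a →
    sum-above U (λ S → subset-sum F S * monomial S b a) ≈ evaluate F (pick U b (a + b)) (λ _ → b)
  sum-above-subset-sum []            F b a = *-identityʳ _
  sum-above-subset-sum (inside  ∷ U) F b a = begin
    sum-above U (λ S → subset-sum F (inside ∷ S) * (b * monomial S b a))
      ≈⟨ sum-above-cong U (λ S → solve 4 (λ x y b m → (con 1 :* x :+ con 1 :* y) :* (b :* m) :=
           b :* (x :* m) :+ b :* (y :* m)) ≈-refl (subset-sum F₀ S) (subset-sum F₁ S) b (monomial S b a)) ⟩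
    sum-above U (λ S → b * (subset-sum F₀ S * monomial S b a) + b * (subset-sum F₁ S * monomial S b a))
      ≈⟨ sum-above-+ U _ _ ⟩
    sum-above U (λ S → b * (subset-sum F₀ S * monomial S b a)) + sum-above U (λ S → b * (subset-sum F₁ S * monomial S b a))
      ≈⟨ +-cong (sum-above-*ˡ U b _) (sum-above-*ˡ U b _) ⟩
    b * sum-above U (λ S → subset-sum F₀ S * monomial S b a) + b * sum-above U (λ S → subset-sum F₁ S * monomial S b a)
      ≈⟨ +-cong (*-congˡ (sum-above-subset-sum U F₀ b a)) (*-congˡ (sum-above-subset-sum U F₁ b a)) ⟩
    evaluate F (pick (inside ∷ U) b (a + b)) (λ _ → b) ∎
    where
    F₀ = F ∘ (outside ∷_)
    F₁ = F ∘ (inside ∷_)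
  sum-above-subset-sum (outside ∷ U) F b a = begin
    sum-above U (λ S → subset-sum F (outside ∷ S) * (a * monomial S b a)) +
    sum-above U (λ S → subset-sum F (inside ∷ S) * (b * monomial S b a))
      ≈⟨ sum-above-+ U _ _ ⟨
    sum-above U (λ S → subset-sum F (outside ∷ S) * (a * monomial S b a) + subset-sum F (inside ∷ S) * (b * monomial S b a))
      ≈⟨ sum-above-cong U (λ S → solve 5 (λ x y b a m →
           (con 1 :* x :+ con 0 :* y) :* (a :* m) :+ (con 1 :* x :+ con 1 :* y) :* (b :* m) :=
           (a :+ b) :* (x :* m) :+ b :* (y :* m)) ≈-refl (subset-sum F₀ S) (subset-sum F₁ S) b a (monomial S b a)) ⟩
    sum-above U (λ S → (a + b) * (subset-sum F₀ S * monomial S b a) + b * (subset-sum F₁ S * monomial S b a))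
      ≈⟨ sum-above-+ U _ _ ⟩
    sum-above U (λ S → (a + b) * (subset-sum F₀ S * monomial S b a)) + sum-above U (λ S → b * (subset-sum F₁ S * monomial S b a))
      ≈⟨ +-cong (sum-above-*ˡ U (a + b) _) (sum-above-*ˡ U b _) ⟩
    (a + b) * sum-above U (λ S → subset-sum F₀ S * monomial S b a) + b * sum-above U (λ S → subset-sum F₁ S * monomial S b a)
      ≈⟨ +-cong (*-congˡ (sum-above-subset-sum U F₀ b a)) (*-congˡ (sum-above-subset-sum U F₁ b a)) ⟩
    evaluate F (pick (outside ∷ U) b (a + b)) (λ _ → b) ∎
    where
    F₀ = F ∘ (outside ∷_)
    F₁ = F ∘ (inside ∷_)

  -- A coordinate in U contributes b or br according to whether it is outside or inside z; any other
  -- contributes r or rb. Pulling out b, respectively r, leaves 1 or the entry of the new point.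
  evaluate-factor : ∀ (U : Subset t) F b r →
    evaluate (λ z → r ^ ∣ z ∣ * F z) (pick U b r) (λ _ → b) ≈ monomial U b r * evaluate₁ F (pick U r b)
  evaluate-factor []      F b r = ≈-refl
  evaluate-factor {suc t} (s ∷ U) F b r = begin
    pick (s ∷ U) b r Fin.zero * evaluate (λ z → r ^ ∣ z ∣ * F₀ z) (pick U b r) (λ _ → b) +
    b * evaluate (λ z → r * r ^ ∣ z ∣ * F₁ z) (pick U b r) (λ _ → b)
      ≈⟨ +-cong (*-congˡ (evaluate-factor U F₀ b r)) (*-congˡ (trans
           (trans (evaluate-weight {t} (λ z → *-assoc r (r ^ ∣ z ∣) (F₁ z))) (evaluate-*ˡ {t} r _ _ _))
           (*-congˡ (evaluate-factor U F₁ b r)))) ⟩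
    pick (s ∷ U) b r Fin.zero * (monomial U b r * evaluate₁ F₀ (pick U r b)) +
    b * (r * (monomial U b r * evaluate₁ F₁ (pick U r b)))
      ≈⟨ collect s ⟩
    monomial (s ∷ U) b r * evaluate₁ F (pick (s ∷ U) r b) ∎
    where
    F₀ = F ∘ (outside ∷_)
    F₁ = F ∘ (inside ∷_)
    collect : ∀ s → pick (s ∷ U) b r Fin.zero * (monomial U b r * evaluate₁ F₀ (pick U r b)) +
      b * (r * (monomial U b r * evaluate₁ F₁ (pick U r b))) ≈
      monomial (s ∷ U) b r * evaluate₁ F (pick (s ∷ U) r b)
    collect true  = solve 5 (λ b r m x y → b :* (m :* x) :+ b :* (r :* (m :* y)) :=
      (b :* m) :* (con 1 :* x :+ r :* y)) ≈-refl b r _ _ _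
    collect false = solve 5 (λ b r m x y → r :* (m :* x) :+ b :* (r :* (m :* y)) :=
      (r :* m) :* (con 1 :* x :+ b :* y)) ≈-refl b r _ _ _

  module HarmonicWeight {t} (torsionFree : TorsionFree) {d} {F : Weight t}
      (F-harmonic : Harmonic F) (F-homogeneous : Homogeneous-of d F) where

    scale≈ : ∀ r z → r ^ ∣ z ∣ * F z ≈ r ^ d * F z
    scale≈ r z with ∣ z ∣ ℕ.≟ d
    ... | yes ≡.refl = ≈-refl
    ... | no ∣z∣≢d = trans (*-congˡ F≈0) (trans (zeroʳ _) (sym (trans (*-congˡ F≈0) (zeroʳ _))))
      where F≈0 = F-homogeneous z ∣z∣≢d

    evaluate₁-homogeneous : ∀ r w → evaluate₁ F (λ i → r * w i) ≈ r ^ d * evaluate₁ F w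
    evaluate₁-homogeneous r w = trans (evaluate₁-scale r F w)
      (trans (evaluate-weight (scale≈ r)) (evaluate-*ˡ (r ^ d) F _ _))

    evaluate₁-translate : ∀ r w → evaluate₁ F (λ i → w i + r) ≈ evaluate₁ F w
    evaluate₁-translate r w = trans (evaluate₁-shift r F w)
      (evaluate-weight (harmonic⇒up torsionFree F-harmonic r))

    subset-sum-∁ : ∀ S → subset-sum F (∁ S) ≈ (- 1#) ^ d * subset-sum F S
    subset-sum-∁ S = begin
      evaluate₁ F (pick (∁ S) 1# 0#)
        ≈⟨ evaluate₁-point {F = F} (λ i → trans (pick-∁ S 1# 0# i) (pick-map S (λ x → - 1# * x + 1#)
             (sym (trans (+-congʳ (*-identityʳ _)) (-‿inverseˡ 1#)))
             (sym (trans (+-congʳ (zeroʳ _)) (+-identityˡ 1#))) i)) ⟩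
      evaluate₁ F (λ i → - 1# * pick S 1# 0# i + 1#)  ≈⟨ evaluate₁-translate 1# _ ⟩
      evaluate₁ F (λ i → - 1# * pick S 1# 0# i)       ≈⟨ evaluate₁-homogeneous (- 1#) _ ⟩
      (- 1#) ^ d * subset-sum F S                     ∎

    subset-sum-small : ∀ S → ∣ S ∣ ℕ.< d → subset-sum F S ≈ 0#
    subset-sum-small S ∣S∣<d = subset-sum-0 S λ {z} z⊆S →
      F-homogeneous z (ℕ.<⇒≢ (ℕ.≤-<-trans (Subset.p⊆q⇒∣p∣≤∣q∣ z⊆S) ∣S∣<d))

    -- The complement of S has fewer than d elements, and the sign relating the two sums is its own
    -- inverse. With `subset-sum-small` this is the reason why (xy)^d divides the enumerator.
    subset-sum-large : ∀ S → t ℕ.∸ ∣ S ∣ ℕ.< d → subset-sum F S ≈ 0#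
    subset-sum-large S <d = begin
      subset-sum F S                            ≈⟨ *-identityˡ _ ⟨
      1# * subset-sum F S                       ≈⟨ *-congʳ (sign² d) ⟨
      (- 1#) ^ d * (- 1#) ^ d * subset-sum F S  ≈⟨ *-assoc _ _ _ ⟩
      (- 1#) ^ d * ((- 1#) ^ d * subset-sum F S)  ≈⟨ *-congˡ (subset-sum-∁ S) ⟨
      (- 1#) ^ d * subset-sum F (∁ S)
        ≈⟨ *-congˡ (subset-sum-small (∁ S) (≡.subst (ℕ._< d) (≡.sym (Subset.∣∁p∣≡n∸∣p∣ S)) <d)) ⟩
      (- 1#) ^ d * 0#                           ≈⟨ zeroʳ _ ⟩
      0#                                        ∎
      where
      sign² : ∀ d → (- 1#) ^ d * (- 1#) ^ d ≈ 1#
      sign² zero    = *-identityˡ 1#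
      sign² (suc d) = begin
        (- 1# * (- 1#) ^ d) * (- 1# * (- 1#) ^ d)
          ≈⟨ solve 2 (λ m x → (m :* x) :* (m :* x) := m :* m :* (x :* x)) ≈-refl (- 1#) ((- 1#) ^ d) ⟩
        - 1# * - 1# * ((- 1#) ^ d * (- 1#) ^ d)
          ≈⟨ *-cong (trans (-1*x≈-x (- 1#)) (RingProperties.-‿involutive ring 1#)) (sign² d) ⟩
        1# * 1#  ≈⟨ *-identityˡ 1# ⟩
        1#       ∎

    -- The factor (a+b)^d supplies the powers of a + b that `evaluate-factor` asks for, as only sets
    -- of size d matter. The resulting point has a + b on U and b elsewhere, that is, a times the
    -- indicator of U plus the constant b. Translation removes b, and homogeneity extracts a^d.
    sum-above-harmonic : ∀ U a b →
      (a + b) ^ d * sum-above U (λ S → subset-sum F S * monomial S b a) ≈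
      a ^ d * (subset-sum F U * monomial U b (a + b))
    sum-above-harmonic U a b = begin
      (a + b) ^ d * sum-above U (λ S → subset-sum F S * monomial S b a)
        ≈⟨ *-congˡ (sum-above-subset-sum U F b a) ⟩
      (a + b) ^ d * evaluate F (pick U b (a + b)) (λ _ → b)
        ≈⟨ evaluate-*ˡ _ F _ _ ⟨
      evaluate (λ z → (a + b) ^ d * F z) (pick U b (a + b)) (λ _ → b)
        ≈⟨ evaluate-weight (scale≈ (a + b)) ⟨
      evaluate (λ z → (a + b) ^ ∣ z ∣ * F z) (pick U b (a + b)) (λ _ → b)
        ≈⟨ evaluate-factor U F b (a + b) ⟩
      monomial U b (a + b) * evaluate₁ F (pick U (a + b) b)
        ≈⟨ *-congˡ (evaluate₁-point {F = F} (pick-map U (λ x → a * x + b)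
             (+-congʳ (sym (*-identityʳ a)))
             (sym (trans (+-congʳ (zeroʳ a)) (+-identityˡ b))))) ⟩
      monomial U b (a + b) * evaluate₁ F (λ i → a * pick U 1# 0# i + b)
        ≈⟨ *-congˡ (trans (evaluate₁-translate b _) (evaluate₁-homogeneous a _)) ⟩
      monomial U b (a + b) * (a ^ d * subset-sum F U)
        ≈⟨ solve 3 (λ m x y → m :* (x :* y) := x :* (y :* m)) ≈-refl _ _ _ ⟩
      a ^ d * (subset-sum F U * monomial U b (a + b)) ∎

  sum-subsets : (Subset t → Carrier) → Carrier
  sum-subsets {zero}  f = f []
  sum-subsets {suc t} f = sum-subsets (f ∘ (outside ∷_)) + sum-subsets (f ∘ (inside ∷_))

  sum-subsets-cong : ∀ {f f′ : Subset t → Carrier} → (∀ S → f S ≈ f′ S) → sum-subsets f ≈ sum-subsets f′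
  sum-subsets-cong {zero}  f≈ = f≈ []
  sum-subsets-cong {suc t} f≈ = +-cong (sum-subsets-cong (f≈ ∘ (outside ∷_))) (sum-subsets-cong (f≈ ∘ (inside ∷_)))

  sum-subsets-0 : ∀ {f : Subset t → Carrier} → (∀ S → f S ≈ 0#) → sum-subsets f ≈ 0#
  sum-subsets-0 {zero}  f≈0 = f≈0 []
  sum-subsets-0 {suc t} f≈0 =
    trans (+-cong (sum-subsets-0 (f≈0 ∘ (outside ∷_))) (sum-subsets-0 (f≈0 ∘ (inside ∷_)))) (+-identityˡ 0#)

  sum-subsets-*ˡ : ∀ r (f : Subset t → Carrier) → sum-subsets (λ S → r * f S) ≈ r * sum-subsets f
  sum-subsets-*ˡ {zero}  r f = ≈-refl
  sum-subsets-*ˡ {suc t} r f =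
    trans (+-cong (sum-subsets-*ˡ r (f ∘ (outside ∷_))) (sum-subsets-*ˡ r (f ∘ (inside ∷_)))) (sym (distribˡ r _ _))

  sum-subsets-∁ : ∀ (f : Subset t → Carrier) → sum-subsets (f ∘ ∁) ≈ sum-subsets f
  sum-subsets-∁ {zero}  f = ≈-refl
  sum-subsets-∁ {suc t} f =
    trans (+-cong (sum-subsets-∁ (f ∘ (inside ∷_))) (sum-subsets-∁ (f ∘ (outside ∷_)))) (+-comm _ _)

  sum-subsets-sum : ∀ {n} (f : Fin n → Subset t → Carrier) →
    sum-subsets (λ S → sum (λ k → f k S)) ≈ sum (λ k → sum-subsets (f k))
  sum-subsets-sum {zero}  f = ≈-refl
  sum-subsets-sum {suc t} f =
    trans (+-cong (sum-subsets-sum (λ k → f k ∘ (outside ∷_))) (sum-subsets-sum (λ k → f k ∘ (inside ∷_))))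
      (sym (𝓡-Sums.sum-∙ _ _))

  sum-subsets-when : ∀ b (f : Subset t → Carrier) → sum-subsets (λ S → f S when b) ≈ (sum-subsets f when b)
  sum-subsets-when true  f = ≈-refl
  sum-subsets-when {t} false f = sum-subsets-0 {t} (λ _ → ≈-refl)

  sum-above≈sum-subsets : ∀ (U : Subset t) f → sum-above U f ≈ sum-subsets (λ S → f S when does (U Subset.⊆? S))
  sum-above≈sum-subsets []            f = ≈-refl
  sum-above≈sum-subsets {suc t} (inside  ∷ U) f = trans (sym (+-identityˡ _)) (+-cong
    (sym (sum-subsets-0 {t} (λ _ → ≈-refl)))
    (trans (sum-above≈sum-subsets U (f ∘ (inside ∷_))) (sum-subsets-cong λ S →
      𝓡-Sums.when-cong (U Subset.⊆? S) ((inside ∷ U) Subset.⊆? (inside ∷ S)) Subset.in⊆in Subset.drop-∷-⊆ (λ _ → ≈-refl))))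
  sum-above≈sum-subsets (outside ∷ U) f = +-cong
    (trans (sum-above≈sum-subsets U (f ∘ (outside ∷_))) (sum-subsets-cong λ S →
      𝓡-Sums.when-cong (U Subset.⊆? S) ((outside ∷ U) Subset.⊆? (outside ∷ S)) Subset.out⊆ Subset.drop-∷-⊆ (λ _ → ≈-refl)))
    (trans (sum-above≈sum-subsets U (f ∘ (inside ∷_))) (sum-subsets-cong λ S →
      𝓡-Sums.when-cong (U Subset.⊆? S) ((outside ∷ U) Subset.⊆? (inside ∷ S)) Subset.out⊆ Subset.drop-∷-⊆ (λ _ → ≈-refl)))

  sum-*ˡ : ∀ {n} r (f : Fin n → Carrier) → r * sum f ≈ sum (λ k → r * f k)
  sum-*ˡ {zero}  r f = trans (*-congˡ (𝓡-Sums.sum-zero f)) (trans (zeroʳ r) (sym (𝓡-Sums.sum-zero _)))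
  sum-*ˡ {suc n} r f = trans (*-congˡ (𝓡-Sums.sum-suc f))
    (trans (distribˡ r _ _) (trans (+-congˡ (sum-*ˡ r (f ∘ Fin.suc))) (sym (𝓡-Sums.sum-suc _))))

  *-when : ∀ b r x → r * (x when b) ≈ ((r * x) when b)
  *-when true  r x = ≈-refl
  *-when false r x = zeroʳ r

  ^-· : ∀ q k x → (q ℕ.^ k) · x ≈ (q · 1#) ^ k * x
  ^-· q zero    x = trans (+-identityʳ x) (sym (*-identityˡ x))
  ^-· q (suc k) x = begin
    (q ℕ.* q ℕ.^ k) · x            ≈⟨ ×-assocˡ x q (q ℕ.^ k) ⟨
    q · ((q ℕ.^ k) · x)            ≈⟨ ×-congʳ q (trans (^-· q k x) (sym (*-identityˡ _))) ⟩
    q · (1# * ((q · 1#) ^ k * x))  ≈⟨ ×-assoc-* q 1# _ ⟨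
    q · 1# * ((q · 1#) ^ k * x)    ≈⟨ *-assoc _ _ _ ⟨
    (q · 1#) ^ suc k * x           ∎

  -- The code is recorded by the supports σ k of all vectors and by the set A of
  -- those k whose vector is a codeword.
  module Enumerators {t N} (σ : Fin N → Subset t) where

    count-in : (Fin N → Bool) → Subset t → ℕ
    count-in A S = sumℕ (λ k → (1 whenℕ does (σ k Subset.⊆? S)) whenℕ A k)

    module _ (torsionFree : TorsionFree) {d} {F : Weight t}
        (F-harmonic : Harmonic F) (F-homogeneous : Homogeneous-of d F) where
      open HarmonicWeight torsionFree F-harmonic F-homogeneous

      enumerator : (Fin N → Bool) → Carrier → Carrier → Carrier
      enumerator A x y = sum (λ k → subset-sum F (σ k) * monomial (σ k) y x when A k)

      private
        weighted-counts : (Fin N → Bool) → Carrier → Carrier → Carrier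
        weighted-counts A b a = sum-subsets (λ S → count-in A S · (subset-sum F S * monomial S b a))

        count-· : ∀ A S x → count-in A S · x ≈ sum (λ k → (x when does (σ k Subset.⊆? S)) when A k)
        count-· A S x = trans
          (×-congˡ′ (ℕ-Sums.sum-cong λ k → ∧-when (A k) (does (σ k Subset.⊆? S))))
          (trans (sum-when-· +-commutativeMonoid (λ k → if A k then does (σ k Subset.⊆? S) else false) x) (𝓡-Sums.sum-cong λ k → when-∧ (A k) (does (σ k Subset.⊆? S))))
          where
          ×-congˡ′ : ∀ {m n} → m ≡ n → m · x ≈ n · x
          ×-congˡ′ ≡.refl = ≈-refl
          ∧-when : ∀ a b → ((1 whenℕ b) whenℕ a) ≡ (1 whenℕ (if a then b else false))
          ∧-when true  b = ≡.refl
          ∧-when false b = ≡.refl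
          when-∧ : ∀ a b → (x when (if a then b else false)) ≈ ((x when b) when a)
          when-∧ true  b = ≈-refl
          when-∧ false b = ≈-refl

        weighted-counts≈ : ∀ A b a → weighted-counts A b a ≈
          sum (λ k → sum-above (σ k) (λ S → subset-sum F S * monomial S b a) when A k)
        weighted-counts≈ A b a = trans
          (sum-subsets-cong (λ S → count-· A S _))
          (trans (sum-subsets-sum {t} _) (𝓡-Sums.sum-cong λ k → trans (sum-subsets-when {t} (A k) _)
            (𝓡-Sums.when-congˡ (A k) (sym (sum-above≈sum-subsets (σ k) _)))))

      -- In the sum over all S, a codeword is counted for exactly those S that contain its support.
      -- So each codeword contributes one instance of `sum-above-harmonic`.
      weighted-counts-enumerator : ∀ A a b →
        (a + b) ^ d * weighted-counts A b a ≈ a ^ d * enumerator A (a + b) b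
      weighted-counts-enumerator A a b = begin
        (a + b) ^ d * weighted-counts A b a
          ≈⟨ trans (*-congˡ (weighted-counts≈ A b a)) (sum-*ˡ _ _) ⟩
        sum (λ k → (a + b) ^ d * (sum-above (σ k) (λ S → subset-sum F S * monomial S b a) when A k))
          ≈⟨ 𝓡-Sums.sum-cong (λ k → trans (*-when (A k) _ _)
               (trans (𝓡-Sums.when-congˡ (A k) (sum-above-harmonic (σ k) a b)) (sym (*-when (A k) _ _)))) ⟩
        sum (λ k → a ^ d * (subset-sum F (σ k) * monomial (σ k) b (a + b) when A k))
          ≈⟨ sum-*ˡ _ _ ⟨
        a ^ d * enumerator A (a + b) b ∎

      module _ {q m : ℕ} {A A′ : Fin N → Bool}
          (counts : ∀ S → count-in A′ (∁ S) ℕ.* m ≡ q ℕ.^ ∣ ∁ S ∣ ℕ.* count-in A S) where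
        private Q = q · 1#

        -- The sum is reindexed by complements. The relation between the counts trades words of A′
        -- in the complement of S for words of A in S; its power of q turns y into Qy, and
        -- harmonicity contributes the sign.
        weighted-counts-dual : ∀ y a →
          m · weighted-counts A′ y a ≈ (- 1#) ^ d * weighted-counts A a (Q * y)
        weighted-counts-dual y a = begin
          m · weighted-counts A′ y a
            ≈⟨ trans (×-congʳ m (sym (*-identityˡ _))) (sym (×-assoc-* m 1# _)) ⟩
          m · 1# * weighted-counts A′ y a
            ≈⟨ *-congˡ (sym (sum-subsets-∁ (λ S → count-in A′ S · (subset-sum F S * monomial S y a)))) ⟩
          m · 1# * sum-subsets (λ S → count-in A′ (∁ S) · (subset-sum F (∁ S) * monomial (∁ S) y a))
            ≈⟨ sum-subsets-*ˡ {t} _ _ ⟨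
          sum-subsets (λ S → m · 1# * (count-in A′ (∁ S) · (subset-sum F (∁ S) * monomial (∁ S) y a)))
            ≈⟨ sum-subsets-cong term ⟩
          sum-subsets (λ S → (- 1#) ^ d * (count-in A S · (subset-sum F S * monomial S a (Q * y))))
            ≈⟨ sum-subsets-*ˡ {t} _ _ ⟩
          (- 1#) ^ d * weighted-counts A a (Q * y) ∎
          where
          term : ∀ S → m · 1# * (count-in A′ (∁ S) · (subset-sum F (∁ S) * monomial (∁ S) y a)) ≈
            (- 1#) ^ d * (count-in A S · (subset-sum F S * monomial S a (Q * y)))
          term S = begin
            m · 1# * (count-in A′ (∁ S) · w)
              ≈⟨ trans (×-assoc-* m 1# _) (×-congʳ m (*-identityˡ _)) ⟩
            m · (count-in A′ (∁ S) · w)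
              ≈⟨ ×-assocˡ w m _ ⟩
            (m ℕ.* count-in A′ (∁ S)) · w
              ≈⟨ ·-cong (≡.trans (ℕ.*-comm m _) (≡.trans (counts S) (ℕ.*-comm (q ℕ.^ ∣ ∁ S ∣) _))) ⟩
            (count-in A S ℕ.* q ℕ.^ ∣ ∁ S ∣) · w
              ≈⟨ ×-assocˡ w (count-in A S) _ ⟨
            count-in A S · ((q ℕ.^ ∣ ∁ S ∣) · w)
              ≈⟨ ×-congʳ (count-in A S) (begin
                   (q ℕ.^ ∣ ∁ S ∣) · (subset-sum F (∁ S) * monomial (∁ S) y a)
                     ≈⟨ ^-· q ∣ ∁ S ∣ _ ⟩
                   Q ^ ∣ ∁ S ∣ * (subset-sum F (∁ S) * monomial (∁ S) y a)
                     ≈⟨ solve 3 (λ x y z → x :* (y :* z) := y :* (x :* z)) ≈-refl _ _ _ ⟩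
                   subset-sum F (∁ S) * (Q ^ ∣ ∁ S ∣ * monomial (∁ S) y a)
                     ≈⟨ *-cong (subset-sum-∁ S) (trans (monomial-scale (∁ S) Q y a) (monomial-∁ S (Q * y) a)) ⟩
                   (- 1#) ^ d * subset-sum F S * monomial S a (Q * y)
                     ≈⟨ *-assoc _ _ _ ⟩
                   (- 1#) ^ d * (subset-sum F S * monomial S a (Q * y)) ∎) ⟩
            count-in A S · ((- 1#) ^ d * (subset-sum F S * monomial S a (Q * y)))
              ≈⟨ ×-comm-* (count-in A S) _ _ ⟨
            (- 1#) ^ d * (count-in A S · (subset-sum F S * monomial S a (Q * y))) ∎
            where
            w = subset-sum F (∁ S) * monomial (∁ S) y a
            ·-cong : ∀ {m n} → m ≡ n → m · w ≈ n · w
            ·-cong ≡.refl = ≈-refl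

        -- To be read with a = x - y, so that a + y = x and Qy + a = x + (q-1)y. The outer factors
        -- are those that `weighted-counts-enumerator` demands for A′ at (a, y) and for A at (Qy,
        -- a).
        enumerator-duality : ∀ a y →
          ((Q * y + a) ^ d * a ^ d) * (m · 1# * enumerator A′ (a + y) y) ≈
          ((a + y) ^ d * (Q * y) ^ d) * ((- 1#) ^ d * enumerator A (Q * y + a) a)
        enumerator-duality a y = begin
          ((Q * y + a) ^ d * a ^ d) * (m · 1# * enumerator A′ (a + y) y)
            ≈⟨ solve 4 (λ l a m w → (l :* a) :* (m :* w) := l :* (m :* (a :* w))) ≈-refl _ _ _ _ ⟩
          (Q * y + a) ^ d * (m · 1# * (a ^ d * enumerator A′ (a + y) y))
            ≈⟨ *-congˡ (*-congˡ (weighted-counts-enumerator A′ a y)) ⟨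
          (Q * y + a) ^ d * (m · 1# * ((a + y) ^ d * weighted-counts A′ y a))
            ≈⟨ solve 4 (λ l m x w → l :* (m :* (x :* w)) := (l :* x) :* (m :* w)) ≈-refl _ _ _ _ ⟩
          ((Q * y + a) ^ d * (a + y) ^ d) * (m · 1# * weighted-counts A′ y a)
            ≈⟨ *-congˡ (trans (trans (×-assoc-* m 1# _) (×-congʳ m (*-identityˡ _))) (weighted-counts-dual y a)) ⟩
          ((Q * y + a) ^ d * (a + y) ^ d) * ((- 1#) ^ d * weighted-counts A a (Q * y))
            ≈⟨ solve 4 (λ l x s w → (l :* x) :* (s :* w) := (x :* s) :* (l :* w)) ≈-refl _ _ _ _ ⟩
          ((a + y) ^ d * (- 1#) ^ d) * ((Q * y + a) ^ d * weighted-counts A a (Q * y))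
            ≈⟨ *-congˡ (weighted-counts-enumerator A (Q * y) a) ⟩
          ((a + y) ^ d * (- 1#) ^ d) * ((Q * y) ^ d * enumerator A (Q * y + a) a)
            ≈⟨ solve 4 (λ x s l w → (x :* s) :* (l :* w) := (x :* l) :* (s :* w)) ≈-refl _ _ _ _ ⟩
          ((a + y) ^ d * (Q * y) ^ d) * ((- 1#) ^ d * enumerator A (Q * y + a) a) ∎

-- Real numbers

-- `x ≃ y` is by definition nullity of the difference of the two sequences, so the laws of ≃ reduce
-- to closure properties of null sequences.
Null : (ℕ → ℚ) → Set
Null s = ∀ ε → .{{Positive ε}} → ∃ λ N → ∀ n → N ℕ.≤ n → ℚ.∣ s n ∣ ℚ.≤ ε

Bounded : (ℕ → ℚ) → Set
Bounded s = Σ[ B ∈ ℚ ] Positive B × ∃ λ N → ∀ n → N ℕ.≤ n → ℚ.∣ s n ∣ ℚ.≤ B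

Null-≗ : ∀ {s r} → (∀ n → s n ≡ r n) → Null s → Null r
Null-≗ s≗r s-null ε = let N , h = s-null ε in N , λ n N≤n → subst (λ x → ℚ.∣ x ∣ ℚ.≤ ε) (s≗r n) (h n N≤n)

Null-0 : Null (λ _ → 0ℚ)
Null-0 ε = 0 , λ _ _ → ℚ.<⇒≤ (ℚ.positive⁻¹ ε)

Null-+ : ∀ {s r} → Null s → Null r → Null (λ n → s n ℚ.+ r n)
Null-+ {s} {r} s-null r-null ε =
  let instance
        ½ε-pos : Positive (½ ℚ.* ε)
        ½ε-pos = ℚ.pos*pos⇒pos ½ ε
      N , h = s-null (½ ℚ.* ε)
      M , k = r-null (½ ℚ.* ε)
  in N ℕ.⊔ M , λ n N⊔M≤n → ℚ.≤-trans (ℚ.∣p+q∣≤∣p∣+∣q∣ (s n) (r n))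
       (ℚ.≤-trans (ℚ.+-mono-≤ (h n (ℕ.m⊔n≤o⇒m≤o N M N⊔M≤n)) (k n (ℕ.m⊔n≤o⇒n≤o N M N⊔M≤n)))
         (ℚ.≤-reflexive (≡.trans (≡.sym (ℚ.*-distribʳ-+ ε ½ ½)) (ℚ.*-identityˡ ε))))

Null-neg : ∀ {s} → Null s → Null (λ n → ℚ.- s n)
Null-neg {s} s-null ε = let N , h = s-null ε in N , λ n N≤n → subst (ℚ._≤ ε) (≡.sym (ℚ.∣-p∣≡∣p∣ (s n))) (h n N≤n)

Null-* : ∀ {s r} → Bounded s → Null r → Null (λ n → s n ℚ.* r n)
Null-* {s} {r} (B , B>0 , M , s≤B) r-null ε {{ε>0}} =
  let N , h = r-null δ
  in M ℕ.⊔ N , λ n M⊔N≤n → ℚ.≤-trans (ℚ.≤-reflexive (ℚ.∣p*q∣≡∣p∣*∣q∣ (s n) (r n)))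
       (ℚ.≤-trans (ℚ.*-monoʳ-≤-nonNeg ℚ.∣ r n ∣ {{ℚ.∣-∣-nonNeg (r n)}} (s≤B n (ℕ.m⊔n≤o⇒m≤o M N M⊔N≤n)))
       (ℚ.≤-trans (ℚ.*-monoˡ-≤-nonNeg B {{ℚ.pos⇒nonNeg B}} (h n (ℕ.m⊔n≤o⇒n≤o M N M⊔N≤n)))
         (ℚ.≤-reflexive Bδ≡ε)))
  where
  instance
    B-pos : Positive B
    B-pos = B>0
    B-nonZero : ℚ.NonZero B
    B-nonZero = ℚ.pos⇒nonZero B
    1/B-pos : Positive (ℚ.1/ B)
    1/B-pos = ℚ.1/pos⇒pos B
  δ = ℚ.1/ B ℚ.* ε
  instance
    δ-pos : Positive δ
    δ-pos = ℚ.pos*pos⇒pos (ℚ.1/ B) ε {{ℚ.positive (ℚ.positive⁻¹ ε {{ε>0}})}}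
  Bδ≡ε : B ℚ.* δ ≡ ε
  Bδ≡ε = ≡.trans (≡.sym (ℚ.*-assoc B (ℚ.1/ B) ε)) (≡.trans (cong (ℚ._* ε) (ℚ.*-inverseʳ B)) (ℚ.*-identityˡ ε))

cauchy⇒bounded : ∀ {s} → IsCauchy s → Bounded s
cauchy⇒bounded {s} s-cauchy =
  let N , h = s-cauchy 1ℚ
  in ℚ.∣ s N ∣ ℚ.+ 1ℚ , ℚ.nonNeg+pos⇒pos ℚ.∣ s N ∣ {{ℚ.∣-∣-nonNeg (s N)}} 1ℚ , N , λ n N≤n →
       ℚ.≤-trans (ℚ.≤-reflexive (cong ℚ.∣_∣ (solve 2 (λ a b → a := b :+ (a :- b)) ≡.refl (s n) (s N))))
       (ℚ.≤-trans (ℚ.∣p+q∣≤∣p∣+∣q∣ (s N) _) (ℚ.+-monoʳ-≤ ℚ.∣ s N ∣ (h n N N≤n ℕ.≤-refl)))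
  where open ℚ-Solver

module _ where
  open ℝ
  open ℚ-Solver

  ≗⇒≃ : ∀ {x y} → (∀ n → seq x n ≡ seq y n) → x ≃ y
  ≗⇒≃ {x} {y} x≗y = Null-≗ (λ n → ≡.sym (≡.trans (cong (ℚ._- seq y n) (x≗y n)) (ℚ.+-inverseʳ (seq y n)))) Null-0

  ≃-sym : ∀ {x y} → x ≃ y → y ≃ x
  ≃-sym {x} {y} x≃y = Null-≗ (λ n → solve 2 (λ a b → :- (a :- b) := b :- a) ≡.refl (seq x n) (seq y n)) (Null-neg x≃y)

  ≃-trans : ∀ {x y z} → x ≃ y → y ≃ z → x ≃ z
  ≃-trans {x} {y} {z} x≃y y≃z = Null-≗
    (λ n → solve 3 (λ a b c → (a :- b) :+ (b :- c) := a :- c) ≡.refl (seq x n) (seq y n) (seq z n))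
    (Null-+ x≃y y≃z)

  +ʳ-cong : ∀ {x y u v} → x ≃ y → u ≃ v → x +ʳ u ≃ y +ʳ v
  +ʳ-cong {x} {y} {u} {v} x≃y u≃v = Null-≗
    (λ n → solve 4 (λ a b c d → (a :- b) :+ (c :- d) := (a :+ c) :- (b :+ d)) ≡.refl
      (seq x n) (seq y n) (seq u n) (seq v n))
    (Null-+ x≃y u≃v)

  *ʳ-cong : ∀ {x y u v} → x ≃ y → u ≃ v → x *ʳ u ≃ y *ʳ v
  *ʳ-cong {x} {y} {u} {v} x≃y u≃v = Null-≗
    (λ n → solve 4 (λ a b c d → a :* (c :- d) :+ d :* (a :- b) := a :* c :- b :* d) ≡.refl
      (seq x n) (seq y n) (seq u n) (seq v n))
    (Null-+ {λ n → seq x n ℚ.* (seq u n ℚ.- seq v n)} {λ n → seq v n ℚ.* (seq x n ℚ.- seq y n)}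
      (Null-* {seq x} (cauchy⇒bounded (cauchy x)) u≃v) (Null-* {seq v} (cauchy⇒bounded (cauchy v)) x≃y))

-1*p+p≡0 : ∀ p → (ℚ.- 1ℚ) ℚ.* p ℚ.+ p ≡ 0ℚ
-1*p+p≡0 p = ≡.trans (cong (ℚ._+ p) (≡.trans (≡.sym (ℚ.neg-distribˡ-* 1ℚ p)) (cong ℚ.-_ (ℚ.*-identityˡ p))))
  (ℚ.+-inverseˡ p)

-- Equality and the operations are hidden behind a record and opaque copies, since
-- their definitions would otherwise unfold during unification.
infix 4 _≈ʳ_

record _≈ʳ_ (x y : ℝ) : Set where
  constructor wrap
  field unwrap : x ≃ y

open _≈ʳ_ public

infixl 6 _⊞_
infixl 7 _⊡_

opaque
  _⊞_ _⊡_ : ℝ → ℝ → ℝ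
  _⊞_ = _+ʳ_
  _⊡_ = _*ʳ_

  ⊞≡ : ∀ x y → x ⊞ y ≡ x +ʳ y
  ⊞≡ x y = ≡.refl

  ⊡≡ : ∀ x y → x ⊡ y ≡ x *ʳ y
  ⊡≡ x y = ≡.refl

  private
    pointwise : ∀ {x y} → (∀ n → ℝ.seq x n ≡ ℝ.seq y n) → x ≈ʳ y
    pointwise {x} {y} x≗y = wrap (≗⇒≃ {x} {y} x≗y)

  ≈ʳ-refl : ∀ {x} → x ≈ʳ x
  ≈ʳ-refl {x} = pointwise {x} {x} (λ _ → ≡.refl)

  ≈ʳ-sym : ∀ {x y} → x ≈ʳ y → y ≈ʳ x
  ≈ʳ-sym {x} {y} (wrap x≃y) = wrap (≃-sym {x} {y} x≃y)

  ≈ʳ-trans : ∀ {x y z} → x ≈ʳ y → y ≈ʳ z → x ≈ʳ z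
  ≈ʳ-trans {x} {y} {z} (wrap x≃y) (wrap y≃z) = wrap (≃-trans {x} {y} {z} x≃y y≃z)

  ⊞-cong : ∀ {x y u v} → x ≈ʳ y → u ≈ʳ v → x ⊞ u ≈ʳ y ⊞ v
  ⊞-cong {x} {y} {u} {v} (wrap x≃y) (wrap u≃v) = wrap (+ʳ-cong {x} {y} {u} {v} x≃y u≃v)

  ⊡-cong : ∀ {x y u v} → x ≈ʳ y → u ≈ʳ v → x ⊡ u ≈ʳ y ⊡ v
  ⊡-cong {x} {y} {u} {v} (wrap x≃y) (wrap u≃v) = wrap (*ʳ-cong {x} {y} {u} {v} x≃y u≃v)

  ⊞-assoc : ∀ x y z → x ⊞ y ⊞ z ≈ʳ x ⊞ (y ⊞ z)
  ⊞-assoc x y z = pointwise {x ⊞ y ⊞ z} {x ⊞ (y ⊞ z)} (λ n → ℚ.+-assoc (ℝ.seq x n) (ℝ.seq y n) (ℝ.seq z n))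

  ⊞-comm : ∀ x y → x ⊞ y ≈ʳ y ⊞ x
  ⊞-comm x y = pointwise {x ⊞ y} {y ⊞ x} (λ n → ℚ.+-comm (ℝ.seq x n) (ℝ.seq y n))

  ⊞-identityˡ : ∀ x → 0ℝ ⊞ x ≈ʳ x
  ⊞-identityˡ x = pointwise {0ℝ ⊞ x} {x} (λ n → ℚ.+-identityˡ (ℝ.seq x n))

  ⊞-inverseˡ : ∀ x → (-1ℝ ⊡ x) ⊞ x ≈ʳ 0ℝ
  ⊞-inverseˡ x = pointwise {(-1ℝ ⊡ x) ⊞ x} {0ℝ} (λ n → -1*p+p≡0 (ℝ.seq x n))

  ⊡-assoc : ∀ x y z → x ⊡ y ⊡ z ≈ʳ x ⊡ (y ⊡ z)
  ⊡-assoc x y z = pointwise {x ⊡ y ⊡ z} {x ⊡ (y ⊡ z)} (λ n → ℚ.*-assoc (ℝ.seq x n) (ℝ.seq y n) (ℝ.seq z n))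

  ⊡-comm : ∀ x y → x ⊡ y ≈ʳ y ⊡ x
  ⊡-comm x y = pointwise {x ⊡ y} {y ⊡ x} (λ n → ℚ.*-comm (ℝ.seq x n) (ℝ.seq y n))

  ⊡-identityˡ : ∀ x → 1ℝ ⊡ x ≈ʳ x
  ⊡-identityˡ x = pointwise {1ℝ ⊡ x} {x} (λ n → ℚ.*-identityˡ (ℝ.seq x n))

  ⊡-distribˡ-⊞ : ∀ x y z → x ⊡ (y ⊞ z) ≈ʳ x ⊡ y ⊞ x ⊡ z
  ⊡-distribˡ-⊞ x y z = pointwise {x ⊡ (y ⊞ z)} {x ⊡ y ⊞ x ⊡ z}
    (λ n → ℚ.*-distribˡ-+ (ℝ.seq x n) (ℝ.seq y n) (ℝ.seq z n))

  fromℚ-⊞ : ∀ p q → fromℚ p ⊞ fromℚ q ≈ʳ fromℚ (p ℚ.+ q)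
  fromℚ-⊞ p q = pointwise {fromℚ p +ʳ fromℚ q} {fromℚ (p ℚ.+ q)} (λ _ → ≡.refl)

  fromℚ-⊡ : ∀ p q → fromℚ p ⊡ fromℚ q ≈ʳ fromℚ (p ℚ.* q)
  fromℚ-⊡ p q = pointwise {fromℚ p *ʳ fromℚ q} {fromℚ (p ℚ.* q)} (λ _ → ≡.refl)

ℝ-commutativeRing : CommutativeRing 0ℓ 0ℓ
ℝ-commutativeRing = record
  { Carrier = ℝ ; _≈_ = _≈ʳ_ ; _+_ = _⊞_ ; _*_ = _⊡_ ; -_ = -1ℝ ⊡_ ; 0# = 0ℝ ; 1# = 1ℝ
  ; isCommutativeRing = record
    { isRing = record
      { +-isAbelianGroup = record
        { isGroup = record
          { isMonoid = record
            { isSemigroup = record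
              { isMagma = record
                { isEquivalence = record { refl = ≈ʳ-refl ; sym = ≈ʳ-sym ; trans = ≈ʳ-trans }
                ; ∙-cong = ⊞-cong }
              ; assoc = ⊞-assoc }
            ; identity = ⊞-identityˡ , (λ x → ≈ʳ-trans (⊞-comm x 0ℝ) (⊞-identityˡ x)) }
          ; inverse = ⊞-inverseˡ , (λ x → ≈ʳ-trans (⊞-comm x _) (⊞-inverseˡ x))
          ; ⁻¹-cong = ⊡-cong ≈ʳ-refl }
        ; comm = ⊞-comm }
      ; *-cong = ⊡-cong
      ; *-assoc = ⊡-assoc
      ; *-identity = ⊡-identityˡ , (λ x → ≈ʳ-trans (⊡-comm x 1ℝ) (⊡-identityˡ x))
      ; distrib = ⊡-distribˡ-⊞ , (λ x y z → ≈ʳ-trans (⊡-comm (y ⊞ z) x)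
          (≈ʳ-trans (⊡-distribˡ-⊞ x y z) (⊞-cong (⊡-comm x y) (⊡-comm x z)))) }
    ; *-comm = ⊡-comm } }

module ℝ-Ring = CommutativeRing ℝ-commutativeRing

-- Fractions in ℚ are reduced by a gcd, which is stuck on a variable n; hence the comparison of
-- unnormalised representatives.
suc/1 : ∀ n → + suc n ℚ./ 1 ≡ 1ℚ ℚ.+ (+ n ℚ./ 1)
suc/1 n = ℚ.toℚᵘ-injective (begin
  ℚ.toℚᵘ (+ suc n ℚ./ 1)                   ≈⟨ ℚ.toℚᵘ-fromℚᵘ (mkℚᵘ (+ suc n) 0) ⟩
  mkℚᵘ (+ suc n) 0                         ≈⟨ *≡* (cong (λ m → (+ 1 ℤ.+ m) ℤ.* + 1) (≡.sym (ℤ.*-identityʳ (+ n)))) ⟩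
  mkℚᵘ (+ 1) 0 ℚᵘ.+ mkℚᵘ (+ n) 0            ≈⟨ ℚᵘ.+-cong (ℚᵘ.≃-refl {ℚ.toℚᵘ 1ℚ}) (ℚ.toℚᵘ-fromℚᵘ (mkℚᵘ (+ n) 0)) ⟨
  ℚ.toℚᵘ 1ℚ ℚᵘ.+ ℚ.toℚᵘ (+ n ℚ./ 1)         ≈⟨ ℚ.toℚᵘ-homo-+ 1ℚ (+ n ℚ./ 1) ⟨
  ℚ.toℚᵘ (1ℚ ℚ.+ (+ n ℚ./ 1))              ∎)
  where open SetoidReasoning ℚᵘ.≃-setoid

/-cancel : ∀ a b → .{{_ : ℕ.NonZero b}} → (+ b ℚ./ 1) ℚ.* (+ a ℚ./ b) ≡ + a ℚ./ 1
/-cancel a b@(suc b-1) = ℚ.toℚᵘ-injective (begin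
  ℚ.toℚᵘ ((+ b ℚ./ 1) ℚ.* (+ a ℚ./ b))            ≈⟨ ℚ.toℚᵘ-homo-* (+ b ℚ./ 1) (+ a ℚ./ b) ⟩
  ℚ.toℚᵘ (+ b ℚ./ 1) ℚᵘ.* ℚ.toℚᵘ (+ a ℚ./ b)
    ≈⟨ ℚᵘ.*-cong (ℚ.toℚᵘ-fromℚᵘ (mkℚᵘ (+ b) 0)) (ℚ.toℚᵘ-fromℚᵘ (mkℚᵘ (+ a) b-1)) ⟩
  mkℚᵘ (+ b) 0 ℚᵘ.* mkℚᵘ (+ a) b-1
    ≈⟨ *≡* (≡.trans (ℤ.*-identityʳ _) (≡.trans (ℤ.*-comm (+ b) (+ a)) (cong (λ m → + a ℤ.* + m) (≡.sym (ℕ.*-identityˡ b))))) ⟩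
  mkℚᵘ (+ a) 0                                    ≈⟨ ℚ.toℚᵘ-fromℚᵘ (mkℚᵘ (+ a) 0) ⟨
  ℚ.toℚᵘ (+ a ℚ./ 1)                              ∎)
  where open SetoidReasoning ℚᵘ.≃-setoid

open SemiringMult ℝ-Ring.semiring using () renaming (_×_ to _·ʳ_)

fromℚ-cong : ∀ {p q} → p ≡ q → fromℚ p ≈ʳ fromℚ q
fromℚ-cong ≡.refl = ℝ-Ring.refl

·1≈fraction : ∀ n → n ·ʳ 1ℝ ≈ʳ fraction n 1
·1≈fraction zero    = ℝ-Ring.refl
·1≈fraction (suc n) = ℝ-Ring.trans (ℝ-Ring.+-congˡ (·1≈fraction n))
  (ℝ-Ring.trans (fromℚ-⊞ 1ℚ (+ n ℚ./ 1)) (fromℚ-cong (≡.sym (suc/1 n))))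

fraction-cancel : ∀ a b → .{{_ : ℕ.NonZero b}} → b ·ʳ 1ℝ ⊡ fraction a b ≈ʳ a ·ʳ 1ℝ
fraction-cancel a b = ℝ-Ring.trans (ℝ-Ring.*-congʳ (·1≈fraction b))
  (ℝ-Ring.trans (fromℚ-⊡ (+ b ℚ./ 1) (+ a ℚ./ b)) (ℝ-Ring.trans (fromℚ-cong (/-cancel a b)) (ℝ-Ring.sym (·1≈fraction a))))

ℝ-torsionFree : ∀ k x → suc k ·ʳ x ≈ʳ 0ℝ → x ≈ʳ 0ℝ
ℝ-torsionFree k x kx≈0 = begin
  x                                    ≈⟨ *-identityˡ x ⟨
  1ℝ ⊡ x                               ≈⟨ *-congʳ (trans (fraction-cancel 1 (suc k)) (+-identityʳ 1ℝ)) ⟨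
  suc k ·ʳ 1ℝ ⊡ fraction 1 (suc k) ⊡ x    ≈⟨ *-congʳ (*-comm _ _) ⟩
  fraction 1 (suc k) ⊡ (suc k ·ʳ 1ℝ) ⊡ x  ≈⟨ *-assoc _ _ _ ⟩
  fraction 1 (suc k) ⊡ (suc k ·ʳ 1ℝ ⊡ x)
    ≈⟨ *-congˡ (trans (SemiringMult.×-assoc-* semiring (suc k) 1ℝ x) (SemiringMult.×-congʳ semiring (suc k) (*-identityˡ x))) ⟩
  fraction 1 (suc k) ⊡ (suc k ·ʳ x)    ≈⟨ *-congˡ kx≈0 ⟩
  fraction 1 (suc k) ⊡ 0ℝ              ≈⟨ zeroʳ _ ⟩
  0ℝ                                   ∎
  where
  open ℝ-Ring
  open SetoidReasoning setoid

-- Real polynomials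

-- Stated over an abstract ring, so that the solver works with variables and never with Cauchy
-- sequences.
module Rearrangements {c ℓ} (𝓡 : CommutativeRing c ℓ) where
  open CommutativeRing 𝓡 renaming (refl to ≈-refl)
  open NaturalSolver commutativeSemiring using (solve; _:+_; _:*_; _:=_)

  pull-factor : ∀ c a x y → c * (a * x) + a * y ≈ a * (c * x + y)
  pull-factor = solve 4 (λ c a x y → c :* (a :* x) :+ a :* y := a :* (c :* x :+ y)) ≈-refl

  split-factor : ∀ c x y z w → c * (x + y) + (z + w) ≈ (c * x + z) + (c * y + w)
  split-factor = solve 5 (λ c x y z w → c :* (x :+ y) :+ (z :+ w) := (c :* x :+ z) :+ (c :* y :+ w)) ≈-refl

-- Polynomials are compared through all linear functionals on ℝ[x,y], not only
-- through the coefficients, which makes the congruence of _*ₚ_ immediate.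
evalₚ : (ℕ → ℕ → ℝ) → Poly → ℝ
evalₚ φ []                = 0ℝ
evalₚ φ ((c , i , j) ∷ P) = c ⊡ φ i j ⊞ evalₚ φ P

infix 4 _~_

record _~_ (P Q : Poly) : Set where
  constructor equal
  field evals : ∀ φ → evalₚ φ P ≈ʳ evalₚ φ Q

open _~_ public

module _ where
  open ℝ-Ring renaming (refl to ≈-refl)
  open SetoidReasoning setoid
  open Rearrangements ℝ-commutativeRing

  evalₚ-cong : ∀ {φ ψ} → (∀ i j → φ i j ≈ʳ ψ i j) → ∀ P → evalₚ φ P ≈ʳ evalₚ ψ P
  evalₚ-cong φ≈ψ []                = ≈-refl
  evalₚ-cong φ≈ψ ((c , i , j) ∷ P) = +-cong (*-congˡ (φ≈ψ i j)) (evalₚ-cong φ≈ψ P)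

  evalₚ-zero : ∀ P → evalₚ (λ _ _ → 0ℝ) P ≈ʳ 0ℝ
  evalₚ-zero []      = ≈-refl
  evalₚ-zero (_ ∷ P) = trans (+-cong (zeroʳ _) (evalₚ-zero P)) (+-identityˡ 0ℝ)

  evalₚ-⊡ : ∀ a φ P → evalₚ (λ i j → a ⊡ φ i j) P ≈ʳ a ⊡ evalₚ φ P
  evalₚ-⊡ a φ []                = sym (zeroʳ a)
  evalₚ-⊡ a φ ((c , i , j) ∷ P) = trans (+-congˡ (evalₚ-⊡ a φ P))
    (pull-factor c a _ _)

  evalₚ-⊞ : ∀ φ ψ P → evalₚ (λ i j → φ i j ⊞ ψ i j) P ≈ʳ evalₚ φ P ⊞ evalₚ ψ P
  evalₚ-⊞ φ ψ []                = sym (+-identityˡ 0ℝ)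
  evalₚ-⊞ φ ψ ((c , i , j) ∷ P) = trans (+-congˡ (evalₚ-⊞ φ ψ P))
    (split-factor c _ _ _ _)

  evalₚ-++ : ∀ φ P Q → evalₚ φ (P ++ Q) ≈ʳ evalₚ φ P ⊞ evalₚ φ Q
  evalₚ-++ φ []      Q = sym (+-identityˡ _)
  evalₚ-++ φ (_ ∷ P) Q = trans (+-congˡ (evalₚ-++ φ P Q)) (sym (+-assoc _ _ _))

  evalₚ-* : ∀ φ P Q → evalₚ φ (P *ₚ Q) ≈ʳ evalₚ (λ i j → evalₚ (λ i′ j′ → φ (i ℕ.+ i′) (j ℕ.+ j′)) Q) P
  evalₚ-* φ []                Q = ≈-refl
  evalₚ-* φ ((c , i , j) ∷ P) Q = trans (evalₚ-++ φ (map _ Q) (P *ₚ Q)) (+-cong (row Q) (evalₚ-* φ P Q))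
    where
    row : ∀ Q → evalₚ φ (map (λ (c′ , i′ , j′) → c *ʳ c′ , i ℕ.+ i′ , j ℕ.+ j′) Q) ≈ʳ
      c ⊡ evalₚ (λ i′ j′ → φ (i ℕ.+ i′) (j ℕ.+ j′)) Q
    row []                   = sym (zeroʳ c)
    row ((c′ , i′ , j′) ∷ Q) = trans
      (+-cong (trans (*-congʳ (reflexive (≡.sym (⊡≡ c c′)))) (*-assoc c c′ _)) (row Q)) (sym (distribˡ c _ _))

  evalₚ-swap : ∀ (φ : ℕ → ℕ → ℕ → ℕ → ℝ) P Q →
    evalₚ (λ i j → evalₚ (φ i j) Q) P ≈ʳ evalₚ (λ i′ j′ → evalₚ (λ i j → φ i j i′ j′) P) Q
  evalₚ-swap φ []                Q = sym (evalₚ-zero Q)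
  evalₚ-swap φ ((c , i , j) ∷ P) Q = trans
    (+-cong (sym (evalₚ-⊡ c (φ i j) Q)) (evalₚ-swap φ P Q))
    (sym (evalₚ-⊞ (λ i′ j′ → c ⊡ φ i j i′ j′) _ Q))

infixl 6 _⊕ₚ_
infixl 7 _⊗ₚ_

opaque
  _⊕ₚ_ _⊗ₚ_ : Poly → Poly → Poly
  _⊕ₚ_ = _+ₚ_
  _⊗ₚ_ = _*ₚ_

  ⊕ₚ≡ : ∀ P Q → P ⊕ₚ Q ≡ P +ₚ Q
  ⊕ₚ≡ P Q = ≡.refl

  ⊗ₚ≡ : ∀ P Q → P ⊗ₚ Q ≡ P *ₚ Q
  ⊗ₚ≡ P Q = ≡.refl

  evalₚ-⊕ₚ : ∀ φ P Q → evalₚ φ (P ⊕ₚ Q) ≈ʳ evalₚ φ P ⊞ evalₚ φ Q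
  evalₚ-⊕ₚ = evalₚ-++

  evalₚ-⊗ₚ : ∀ φ P Q → evalₚ φ (P ⊗ₚ Q) ≈ʳ evalₚ (λ i j → evalₚ (λ i′ j′ → φ (i ℕ.+ i′) (j ℕ.+ j′)) Q) P
  evalₚ-⊗ₚ = evalₚ-*

module _ where
  open ℝ-Ring renaming (refl to ≈-refl)

  evalₚ-monomial : ∀ φ c i j → evalₚ φ ((c , i , j) ∷ []) ≈ʳ c ⊡ φ i j
  evalₚ-monomial φ c i j = +-identityʳ _

  evalₚ-const-⊗ : ∀ φ c P → evalₚ φ (constₚ c ⊗ₚ P) ≈ʳ c ⊡ evalₚ φ P
  evalₚ-const-⊗ φ c P = trans (evalₚ-⊗ₚ φ (constₚ c) P)
    (evalₚ-monomial (λ i j → evalₚ (λ i′ j′ → φ (i ℕ.+ i′) (j ℕ.+ j′)) P) c 0 0)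

  private
    ~-refl : ∀ {P} → P ~ P
    ~-refl = equal λ φ → ≈-refl

    ~-sym : ∀ {P Q} → P ~ Q → Q ~ P
    ~-sym P~Q = equal λ φ → sym (evals P~Q φ)

    ~-trans : ∀ {P Q S} → P ~ Q → Q ~ S → P ~ S
    ~-trans P~Q Q~S = equal λ φ → trans (evals P~Q φ) (evals Q~S φ)

    ⊕-cong : ∀ {P Q S T} → P ~ Q → S ~ T → P ⊕ₚ S ~ Q ⊕ₚ T
    ⊕-cong P~Q S~T = equal λ φ → trans (evalₚ-⊕ₚ φ _ _) (trans (+-cong (evals P~Q φ) (evals S~T φ)) (sym (evalₚ-⊕ₚ φ _ _)))

    ⊗-cong : ∀ {P Q S T} → P ~ Q → S ~ T → P ⊗ₚ S ~ Q ⊗ₚ T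
    ⊗-cong {P} {Q} {S} {T} P~Q S~T = equal λ φ → trans (evalₚ-⊗ₚ φ P S)
      (trans (evalₚ-cong (λ i j → evals S~T _) P) (trans (evals P~Q _) (sym (evalₚ-⊗ₚ φ Q T))))

    ⊕-comm : ∀ P Q → P ⊕ₚ Q ~ Q ⊕ₚ P
    ⊕-comm P Q = equal λ φ → trans (evalₚ-⊕ₚ φ P Q) (trans (+-comm _ _) (sym (evalₚ-⊕ₚ φ Q P)))

    ⊕-assoc : ∀ P Q S → (P ⊕ₚ Q) ⊕ₚ S ~ P ⊕ₚ (Q ⊕ₚ S)
    ⊕-assoc P Q S = equal λ φ → trans (evalₚ-⊕ₚ φ _ S) (trans (+-congʳ (evalₚ-⊕ₚ φ P Q))
      (trans (+-assoc _ _ _) (sym (trans (evalₚ-⊕ₚ φ P _) (+-congˡ (evalₚ-⊕ₚ φ Q S))))))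

    ⊕-identityˡ : ∀ P → [] ⊕ₚ P ~ P
    ⊕-identityˡ P = equal λ φ → trans (evalₚ-⊕ₚ φ [] P) (+-identityˡ _)

    ⊕-inverseˡ : ∀ P → constₚ -1ℝ ⊗ₚ P ⊕ₚ P ~ []
    ⊕-inverseˡ P = equal λ φ → trans (evalₚ-⊕ₚ φ _ P) (trans (+-congʳ (evalₚ-const-⊗ φ -1ℝ P)) (-‿inverseˡ _))

    ⊗-comm : ∀ P Q → P ⊗ₚ Q ~ Q ⊗ₚ P
    ⊗-comm P Q = equal λ φ → trans (evalₚ-⊗ₚ φ P Q) (trans (evalₚ-swap _ P Q) (trans
      (evalₚ-cong (λ i j → evalₚ-cong (λ i′ j′ → reflexive (cong₂ φ (ℕ.+-comm i′ i) (ℕ.+-comm j′ j))) P) Q)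
      (sym (evalₚ-⊗ₚ φ Q P))))

    ⊗-assoc : ∀ P Q S → (P ⊗ₚ Q) ⊗ₚ S ~ P ⊗ₚ (Q ⊗ₚ S)
    ⊗-assoc P Q S = equal λ φ → trans (evalₚ-⊗ₚ φ _ S) (trans (evalₚ-⊗ₚ _ P Q)
      (trans (evalₚ-cong (λ i j → trans
          (evalₚ-cong (λ i′ j′ → evalₚ-cong (λ i″ j″ → reflexive (cong₂ φ (ℕ.+-assoc i i′ i″) (ℕ.+-assoc j j′ j″))) S) Q)
          (sym (evalₚ-⊗ₚ _ Q S))) P)
        (sym (evalₚ-⊗ₚ φ P _))))

    ⊗-identityˡ : ∀ P → constₚ 1ℝ ⊗ₚ P ~ P
    ⊗-identityˡ P = equal λ φ → trans (evalₚ-const-⊗ φ 1ℝ P) (*-identityˡ _)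

    ⊗-distribʳ : ∀ P Q S → (Q ⊕ₚ S) ⊗ₚ P ~ Q ⊗ₚ P ⊕ₚ S ⊗ₚ P
    ⊗-distribʳ P Q S = equal λ φ → trans (evalₚ-⊗ₚ φ _ P) (trans (evalₚ-⊕ₚ _ Q S)
      (sym (trans (evalₚ-⊕ₚ φ _ _) (+-cong (evalₚ-⊗ₚ φ Q P) (evalₚ-⊗ₚ φ S P)))))

  𝒫-commutativeRing : CommutativeRing 0ℓ 0ℓ
  𝒫-commutativeRing = record
    { Carrier = Poly ; _≈_ = _~_ ; _+_ = _⊕ₚ_ ; _*_ = _⊗ₚ_ ; -_ = constₚ -1ℝ ⊗ₚ_ ; 0# = [] ; 1# = constₚ 1ℝ
    ; isCommutativeRing = record
      { isRing = record
        { +-isAbelianGroup = record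
          { isGroup = record
            { isMonoid = record
              { isSemigroup = record
                { isMagma = record
                  { isEquivalence = record { refl = ~-refl ; sym = ~-sym ; trans = ~-trans }
                  ; ∙-cong = ⊕-cong }
                ; assoc = ⊕-assoc }
              ; identity = ⊕-identityˡ , (λ P → ~-trans (⊕-comm P []) (⊕-identityˡ P)) }
            ; inverse = ⊕-inverseˡ , (λ P → ~-trans (⊕-comm P _) (⊕-inverseˡ P))
            ; ⁻¹-cong = ⊗-cong ~-refl }
          ; comm = ⊕-comm }
        ; *-cong = ⊗-cong
        ; *-assoc = ⊗-assoc
        ; *-identity = ⊗-identityˡ , (λ P → ~-trans (⊗-comm P _) (⊗-identityˡ P))
        ; distrib = (λ P Q S → ~-trans (⊗-comm P _) (~-trans (⊗-distribʳ P Q S) (⊕-cong (⊗-comm Q P) (⊗-comm S P))))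
                  , ⊗-distribʳ }
      ; *-comm = ⊗-comm } }

module 𝒫 = CommutativeRing 𝒫-commutativeRing
open SemiringMult 𝒫.semiring using () renaming (_×_ to _·ₚ_)
open SemiringExp 𝒫.semiring using () renaming (_^_ to _^ᵖ_)

^ₚ≡^ᵖ : ∀ P k → P ^ₚ k ≡ P ^ᵖ k
^ₚ≡^ᵖ P zero    = ≡.refl
^ₚ≡^ᵖ P (suc k) = ≡.trans (cong (P *ₚ_) (^ₚ≡^ᵖ P k)) (≡.sym (⊗ₚ≡ P _))

module _ where
  open ℝ-Ring renaming (refl to ≈-refl)

  evalₚ-·ₚ : ∀ k φ P → evalₚ φ (k ·ₚ P) ≈ʳ k ·ʳ evalₚ φ P
  evalₚ-·ₚ zero    φ P = ≈-refl
  evalₚ-·ₚ (suc k) φ P = trans (evalₚ-⊕ₚ φ P _) (+-congˡ (evalₚ-·ₚ k φ P))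

  𝒫-torsionFree : ∀ k P → suc k ·ₚ P ~ [] → P ~ []
  𝒫-torsionFree k P kP~0 = equal λ φ → ℝ-torsionFree k _ (trans (sym (evalₚ-·ₚ (suc k) φ P)) (evals kP~0 φ))

  constₚ-cong : ∀ {a b} → a ≈ʳ b → constₚ a ~ constₚ b
  constₚ-cong a≈b = equal λ φ → +-congʳ (*-congʳ a≈b)

  constₚ-⊞ : ∀ a b → constₚ (a ⊞ b) ~ constₚ a ⊕ₚ constₚ b
  constₚ-⊞ a b = equal λ φ → sym (trans (evalₚ-⊕ₚ φ (constₚ a) (constₚ b))
    (trans (+-cong (+-identityʳ _) (+-identityʳ _)) (trans (sym (distribʳ _ a b)) (sym (+-identityʳ _)))))

  constₚ-⊡ : ∀ a b → constₚ (a ⊡ b) ~ constₚ a ⊗ₚ constₚ b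
  constₚ-⊡ a b = equal λ φ → sym (trans (evalₚ-const-⊗ φ a (constₚ b))
    (trans (*-congˡ (+-identityʳ _)) (trans (sym (*-assoc a b _)) (sym (+-identityʳ _)))))

  constₚ-0 : constₚ 0ℝ ~ []
  constₚ-0 = equal λ φ → trans (+-identityʳ _) (zeroˡ _)

  constₚ-·ʳ : ∀ k → constₚ (k ·ʳ 1ℝ) ~ k ·ₚ constₚ 1ℝ
  constₚ-·ʳ zero    = constₚ-0
  constₚ-·ʳ (suc k) = 𝒫.trans (constₚ-⊞ 1ℝ (k ·ʳ 1ℝ)) (𝒫.+-congˡ (constₚ-·ʳ k))

  evalₚ-X-⊗ : ∀ φ P → evalₚ φ (X ⊗ₚ P) ≈ʳ evalₚ (λ i j → φ (suc i) j) P
  evalₚ-X-⊗ φ P = trans (evalₚ-⊗ₚ φ X P) (trans (+-identityʳ _) (*-identityˡ _))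

  evalₚ-Y-⊗ : ∀ φ P → evalₚ φ (Y ⊗ₚ P) ≈ʳ evalₚ (λ i j → φ i (suc j)) P
  evalₚ-Y-⊗ φ P = trans (evalₚ-⊗ₚ φ Y P) (trans (+-identityʳ _) (*-identityˡ _))

  -- Every functional ψ has the form P ↦ φ (Y P), where φ is ψ shifted by one power of y. The value
  -- of φ at y^0 is arbitrary, since multiples of Y never reach it.
  Y-cancel : ∀ {P Q} → Y ⊗ₚ P ~ Y ⊗ₚ Q → P ~ Q
  Y-cancel {P} {Q} YP~YQ = equal λ ψ →
    trans (sym (evalₚ-Y-⊗ (shift ψ) P)) (trans (evals YP~YQ (shift ψ)) (evalₚ-Y-⊗ (shift ψ) Q))
    where
    shift : (ℕ → ℕ → ℝ) → ℕ → ℕ → ℝ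
    shift ψ i zero    = 0ℝ
    shift ψ i (suc j) = ψ i j

  -- Every functional ψ is P ↦ φ ((X + c Y) P) for some φ: solve
  -- φ (i + 1) j + c φ i (j + 1) = ψ i j by recursion on i.
  linear-cancel : ∀ c {P Q} → (X ⊕ₚ constₚ c ⊗ₚ Y) ⊗ₚ P ~ (X ⊕ₚ constₚ c ⊗ₚ Y) ⊗ₚ Q → P ~ Q
  linear-cancel c {P} {Q} LP~LQ = equal λ ψ → trans (sym (eval-L ψ P)) (trans (evals LP~LQ (lift ψ)) (eval-L ψ Q))
    where
    lift : (ℕ → ℕ → ℝ) → ℕ → ℕ → ℝ
    lift ψ zero    j = 0ℝ
    lift ψ (suc i) j = ψ i j - c ⊡ lift ψ i (suc j)

    eval-L : ∀ ψ P → evalₚ (lift ψ) ((X ⊕ₚ constₚ c ⊗ₚ Y) ⊗ₚ P) ≈ʳ evalₚ ψ P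
    eval-L ψ P = begin
      evalₚ (lift ψ) ((X ⊕ₚ constₚ c ⊗ₚ Y) ⊗ₚ P)
        ≈⟨ evals (𝒫.trans (𝒫.distribʳ P X _) (𝒫.+-congˡ (𝒫.*-assoc _ Y P))) (lift ψ) ⟩
      evalₚ (lift ψ) (X ⊗ₚ P ⊕ₚ constₚ c ⊗ₚ (Y ⊗ₚ P))
        ≈⟨ evalₚ-⊕ₚ (lift ψ) _ _ ⟩
      evalₚ (lift ψ) (X ⊗ₚ P) ⊞ evalₚ (lift ψ) (constₚ c ⊗ₚ (Y ⊗ₚ P))
        ≈⟨ +-cong (evalₚ-X-⊗ (lift ψ) P) (trans (evalₚ-const-⊗ (lift ψ) c _) (*-congˡ (evalₚ-Y-⊗ (lift ψ) P))) ⟩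
      evalₚ (λ i j → lift ψ (suc i) j) P ⊞ c ⊡ evalₚ (λ i j → lift ψ i (suc j)) P
        ≈⟨ +-congˡ (evalₚ-⊡ c _ P) ⟨
      evalₚ (λ i j → lift ψ (suc i) j) P ⊞ evalₚ (λ i j → c ⊡ lift ψ i (suc j)) P
        ≈⟨ evalₚ-⊞ _ _ P ⟨
      evalₚ (λ i j → lift ψ (suc i) j ⊞ c ⊡ lift ψ i (suc j)) P
        ≈⟨ evalₚ-cong (λ i j → trans (+-assoc _ _ _) (trans (+-congˡ (-‿inverseˡ _)) (+-identityʳ _))) P ⟩
      evalₚ ψ P ∎
      where open SetoidReasoning setoid

power-cancel : ∀ {L} → (∀ {P Q} → L ⊗ₚ P ~ L ⊗ₚ Q → P ~ Q) → ∀ d {P Q} → L ^ᵖ d ⊗ₚ P ~ L ^ᵖ d ⊗ₚ Q → P ~ Q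
power-cancel cancel zero    eq = 𝒫.trans (𝒫.sym (𝒫.*-identityˡ _)) (𝒫.trans eq (𝒫.*-identityˡ _))
power-cancel cancel (suc d) eq = power-cancel cancel d (cancel
  (𝒫.trans (𝒫.sym (𝒫.*-assoc _ _ _)) (𝒫.trans eq (𝒫.*-assoc _ _ _))))

term : Poly → Poly → ℝ × ℕ × ℕ → Poly
term P Q (c , i , j) = constₚ c ⊗ₚ P ^ᵖ i ⊗ₚ Q ^ᵖ j

monomial~ : ∀ c i j → (c , i , j) ∷ [] ~ term X Y (c , i , j)
monomial~ c i j = 𝒫.trans (base i j) (𝒫.sym (𝒫.*-assoc _ _ _))
  where
  open ℝ-Ring renaming (refl to ≈-refl)
  Y-power : ∀ φ j → evalₚ φ (Y ^ᵖ j) ≈ʳ φ 0 j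
  Y-power φ zero    = trans (+-identityʳ _) (*-identityˡ _)
  Y-power φ (suc j) = trans (evalₚ-Y-⊗ φ (Y ^ᵖ j)) (Y-power (λ i j → φ i (suc j)) j)
  XY-power : ∀ φ i j → evalₚ φ (X ^ᵖ i ⊗ₚ Y ^ᵖ j) ≈ʳ φ i j
  XY-power φ zero    j = trans (evals (𝒫.*-identityˡ (Y ^ᵖ j)) φ) (Y-power φ j)
  XY-power φ (suc i) j = trans (evals (𝒫.*-assoc X _ _) φ)
    (trans (evalₚ-X-⊗ φ _) (XY-power (λ i j → φ (suc i) j) i j))
  base : ∀ i j → (c , i , j) ∷ [] ~ constₚ c ⊗ₚ (X ^ᵖ i ⊗ₚ Y ^ᵖ j)
  base i j = equal λ φ → trans (+-identityʳ _) (sym (trans (evalₚ-const-⊗ φ c _) (*-congˡ (XY-power φ i j))))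

module 𝒫-Sums = Sums 𝒫.+-commutativeMonoid
open 𝒫-Sums using () renaming (sum to sumₚ; _when_ to _whenₚ_)

-- The same polynomial as `Z [ P , Q ]`, built from the opaque operations so that the laws of the
-- polynomial ring apply.
substitute : Poly → Poly → Poly → Poly
substitute P Q []      = []
substitute P Q (m ∷ Z) = term P Q m ⊕ₚ substitute P Q Z

substitute-XY : ∀ Z → Z ~ substitute X Y Z
substitute-XY []      = 𝒫.refl
substitute-XY (m ∷ Z) = 𝒫.trans (𝒫.reflexive (≡.sym (⊕ₚ≡ (m ∷ []) Z)))
  (𝒫.+-cong (monomial~ _ _ _) (substitute-XY Z))

[,]~substitute : ∀ Z P Q → Z [ P , Q ] ~ substitute P Q Z
[,]~substitute []                P Q = 𝒫.refl
[,]~substitute ((c , i , j) ∷ Z) P Q = 𝒫.trans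
  (𝒫.reflexive (≡.sym (⊕ₚ≡ (constₚ c *ₚ P ^ₚ i *ₚ Q ^ₚ j) (Z [ P , Q ]))))
  (𝒫.+-cong (𝒫.reflexive (≡.trans (cong₂ (λ A B → constₚ c *ₚ A *ₚ B) (^ₚ≡^ᵖ P i) (^ₚ≡^ᵖ Q j))
      (≡.trans (cong (_*ₚ Q ^ᵖ j) (≡.sym (⊗ₚ≡ (constₚ c) (P ^ᵖ i)))) (≡.sym (⊗ₚ≡ _ (Q ^ᵖ j))))))
    ([,]~substitute Z P Q))

substitute-cong : ∀ {P P′ Q Q′} → P ~ P′ → Q ~ Q′ → ∀ Z → substitute P Q Z ~ substitute P′ Q′ Z
substitute-cong P~ Q~ []                = 𝒫.refl
substitute-cong P~ Q~ ((c , i , j) ∷ Z) = 𝒫.+-cong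
  (𝒫.*-cong (𝒫.*-congˡ (SemiringExp.^-congˡ 𝒫.semiring i P~)) (SemiringExp.^-congˡ 𝒫.semiring j Q~))
  (substitute-cong P~ Q~ Z)

substitute-sum : ∀ {a p} {A : Set a} {M : Pred A p} (M? : Decidable M) (h : A → ℝ × ℕ × ℕ) P Q {n} (v : Fin n → A) →
  substitute P Q (map h (filter M? (List.tabulate v))) ~ sumₚ (λ k → term P Q (h (v k)) whenₚ does (M? (v k)))
substitute-sum M? h P Q {zero}  v = 𝒫.sym (𝒫-Sums.sum-zero _)
substitute-sum M? h P Q {suc n} v with M? (v Fin.zero) in eq
... | yes _ = 𝒫.trans (𝒫.+-cong (𝒫.reflexive (cong (λ b → term P Q (h (v Fin.zero)) whenₚ b) (≡.sym (cong does eq))))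
      (substitute-sum M? h P Q (v ∘ Fin.suc))) (𝒫.sym (𝒫-Sums.sum-suc _))
... | no _  = 𝒫.trans (substitute-sum M? h P Q (v ∘ Fin.suc))
      (𝒫.trans (𝒫.sym (𝒫.+-identityˡ _))
        (𝒫.trans (𝒫.+-congʳ (𝒫.reflexive (cong (λ b → term P Q (h (v Fin.zero)) whenₚ b) (≡.sym (cong does eq)))))
          (𝒫.sym (𝒫-Sums.sum-suc _))))

module ℝ-Sums = Sums ℝ-Ring.+-commutativeMonoid
open ℝ-Sums using () renaming (_when_ to _whenʳ_)

listSum : ∀ {a} {A : Set a} → (A → ℝ) → List A → ℝ
listSum v []       = 0ℝ
listSum v (x ∷ xs) = v x ⊞ listSum v xs

module _ {a p} {A : Set a} {P : Pred A p} (P? : Decidable P) (g : ∀ x → P x → ℝ) where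

  -- The graph of sumOver: as an index, the sum of reals is never normalised
  -- together with its Cauchy proof.
  data SumOf : List A → ℝ → Set (a Level.⊔ p) where
    none : SumOf [] 0ℝ
    take : ∀ {x xs a r} (px : P x) → does (P? x) ≡ true → a ≡ g x px → SumOf xs r → SumOf (x ∷ xs) (a +ʳ r)
    skip : ∀ {x xs r} → does (P? x) ≡ false → SumOf xs r → SumOf (x ∷ xs) r

  sumOf : ∀ xs → SumOf xs (sumOver xs P? g)
  sumOf []       = none
  sumOf (x ∷ xs) with P? x in eq
  ... | yes px = take px (cong does eq) ≡.refl (sumOf xs)
  ... | no ¬px = skip (cong does eq) (sumOf xs)

  module _ (v : A → ℝ) (g≈v : ∀ x px → g x px ≈ʳ v x) where
    open ℝ-Ring renaming (refl to ≈-refl)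

    sumOf≈listSum : ∀ {xs r} → SumOf xs r → r ≈ʳ listSum (λ x → v x whenʳ does (P? x)) xs
    sumOf≈listSum none = ≈-refl
    sumOf≈listSum (take {x} {xs} {a} {r} px does≡ a≡ s) = trans (reflexive (≡.sym (⊞≡ a r)))
      (+-cong (trans (reflexive a≡) (trans (g≈v x px) (reflexive (cong (v x whenʳ_) (≡.sym does≡)))))
        (sumOf≈listSum s))
    sumOf≈listSum (skip {x} does≡ s) = trans (sumOf≈listSum s) (trans (sym (+-identityˡ _))
      (+-congʳ (reflexive (cong (v x whenʳ_) (≡.sym does≡)))))

    sumOver≈listSum : ∀ xs → sumOver xs P? g ≈ʳ listSum (λ x → v x whenʳ does (P? x)) xs
    sumOver≈listSum xs = sumOf≈listSum (sumOf xs)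

indicator : Bool → ℝ
indicator b = 1ℝ whenʳ b

-- Extracting a coefficient is itself a linear functional, so `_~_` implies equality of
-- coefficients.
coeff≈evalₚ : ∀ P i j → coeff P i j ≈ʳ evalₚ (λ i′ j′ → indicator (does ((i′ ℕ.≟ i) ×-dec (j′ ℕ.≟ j)))) P
coeff≈evalₚ P i j = trans (sumOver≈listSum (λ (_ , i′ , j′) → (i′ ℕ.≟ i) ×-dec (j′ ℕ.≟ j)) (λ (c , _) _ → c)
  proj₁ (λ _ _ → ≈-refl) P) (expand P)
  where
  open ℝ-Ring renaming (refl to ≈-refl)
  scale : ∀ c b → c whenʳ b ≈ʳ c ⊡ indicator b
  scale c true  = sym (*-identityʳ c)
  scale c false = sym (zeroʳ c)
  expand : ∀ P → listSum (λ (c , i′ , j′) → c whenʳ does ((i′ ℕ.≟ i) ×-dec (j′ ℕ.≟ j))) P ≈ʳ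
    evalₚ (λ i′ j′ → indicator (does ((i′ ℕ.≟ i) ×-dec (j′ ℕ.≟ j)))) P
  expand []                  = ≈-refl
  expand ((c , i′ , j′) ∷ P) = +-cong (scale c (does ((i′ ℕ.≟ i) ×-dec (j′ ℕ.≟ j)))) (expand P)

~⇒≈ₚ : ∀ {P Q} → P ~ Q → P ≈ₚ[x,y] Q
~⇒≈ₚ {P} {Q} P~Q i j = unwrap (ℝ-Ring.trans (coeff≈evalₚ P i j)
  (ℝ-Ring.trans (evals P~Q _) (ℝ-Ring.sym (coeff≈evalₚ Q i j))))

homogeneous : ∀ e P → All (λ (c , i , j) → + (i ℕ.+ j) ≢ e → c ≈ʳ 0ℝ) P → Homogeneous e P
homogeneous e P all i j i+j≢e = unwrap (ℝ-Ring.trans (coeff≈evalₚ P i j) (vanish P all))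
  where
  open ℝ-Ring renaming (refl to ≈-refl)
  vanish : ∀ P → All (λ (c , i , j) → + (i ℕ.+ j) ≢ e → c ≈ʳ 0ℝ) P →
    evalₚ (λ i′ j′ → indicator (does ((i′ ℕ.≟ i) ×-dec (j′ ℕ.≟ j)))) P ≈ʳ 0ℝ
  vanish []                  []       = ≈-refl
  vanish ((c , i′ , j′) ∷ P) (h ∷ hs) = trans (+-cong head (vanish P hs)) (+-identityˡ 0ℝ)
    where
    head : c ⊡ indicator (does ((i′ ℕ.≟ i) ×-dec (j′ ℕ.≟ j))) ≈ʳ 0ℝ
    head = helper ((i′ ℕ.≟ i) ×-dec (j′ ℕ.≟ j))
      where
      helper : (eq? : Dec (i′ ≡ i × j′ ≡ j)) → c ⊡ indicator (does eq?) ≈ʳ 0ℝ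
      helper (yes (≡.refl , ≡.refl)) = trans (*-congʳ (h i+j≢e)) (zeroˡ _)
      helper (no _)                  = zeroʳ c

-- Supports and shortened codes

module Supports {c ℓ} (R : Ring c ℓ) {q} (enum : Enumeration R q) where
  open Ring R renaming (refl to ≈-refl; sym to ≈-sym; trans to ≈-trans)
  open Vectors R enum
  open Inverse enum using (to; from; to-cong; strictlyInverseˡ; strictlyInverseʳ)

  support : ∀ {n} → V n → Subset n
  support v = Vec.tabulate (λ i → not (does (v i ≟ 0#)))

  nonzero : Fin q → Bool
  nonzero a = not (does (from a ≟ 0#))

  -- This is q - 1, kept as a count to avoid subtraction; see `suc-nonzeros`.
  nonzeros : ℕ
  nonzeros = sumℕ (λ a → 1 whenℕ nonzero a)

  support-combine : ∀ {n} (a : Fin q) (l : Fin (q ℕ.^ n)) →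
    support (vector {suc n} (combine a l)) ≡ nonzero a ∷ support (vector {n} l)
  support-combine {n} a l = cong₂ (λ b m → not (does (from b ≟ 0#)) ∷ support (vector {n} m))
    (cong proj₁ (Fin.remQuot-combine {n = q} a l)) (cong proj₂ (Fin.remQuot-combine {n = q} a l))

  ∈-support⁺ : ∀ {n} {v : V n} {i} → ¬ (v i ≈ 0#) → i Subset.∈ support v
  ∈-support⁺ {v = v} {i} vi≉0 = Vec.lookup⇒[]= i (support v)
    (≡.trans (Vec.lookup∘tabulate _ i) (cong not (dec-false (v i ≟ 0#) vi≉0)))

  ∈-support⁻ : ∀ {n} {v : V n} {i} → i Subset.∈ support v → ¬ (v i ≈ 0#)
  ∈-support⁻ {v = v} {i} i∈ vi≈0
    with ≡.trans (≡.sym (Vec.[]=⇒lookup i∈)) (≡.trans (Vec.lookup∘tabulate _ i) (cong not (dec-true (v i ≟ 0#) vi≈0)))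
  ... | ()

  support⊆⁺ : ∀ {n} {v : V n} {S} → (∀ i → i Subset.∉ S → v i ≈ 0#) → support v Subset.⊆ S
  support⊆⁺ {v = v} {S} h {i} i∈ with i Subset.∈? S
  ... | yes i∈S = i∈S
  ... | no  i∉S = contradiction (h i i∉S) (∈-support⁻ {v = v} i∈)

  support⊆⁻ : ∀ {n} {v : V n} {S} → support v Subset.⊆ S → ∀ i → i Subset.∉ S → v i ≈ 0#
  support⊆⁻ {v = v} ⊆S i i∉S with v i ≟ 0#
  ... | yes vi≈0 = vi≈0
  ... | no  vi≉0 = contradiction (⊆S (∈-support⁺ {v = v} vi≉0)) i∉S

  support-cong : ∀ {n} {u v : V n} → u ≋ v → support u ≡ support v
  support-cong {u = u} {v} u≋v = Subset.⊆-antisym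
    (λ {i} i∈ → ∈-support⁺ {v = v} (λ vi≈0 → ∈-support⁻ {v = u} i∈ (≈-trans (u≋v i) vi≈0)))
    (λ {i} i∈ → ∈-support⁺ {v = u} (λ ui≈0 → ∈-support⁻ {v = v} i∈ (≈-trans (≈-sym (u≋v i)) ui≈0)))

  module _ {m ℓm} (M : CommutativeMonoid m ℓm) where
    private
      module M = CommutativeMonoid M
      module S = Sums M
    open MonoidMult M.monoid using (×-congʳ) renaming (_×_ to _·_)
    open S using (_when_)
    open SetoidReasoning M.setoid

    -- Each subset z of S enters (q-1)^|z| times, the number of vectors whose support is z.
    weighted-total : ∀ {n} → Subset n → (Subset n → M.Carrier) → M.Carrier
    weighted-total []            F = F []
    weighted-total (outside ∷ S) F = weighted-total S (F ∘ (outside ∷_))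
    weighted-total (inside  ∷ S) F =
      weighted-total S (F ∘ (outside ∷_)) M.∙ nonzeros · weighted-total S (F ∘ (inside ∷_))

    -- The first coordinate vanishes in one way and is nonzero in `nonzeros` ways, the latter being
    -- admissible only if it belongs to S. The monoid is arbitrary because the sum is used in ℕ for
    -- sizes and in ℝ for f̃.
    support-sum : ∀ {n} (S : Subset n) F →
      S.sum (λ k → F (support (vector {n} k)) when does (support (vector {n} k) Subset.⊆? S)) M.≈ weighted-total S F
    support-sum []      F = M.trans (S.sum-suc _) (M.trans (M.∙-congˡ (S.sum-zero _)) (M.identityʳ _))
    support-sum {suc n} (s ∷ S) F = begin
      S.sum (λ k → G (support (vector {suc n} k)))
        ≈⟨ S.sum-combine q {q ℕ.^ n} _ ⟩
      S.sum (λ (a : Fin q) → S.sum (λ (l : Fin (q ℕ.^ n)) → G (support (vector {suc n} (combine a l)))))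
        ≈⟨ S.sum-cong (λ a → S.sum-cong (λ l → M.reflexive (cong G (support-combine {n} a l)))) ⟩
      S.sum (λ (a : Fin q) → S.sum (λ (l : Fin (q ℕ.^ n)) → G (nonzero a ∷ support (vector {n} l))))
        ≈⟨ S.sum-cong (λ a → split (nonzero a)) ⟩
      S.sum (λ a → (inner false when not (nonzero a)) M.∙ (inner true when nonzero a))
        ≈⟨ S.sum-∙ _ _ ⟩
      S.sum (λ a → inner false when not (nonzero a)) M.∙ S.sum (λ a → inner true when nonzero a)
        ≈⟨ M.∙-cong zero-part (M.sym (sum-when-· M nonzero (inner true))) ⟩
      inner false M.∙ nonzeros · inner true
        ≈⟨ total s refl ⟩
      weighted-total (s ∷ S) F ∎
      where
      G : Subset (suc n) → M.Carrier
      G z = F z when does (z Subset.⊆? (s ∷ S))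

      inner : Bool → M.Carrier
      inner b = S.sum (λ (l : Fin (q ℕ.^ n)) → G (b ∷ support (vector {n} l)))

      split : ∀ b → inner b M.≈ (inner false when not b) M.∙ (inner true when b)
      split true  = M.sym (M.identityˡ _)
      split false = M.sym (M.identityʳ _)

      zero-part : S.sum (λ a → inner false when not (nonzero a)) M.≈ inner false
      zero-part = M.trans
        (S.sum-cong (λ a → M.reflexive (cong (inner false when_) (not-not (does (from a ≟ 0#))))))
        (S.sum-unique (λ a → from a ≟ 0#) (λ _ → inner false) (to 0#) (strictlyInverseʳ 0#)
          (λ {a} a≈0 → ≡.trans (≡.sym (strictlyInverseˡ a)) (to-cong a≈0)))
        where
        not-not : ∀ b → not (not b) ≡ b
        not-not true  = refl
        not-not false = refl

      inner-false : inner false M.≈ weighted-total S (F ∘ (outside ∷_))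
      inner-false = M.trans (S.sum-cong (λ l → S.when-cong ((outside ∷ support (vector {n} l)) Subset.⊆? (s ∷ S))
          (support (vector {n} l) Subset.⊆? S) Subset.drop-∷-⊆ Subset.out⊆ (λ _ → M.refl)))
        (support-sum S (F ∘ (outside ∷_)))

      ·-ε : ∀ k → k · M.ε M.≈ M.ε
      ·-ε zero    = M.refl
      ·-ε (suc k) = M.trans (M.identityˡ _) (·-ε k)

      total : ∀ s′ → s ≡ s′ → inner false M.∙ nonzeros · inner true M.≈ weighted-total (s′ ∷ S) F
      total true refl = M.∙-cong inner-false (×-congʳ nonzeros (M.trans
        (S.sum-cong (λ l → S.when-cong ((inside ∷ support (vector {n} l)) Subset.⊆? (inside ∷ S))
          (support (vector {n} l) Subset.⊆? S) Subset.drop-∷-⊆ Subset.in⊆in (λ _ → M.refl)))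
        (support-sum S (F ∘ (inside ∷_)))))
      total false refl = M.trans (M.∙-cong inner-false (M.trans (×-congʳ nonzeros (S.sum-ε λ l → M.refl)) (·-ε nonzeros)))
        (M.identityʳ _)

  suc-nonzeros : suc nonzeros ≡ q
  suc-nonzeros = ≡.trans (≡.sym (≡.trans (ℕ-Sums.sum-∙ _ _) (cong (ℕ._+ nonzeros)
      (ℕ-Sums.sum-unique (λ a → from a ≟ 0#) (λ _ → 1) (to 0#) (strictlyInverseʳ 0#)
        (λ {a} a≈0 → ≡.trans (≡.sym (strictlyInverseˡ a)) (to-cong a≈0))))))
    (≡.trans (ℕ-Sums.sum-cong (λ a → one (does (from a ≟ 0#))))
      (≡.trans (ℕ-Sums.sum-cong {g = λ a → 1 whenℕ does (a Subset.∈? Subset.⊤)}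
          (λ a → cong (1 whenℕ_) (≡.sym (dec-true (a Subset.∈? Subset.⊤) Subset.∈⊤))))
        (≡.trans (≡.sym (∣-∣≡sum Subset.⊤)) (Subset.∣⊤∣≡n q))))
    where
    one : ∀ b → (1 whenℕ b) ℕ.+ (1 whenℕ not b) ≡ 1
    one true  = refl
    one false = refl

  weighted-total-1 : ∀ {n} (S : Subset n) → weighted-total ℕ.+-0-commutativeMonoid S (λ _ → 1) ≡ q ℕ.^ ∣ S ∣
  weighted-total-1 []            = refl
  weighted-total-1 (outside ∷ S) = weighted-total-1 S
  weighted-total-1 (inside  ∷ S) = ≡.trans
    (≡.trans (cong (weighted-total ℕ.+-0-commutativeMonoid S (λ _ → 1) ℕ.+_) (·≡* nonzeros _))
      (cong (ℕ._* weighted-total ℕ.+-0-commutativeMonoid S (λ _ → 1)) suc-nonzeros))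
    (cong (q ℕ.*_) (weighted-total-1 S))
    where
    open MonoidMult ℕ.+-0-monoid using () renaming (_×_ to _·_)
    ·≡* : ∀ k m → k · m ≡ k ℕ.* m
    ·≡* zero    m = refl
    ·≡* (suc k) m = cong (m ℕ.+_) (·≡* k m)

  module _ {a b} (𝓡 : CommutativeRing a b) where
    open SubsetFunctions 𝓡
    open CommutativeRing 𝓡 using () renaming (_≈_ to _≈𝓡_; 1# to 1𝓡; 0# to 0𝓡; +-commutativeMonoid to 𝓡-+)
    private module 𝓡 = CommutativeRing 𝓡
    open SemiringMult 𝓡.semiring using (×-assoc-*; ×-congʳ) renaming (_×_ to _·_)

    weighted-total≈evaluate₁ : ∀ {n} (S : Subset n) F →
      weighted-total 𝓡-+ S F ≈𝓡 evaluate₁ F (pick S (nonzeros · 1𝓡) 0𝓡)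
    weighted-total≈evaluate₁ []            F = 𝓡.refl
    weighted-total≈evaluate₁ (outside ∷ S) F = 𝓡.trans (weighted-total≈evaluate₁ S (F ∘ (outside ∷_)))
      (𝓡.sym (𝓡.trans (𝓡.+-cong (𝓡.*-identityˡ _) (𝓡.zeroˡ _)) (𝓡.+-identityʳ _)))
    weighted-total≈evaluate₁ (inside  ∷ S) F = 𝓡.+-cong
      (𝓡.trans (weighted-total≈evaluate₁ S (F ∘ (outside ∷_))) (𝓡.sym (𝓡.*-identityˡ _)))
      (𝓡.trans (×-congʳ nonzeros (𝓡.trans (weighted-total≈evaluate₁ S (F ∘ (inside ∷_))) (𝓡.sym (𝓡.*-identityˡ _))))
        (𝓡.sym (×-assoc-* nonzeros 1𝓡 _)))

module Shortening {c ℓ} (R : Ring c ℓ) {q} (enum : Enumeration R q)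
    {g} (generator : FiniteRing.SocleGenerator R enum g) (n : ℕ) where
  open Ring R renaming (refl to ≈-refl; sym to ≈-sym; trans to ≈-trans)
  open Vectors R enum
  open Supports R enum
  open VectorDuality R enum generator n
  open Subcodes n
  private module DV = Differences (LeftModule.+ᴹ-abelianGroup (vectorModule n))
  open FiniteAbelianGroup group
    using (_∈_; _∈?_; ∈-resp; to; from; Property; comprehension; ∈-comprehension⁺; ∈-comprehension⁻;
      ∈-from; ∈-from⁻; ⊆⁺)

  private
    N = q ℕ.^ n

    ∈-supported : Subset n → Property Level.zero
    ∈-supported S = record
      { holds = λ u → support u Subset.⊆ S ; holds? = λ u → support u Subset.⊆? S
      ; resp = λ u≋v h → subst (Subset._⊆ S) (support-cong u≋v) h }

  supported : Subset n → Subset N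
  supported S = comprehension (∈-supported S)

  ∈-supported⁺ : ∀ {S u} → (∀ i → i Subset.∉ S → u i ≈ 0#) → u ∈ supported S
  ∈-supported⁺ {S} {u} h = ∈-comprehension⁺ (∈-supported S) {u} (support⊆⁺ {v = u} h)

  ∈-supported⁻ : ∀ {S u} → u ∈ supported S → ∀ i → i Subset.∉ S → u i ≈ 0#
  ∈-supported⁻ {S} {u} u∈ = support⊆⁻ {v = u} (∈-comprehension⁻ (∈-supported S) {u} u∈)

  supported-isSubmodule : ∀ S → IsSubmodule (supported S)
  supported-isSubmodule S = record
    { 0-∈ = ∈-supported⁺ λ _ _ → ≈-refl
    ; +-∈ = λ u∈ v∈ → ∈-supported⁺ λ i i∉ →
        ≈-trans (+-cong (∈-supported⁻ u∈ i i∉) (∈-supported⁻ v∈ i i∉)) (+-identityˡ 0#)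
    ; neg-∈ = λ u∈ → ∈-supported⁺ λ i i∉ →
        ≈-trans (-‿cong (∈-supported⁻ u∈ i i∉)) (≈-trans (≈-sym (+-identityʳ _)) (-‿inverseˡ 0#))
    ; *-∈ = λ {s} _ u∈ → ∈-supported⁺ λ i i∉ → ≈-trans (*-congˡ (∈-supported⁻ u∈ i i∉)) (zeroʳ s)
    }

  ∣supported∣ : ∀ S → ∣ supported S ∣ ≡ q ℕ.^ ∣ S ∣
  ∣supported∣ S = ≡.trans (∣tabulate∣≡sum _)
    (≡.trans (support-sum ℕ.+-0-commutativeMonoid S (λ _ → 1)) (weighted-total-1 S))

  private
    module _ {A : Subset N} (A-sub : IsSubmodule A) (S : Subset n) where
      private
        module A = IsSubmodule A-sub
        module S = IsSubmodule (supported-isSubmodule S)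
        B = A ⊕ supported S

      -- The second isomorphism theorem for A and the vectors supported in S, as two double counts
      -- of the relation that x - y lies in A, read once in each direction.
      sum-size : ∣ B ∣ ℕ.* ∣ A ∩ supported S ∣ ≡ q ℕ.^ ∣ S ∣ ℕ.* ∣ A ∣
      sum-size = ≡.trans (ℕ.≤-antisym
        (relation-bound group group (λ x y → (λ i → x i - y i) ∈? A) B A (supported S) (A ∩ supported S)
          (λ x x∈B → let y₀ , y₀∈ , x-y₀∈A = ∈-⊕⁻ x∈B in y₀ , λ y y-y₀∈ →
            let d∈A , d∈S = Subset.x∈p∩q⁻ A (supported S) y-y₀∈
            in S.∈-from-difference d∈S y₀∈ , ∈-resp (DV.difference-cancelʳ x y y₀) (A.difference-∈ x-y₀∈A d∈A))
          (λ x x′ y _ _ _ ρ ρ′ → ∈-resp (DV.difference-cancelʳ x x′ y) (A.difference-∈ ρ ρ′)))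
        (relation-bound group group (λ y x → (λ i → x i - y i) ∈? A) (supported S) (A ∩ supported S) B A
          (λ y y∈ → y , λ x x-y∈A → ∈-⊕⁺ y y∈ x-y∈A , x-y∈A)
          (λ y y′ x y∈ y′∈ _ ρ ρ′ → Subset.x∈p∩q⁺
            (∈-resp (DV.difference-cancelˡ y y′ x) (A.difference-∈ ρ′ ρ) , S.difference-∈ y∈ y′∈))))
        (cong (ℕ._* ∣ A ∣) (∣supported∣ S))

      -- Orthogonality to the unit vectors at the positions in S forces the entries there to vanish,
      -- and vectors with disjoint supports are orthogonal.
      dual-sum : dual B ≡ dual A ∩ supported (∁ S)
      dual-sum = Subset.⊆-antisym
        (⊆⁺ λ {u} u∈ → Subset.x∈p∩q⁺
          ( ∈-dual⁺ (λ v v∈A → ∈-dual⁻ u∈ v (⊆-⊕ˡ (supported-isSubmodule S) v∈A))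
          , ∈-supported⁺ (λ i i∉∁S → ≈-trans (≈-sym (⟨basis,⟩ i u)) (∈-dual⁻ u∈ (basis i)
              (⊆-⊕ʳ A-sub (∈-supported⁺ λ j j∉S → basis-off j i (λ { refl → j∉S (Subset.x∉∁p⇒x∈p i∉∁S) })))))))
        (⊆⁺ λ {u} u∈ →
          let u∈A⊥ , u∈S = Subset.x∈p∩q⁻ (dual A) _ u∈
          in ∈-dual⁺ λ v v∈B →
            let x , x∈S , v-x∈A = ∈-⊕⁻ v∈B
            in ≈-trans (⟨⟩-cong (λ i → ≈-sym (DV.difference-cancel v x i)) (λ _ → ≈-refl))
               (≈-trans (⟨⟩-+ˡ (λ i → v i - x i) x u)
               (≈-trans (+-cong (∈-dual⁻ u∈A⊥ _ v-x∈A) (disjoint x u (∈-supported⁻ x∈S) (∈-supported⁻ u∈S)))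
                 (+-identityˡ 0#))))
        where
        basis-off : ∀ (j i : Fin n) → j ≢ i → basis i j ≈ 0#
        basis-off j i j≢i = reflexive (cong (1# R-Sums.when_) (dec-false (j Fin.≟ i) j≢i))
        disjoint : ∀ x u → (∀ i → i Subset.∉ S → x i ≈ 0#) → (∀ i → i Subset.∉ ∁ S → u i ≈ 0#) → ⟨ x , u ⟩ ≈ 0#
        disjoint x u hx hu = ≈-trans (reflexive (⟨⟩≡sum x u)) (R-Sums.sum-ε vanish)
          where
          vanish : ∀ i → x i * u i ≈ 0#
          vanish i with i Subset.∈? S
          ... | yes i∈S = ≈-trans (*-congˡ (hu i (Subset.x∈p⇒x∉∁p i∈S))) (zeroʳ _)
          ... | no  i∉S = ≈-trans (*-congʳ (hx i i∉S)) (zeroˡ _)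

  q-nonZero : ℕ.NonZero q
  q-nonZero = Fin.nonZeroIndex (Inverse.to enum 0#)

  -- `dual-size` is applied to the sum of A and the vectors supported in S, whose dual is the
  -- shortened dual code. Splitting q^n as q^|S| times the power for the complement lets q^|S|
  -- cancel.
  shortening : ∀ {A} → IsSubmodule A → ∀ S →
    ∣ dual A ∩ supported (∁ S) ∣ ℕ.* ∣ A ∣ ≡ q ℕ.^ ∣ ∁ S ∣ ℕ.* ∣ A ∩ supported S ∣
  shortening {A} A-sub S = ℕ.*-cancelˡ-≡ _ _ (q ℕ.^ ∣ S ∣) {{ℕ.m^n≢0 q (∣ S ∣) {{q-nonZero}}}} (begin
    q ℕ.^ ∣ S ∣ ℕ.* (∣ dual A ∩ supported (∁ S) ∣ ℕ.* ∣ A ∣)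
      ≡⟨ cong (λ X → q ℕ.^ ∣ S ∣ ℕ.* (∣ X ∣ ℕ.* ∣ A ∣)) (dual-sum A-sub S) ⟨
    q ℕ.^ ∣ S ∣ ℕ.* (∣ dual B ∣ ℕ.* ∣ A ∣)
      ≡⟨ solve 3 (λ x y z → x :* (y :* z) := y :* (x :* z)) refl (q ℕ.^ ∣ S ∣) (∣ dual B ∣) (∣ A ∣) ⟩
    ∣ dual B ∣ ℕ.* (q ℕ.^ ∣ S ∣ ℕ.* ∣ A ∣)
      ≡⟨ cong (∣ dual B ∣ ℕ.*_) (sum-size A-sub S) ⟨
    ∣ dual B ∣ ℕ.* (∣ B ∣ ℕ.* ∣ A ∩ supported S ∣)
      ≡⟨ ℕ.*-assoc (∣ dual B ∣) (∣ B ∣) (∣ A ∩ supported S ∣) ⟨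
    ∣ dual B ∣ ℕ.* ∣ B ∣ ℕ.* ∣ A ∩ supported S ∣
      ≡⟨ cong (ℕ._* ∣ A ∩ supported S ∣) (dual-size (⊕-isSubmodule A-sub (supported-isSubmodule S))) ⟩
    q ℕ.^ n ℕ.* ∣ A ∩ supported S ∣
      ≡⟨ cong (λ m → q ℕ.^ m ℕ.* ∣ A ∩ supported S ∣) (size-∁ S) ⟨
    q ℕ.^ (∣ S ∣ ℕ.+ ∣ ∁ S ∣) ℕ.* ∣ A ∩ supported S ∣
      ≡⟨ cong (ℕ._* ∣ A ∩ supported S ∣) (ℕ.^-distribˡ-+-* q (∣ S ∣) (∣ ∁ S ∣)) ⟩
    q ℕ.^ ∣ S ∣ ℕ.* q ℕ.^ ∣ ∁ S ∣ ℕ.* ∣ A ∩ supported S ∣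
      ≡⟨ ℕ.*-assoc (q ℕ.^ ∣ S ∣) (q ℕ.^ ∣ ∁ S ∣) (∣ A ∩ supported S ∣) ⟩
    q ℕ.^ ∣ S ∣ ℕ.* (q ℕ.^ ∣ ∁ S ∣ ℕ.* ∣ A ∩ supported S ∣) ∎)
    where
    open ≡.≡-Reasoning
    open +-*-Solver
    B = A ⊕ supported S
    size-∁ : ∀ {n} (S : Subset n) → ∣ S ∣ ℕ.+ ∣ ∁ S ∣ ≡ n
    size-∁ S = ≡.trans (cong (∣ S ∣ ℕ.+_) (Subset.∣∁p∣≡n∸∣p∣ S)) (ℕ.m+[n∸m]≡n (Subset.∣p∣≤n S))

  count-∩ : ∀ A S → ∣ A ∩ supported S ∣ ≡
    sumℕ (λ k → (1 whenℕ does (support (from k) Subset.⊆? S)) whenℕ does (k Subset.∈? A))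
  count-∩ A S = ≡.trans (∣-∣≡sum (A ∩ supported S)) (ℕ-Sums.sum-cong λ k → indicator-∩ k
    (k Subset.∈? (A ∩ supported S)) (support (from k) Subset.⊆? S) (k Subset.∈? A))
    where
    indicator-∩ : ∀ k (x : Dec (k Subset.∈ A ∩ supported S)) (y : Dec (support (from k) Subset.⊆ S))
      (z : Dec (k Subset.∈ A)) → (1 whenℕ does x) ≡ ((1 whenℕ does y) whenℕ does z)
    indicator-∩ k (yes x) (yes y) (yes z) = refl
    indicator-∩ k (no ¬x) (no ¬y) (yes z) = refl
    indicator-∩ k (no ¬x) _       (no ¬z) = refl
    indicator-∩ k (yes x) _       (no ¬z) = contradiction (proj₁ (Subset.x∈p∩q⁻ A _ x)) ¬z
    indicator-∩ k (yes x) (no ¬y) (yes z) = ⊥-elim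
      (¬y (∈-comprehension⁻ (∈-supported S) {from k} (∈-from (proj₂ (Subset.x∈p∩q⁻ A _ x)))))
    indicator-∩ k (no ¬x) (yes y) (yes z) = contradiction
      (Subset.x∈p∩q⁺ (z , ∈-from⁻ (∈-comprehension⁺ (∈-supported S) {from k} y))) ¬x

open import Data.Fin.Permutation using (_⟨$⟩ˡ_; _∘ₚ_; flip; inverseˡ; inverseʳ)
  renaming (_≈_ to _≈ₚ_)

-- Orbits

lookup-injective : ∀ {a ℓ} {A : Set a} {_~_ : A → A → Set ℓ} → (∀ {x y} → x ~ y → y ~ x) →
  ∀ {xs : List A} → AllPairs (λ x y → ¬ (x ~ y)) xs → ∀ {k l} → List.lookup xs k ~ List.lookup xs l → k ≡ l
lookup-injective sym (x≁ ∷ distinct) {Fin.zero}  {Fin.zero}  x~y = refl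
lookup-injective sym {x ∷ xs} (x≁ ∷ distinct) {Fin.zero}  {Fin.suc l} x~y = contradiction x~y (All.lookup x≁ (∈-lookup {xs = xs} l))
lookup-injective sym {x ∷ xs} (x≁ ∷ distinct) {Fin.suc k} {Fin.zero}  x~y = contradiction (sym x~y) (All.lookup x≁ (∈-lookup {xs = xs} k))
lookup-injective sym (x≁ ∷ distinct) {Fin.suc k} {Fin.suc l} x~y = cong Fin.suc (lookup-injective sym distinct x~y)

module GroupElements {n} (H : PermutationGroup n) where
  open PermutationGroup H

  element : Fin order → Permutation′ n
  element = List.lookup elements

  element-∈ : ∀ k → element k ∈ᴳ
  element-∈ k = go elements k
    where
    go : ∀ xs k → Any (List.lookup xs k ≈ₚ_) xs
    go (x ∷ xs) Fin.zero    = here (λ _ → refl)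
    go (x ∷ xs) (Fin.suc k) = there (go xs k)

  index : ∀ {π} → π ∈ᴳ → Fin order
  index = Any.index

  element-index : ∀ {π} (π∈ : π ∈ᴳ) → π ≈ₚ element (index {π} π∈)
  element-index π∈ = Any.lookup-index π∈

  element-injective : ∀ {k l} → element k ≈ₚ element l → k ≡ l
  element-injective = lookup-injective {_~_ = _≈ₚ_} (λ {π} {ρ} (π≈ρ : π ≈ₚ ρ) i → ≡.sym (π≈ρ i)) {elements} distinct

  ∈⇒InOrbit : ∀ {π} → π ∈ᴳ → ∀ i → InOrbit i (π ⟨$⟩ʳ i)
  ∈⇒InOrbit π∈ i = Any.map (λ π≈ρ → ≡.sym (π≈ρ i)) π∈

  InOrbit⇒∈ : ∀ {i j} → InOrbit i j → ∃ λ π → π ∈ᴳ × π ⟨$⟩ʳ i ≡ j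
  InOrbit⇒∈ i↝j = element (Any.index i↝j) , element-∈ (Any.index i↝j) , Any.lookup-index i↝j

  InOrbit-sym : ∀ {i j} → InOrbit i j → InOrbit j i
  InOrbit-sym i↝j with InOrbit⇒∈ i↝j
  ... | π , π∈ , refl = subst (InOrbit _) (inverseˡ π) (∈⇒InOrbit {flip π} (inv-∈ {π} π∈) _)

  InOrbit-trans : ∀ {i j k} → InOrbit i j → InOrbit j k → InOrbit i k
  InOrbit-trans i↝j j↝k with InOrbit⇒∈ i↝j | InOrbit⇒∈ j↝k
  ... | π , π∈ , refl | ρ , ρ∈ , refl = ∈⇒InOrbit {π ∘ₚ ρ} (∘-∈ {π} {ρ} π∈ ρ∈) _

  module _ {c ℓ} (M : CommutativeMonoid c ℓ) where
    open CommutativeMonoid M renaming (refl to ≈-refl; sym to ≈-sym; trans to ≈-trans)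
    open Sums M

    sum-translate : ∀ {ρ} → ρ ∈ᴳ → (g : Permutation′ n → Carrier) → (∀ {π σ} → π ≈ₚ σ → g π ≈ g σ) →
      sum (λ k → g (element k ∘ₚ ρ)) ≈ sum (λ k → g (element k))
    sum-translate {ρ} ρ∈ g g-cong = sum-bijection {P = λ _ → ⊤} {Q = λ _ → ⊤} (λ _ → yes tt) (λ _ → yes tt)
      {g = λ k → g (element k ∘ₚ ρ)} {h = λ k → g (element k)} right left (λ _ → tt) (λ _ → tt)
      (λ {k} _ → element-injective λ i → ≡.trans (≡.sym (element-index {element (right k) ∘ₚ flip ρ} (left∈ (right k)) i))
        (≡.trans (cong (ρ ⟨$⟩ˡ_) (≡.sym (element-index {element k ∘ₚ ρ} (right∈ k) i))) (inverseˡ ρ)))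
      (λ {k} _ → element-injective λ i → ≡.trans (≡.sym (element-index {element (left k) ∘ₚ ρ} (right∈ (left k)) i))
        (≡.trans (cong (ρ ⟨$⟩ʳ_) (≡.sym (element-index {element k ∘ₚ flip ρ} (left∈ k) i))) (inverseʳ ρ)))
      (λ {k} _ → g-cong {element k ∘ₚ ρ} (element-index {element k ∘ₚ ρ} (right∈ k)))
      where
      right∈ : ∀ k → (element k ∘ₚ ρ) ∈ᴳ
      right∈ k = ∘-∈ {element k} {ρ} (element-∈ k) ρ∈
      left∈ : ∀ k → (element k ∘ₚ flip ρ) ∈ᴳ
      left∈ k = ∘-∈ {element k} {flip ρ} (element-∈ k) (inv-∈ {ρ} ρ∈)
      right left : Fin order → Fin order
      right k = index {element k ∘ₚ ρ} (right∈ k)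
      left  k = index {element k ∘ₚ flip ρ} (left∈ k)

    foldr≈sum : ∀ {A : Set} (xs : List A) (g : A → Carrier) →
      foldr _∙_ ε (map g xs) ≈ sum (λ k → g (List.lookup xs k))
    foldr≈sum []       g = ≈-sym (sum-zero _)
    foldr≈sum (x ∷ xs) g = ≈-trans (∙-congˡ (foldr≈sum xs g)) (≈-sym (sum-suc _))

  stabilizerSize : Fin n → ℕ
  stabilizerSize i = sumℕ (λ k → 1 whenℕ does (element k ⟨$⟩ʳ i Fin.≟ i))

  -- Count the group elements by the image of i. For j in the orbit, translation by an element that
  -- carries i to j matches the elements sending i to j with the stabilizer.
  order≡ : ∀ i → order ≡ orbitSize i ℕ.* stabilizerSize i
  order≡ i = begin
    order
      ≡⟨ ≡.sym (≡.trans (≡.sym (∣-∣≡sum (Subset.⊤ {order}))) (Subset.∣⊤∣≡n order)) ⟩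
    sumℕ (λ k → 1 whenℕ does (k Subset.∈? Subset.⊤))
      ≡⟨ ℕ-Sums.sum-cong (λ k → ≡.trans (cong (1 whenℕ_) (dec-true (k Subset.∈? Subset.⊤) Subset.∈⊤))
           (≡.sym (ℕ-Sums.sum-single (λ _ → 1) (element k ⟨$⟩ʳ i)))) ⟩
    sumℕ (λ k → sumℕ (λ j → 1 whenℕ does (j Fin.≟ element k ⟨$⟩ʳ i)))
      ≡⟨ ℕ-Sums.sum-comm _ ⟩
    sumℕ (λ j → sumℕ (λ k → 1 whenℕ does (j Fin.≟ element k ⟨$⟩ʳ i)))
      ≡⟨ ℕ-Sums.sum-cong (λ j → fibre j (InOrbit? i j)) ⟩
    sumℕ (λ j → stabilizerSize i whenℕ does (InOrbit? i j))
      ≡⟨ sum-when-const (λ j → does (InOrbit? i j)) _ ⟩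
    sumℕ (λ j → 1 whenℕ does (InOrbit? i j)) ℕ.* stabilizerSize i
      ≡⟨ cong (ℕ._* stabilizerSize i) (∣tabulate∣≡sum (λ j → does (InOrbit? i j))) ⟨
    orbitSize i ℕ.* stabilizerSize i ∎
    where
    open ≡.≡-Reasoning
    fibre : ∀ j (i↝j? : Dec (InOrbit i j)) →
      sumℕ (λ k → 1 whenℕ does (j Fin.≟ element k ⟨$⟩ʳ i)) ≡ (stabilizerSize i whenℕ does i↝j?)
    fibre j (no ¬i↝j) = ℕ-Sums.sum-ε (λ k → cong (1 whenℕ_) (dec-false (j Fin.≟ element k ⟨$⟩ʳ i)
      λ j≡ → ¬i↝j (subst (InOrbit i) (≡.sym j≡) (∈⇒InOrbit {element k} (element-∈ k) i))))
    fibre j (yes i↝j) with InOrbit⇒∈ i↝j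
    ... | ρ , ρ∈ , refl = ≡.trans
      (≡.sym (sum-translate ℕ.+-0-commutativeMonoid {ρ} ρ∈ (λ π → 1 whenℕ does (ρ ⟨$⟩ʳ i Fin.≟ π ⟨$⟩ʳ i))
        (λ {π} {σ} π≈σ → cong (λ l → 1 whenℕ does (ρ ⟨$⟩ʳ i Fin.≟ l)) (π≈σ i))))
      (ℕ-Sums.sum-cong λ k → ℕ-Sums.when-cong (ρ ⟨$⟩ʳ i Fin.≟ ρ ⟨$⟩ʳ (element k ⟨$⟩ʳ i)) (element k ⟨$⟩ʳ i Fin.≟ i)
        (λ eq → ≡.trans (≡.sym (inverseˡ ρ)) (≡.trans (cong (ρ ⟨$⟩ˡ_) (≡.sym eq)) (inverseˡ ρ)))
        (λ eq → cong (ρ ⟨$⟩ʳ_) (≡.sym eq)) (λ _ → refl))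

  orbitSize-cong : ∀ {i j} → InOrbit i j → orbitSize i ≡ orbitSize j
  orbitSize-cong {i} {j} i↝j = cong ∣_∣ (Vec.tabulate-cong λ k → agree (InOrbit? i k) (InOrbit? j k))
    where
    agree : ∀ {k} (x : Dec (InOrbit i k)) (y : Dec (InOrbit j k)) → does x ≡ does y
    agree (yes p) (yes q) = refl
    agree (yes p) (no ¬q) = contradiction (InOrbit-trans (InOrbit-sym i↝j) p) ¬q
    agree (no ¬p) (yes q) = contradiction (InOrbit-trans i↝j q) ¬p
    agree (no ¬p) (no ¬q) = refl

module OrbitReduction {c ℓ p} (R : Ring c ℓ) {q} (enum : Enumeration R q)
    {n} (G H : PermutationGroup n) (H≤G : ∀ π → PermutationGroup._∈ᴳ H π → PermutationGroup._∈ᴳ G π) {t} (orbits : Orbits H t)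
    (∣H∣⁻¹ : Coding.OrderInvertible R enum H)
    (C : Coding.DecSubset R enum n p) (isCode : Coding.IsLeftGCode R enum G C) where
  open Ring R renaming (refl to ≈-refl; sym to ≈-sym; trans to ≈-trans)
  open Vectors R enum
  open Average H ∣H∣⁻¹
  open HasInverse ∣H∣⁻¹ using (inverse) renaming (inverseˡ to inverse-order-1; inverseʳ to order-inverse-1)
  open RawMonoidDefs +-rawMonoid using () renaming (sum to rawSum)
  open Orbits orbits
  open PermutationGroup H
  open GroupElements H
  open DecSubset
  open IsLeftGCode isCode
  open SemiringMult semiring using (×-assoc-*; ×-comm-*; ×-congʳ; ×1-homo-*) renaming (_×_ to _·_)
  open SetoidReasoning setoid

  private
    module Vₜ = FiniteAbelianGroup (Subcodes.group t)

  ι : Fin n → Fin t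
  ι j = proj₁ (covering j)

  ι-orbit : ∀ j → InOrbit (α (ι j)) j
  ι-orbit j = proj₂ (covering j)

  ι-unique : ∀ {i j} → InOrbit (α i) j → i ≡ ι j
  ι-unique {j = j} αi↝j = separated (InOrbit-trans αi↝j (InOrbit-sym (ι-orbit j)))

  ι-α : ∀ i → ι (α i) ≡ i
  ι-α i = separated (ι-orbit (α i))

  ι-cong : ∀ {j k} → InOrbit j k → ι j ≡ ι k
  ι-cong {j} j↝k = ι-unique (InOrbit-trans (ι-orbit j) j↝k)

  extend : V t → V n
  extend u j = u (ι j)

  restrict : V n → V t
  restrict v i = v (α i)

  -- Constancy on orbits, tested against the chosen representatives. These are exactly the vectors
  -- of Vθ, by `θ-invariant` and `invariant⇒θ`.
  Invariant : V n → Set ℓ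
  Invariant v = ∀ j → v j ≈ v (α (ι j))

  restrict-extend : ∀ u → restrict (extend u) ≋ u
  restrict-extend u i = reflexive (cong u (ι-α i))

  extend-invariant : ∀ u → Invariant (extend u)
  extend-invariant u j = reflexive (cong u (≡.sym (ι-α (ι j))))

  invariant-resp : Invariant Respects _≋_
  invariant-resp u≋v inv j = ≈-trans (≈-sym (u≋v j)) (≈-trans (inv j) (u≋v _))

  invariant-orbit : ∀ {v} → Invariant v → ∀ {j k} → InOrbit j k → v j ≈ v k
  invariant-orbit {v} inv {j} {k} j↝k =
    ≈-trans (inv j) (≈-trans (reflexive (cong (v ∘ α) (ι-cong j↝k))) (≈-sym (inv k)))

  inOrbit-ˡ : ∀ {π} → π ∈ᴳ → ∀ j → InOrbit (π ⟨$⟩ˡ j) j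
  inOrbit-ˡ {π} π∈ j = subst (InOrbit (π ⟨$⟩ˡ j)) (inverseʳ π) (∈⇒InOrbit {π} π∈ _)

  ·1* : ∀ k x → k · 1# * x ≈ k · x
  ·1* k x = ≈-trans (×-assoc-* k 1# x) (×-congʳ k (*-identityˡ x))

  *·1 : ∀ k x → x * k · 1# ≈ k · x
  *·1 k x = ≈-trans (×-comm-* k x 1#) (×-congʳ k (*-identityʳ x))

  -- A multiple of 1 is central, and so is its inverse. R need not be commutative, and averaging a
  -- vector of the right dual requires moving 1/|H| past entries of C.
  inverse-central : ∀ r → inverse * r ≈ r * inverse
  inverse-central r = begin
    inverse * r                              ≈⟨ *-identityʳ _ ⟨
    inverse * r * 1#                         ≈⟨ *-congˡ order-inverse-1 ⟨
    inverse * r * (order · 1# * inverse)     ≈⟨ *-assoc _ _ _ ⟨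
    inverse * r * order · 1# * inverse       ≈⟨ *-congʳ (*-assoc _ _ _) ⟩
    inverse * (r * order · 1#) * inverse     ≈⟨ *-congʳ (*-congˡ (≈-trans (*·1 order r) (≈-sym (·1* order r)))) ⟩
    inverse * (order · 1# * r) * inverse     ≈⟨ *-congʳ (*-assoc _ _ _) ⟨
    inverse * order · 1# * r * inverse       ≈⟨ *-congʳ (*-congʳ inverse-order-1) ⟩
    1# * r * inverse                         ≈⟨ *-congʳ (*-identityˡ r) ⟩
    r * inverse                              ∎

  θ≈sum : ∀ v i → θ v i ≈ inverse * sum (λ k → v (element k ⟨$⟩ˡ i))
  θ≈sum v i = *-congˡ (foldr≈sum +-commutativeMonoid elements (λ π → (v ∙ π) i))

  ˡ-cong : ∀ {π ρ : Permutation′ n} → π ≈ₚ ρ → ∀ j → π ⟨$⟩ˡ j ≡ ρ ⟨$⟩ˡ j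
  ˡ-cong {π} {ρ} π≈ρ j = ≡.trans (≡.sym (inverseˡ ρ))
    (cong (ρ ⟨$⟩ˡ_) (≡.trans (≡.sym (π≈ρ (π ⟨$⟩ˡ j))) (inverseʳ π)))

  θ-invariant : ∀ v → Invariant (θ v)
  θ-invariant v j with InOrbit⇒∈ (ι-orbit j)
  ... | ρ , ρ∈ , ρα≡j = begin
    θ v j
      ≈⟨ θ≈sum v j ⟩
    inverse * sum (λ k → v (element k ⟨$⟩ˡ j))
      ≈⟨ *-congˡ (R-Sums.sum-cong λ k → reflexive (cong (λ l → v (element k ⟨$⟩ˡ l)) (≡.sym ρα≡j))) ⟩
    inverse * sum (λ k → v (element k ⟨$⟩ˡ (ρ ⟨$⟩ʳ α (ι j))))
      ≈⟨ *-congˡ (sum-translate +-commutativeMonoid {flip ρ} (inv-∈ {ρ} ρ∈) (λ π → v (π ⟨$⟩ˡ α (ι j)))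
           (λ {π} {σ} π≈σ → reflexive (cong v (ˡ-cong {π} {σ} π≈σ (α (ι j)))))) ⟩
    inverse * sum (λ k → v (element k ⟨$⟩ˡ α (ι j)))
      ≈⟨ θ≈sum v (α (ι j)) ⟨
    θ v (α (ι j)) ∎

  sum-const : ∀ k x → sum {k} (λ _ → x) ≈ k · x
  sum-const zero    x = R-Sums.sum-zero _
  sum-const (suc k) x = ≈-trans (R-Sums.sum-suc _) (+-congˡ (sum-const k x))

  inverse-order : ∀ x → inverse * (order · x) ≈ x
  inverse-order x = begin
    inverse * (order · x)      ≈⟨ *-congˡ (·1* order x) ⟨
    inverse * (order · 1# * x) ≈⟨ *-assoc _ _ _ ⟨
    inverse * order · 1# * x   ≈⟨ *-congʳ inverse-order-1 ⟩
    1# * x                     ≈⟨ *-identityˡ x ⟩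
    x                          ∎

  invariant⇒θ : ∀ {v} → Invariant v → v ≋ θ v
  invariant⇒θ {v} inv j = ≈-sym (begin
    θ v j                                       ≈⟨ θ≈sum v j ⟩
    inverse * sum (λ k → v (element k ⟨$⟩ˡ j))
      ≈⟨ *-congˡ (R-Sums.sum-cong λ k → invariant-orbit inv (inOrbit-ˡ {element k} (element-∈ k) j)) ⟩
    inverse * sum {order} (λ _ → v j)           ≈⟨ *-congˡ (sum-const order (v j)) ⟩
    inverse * (order · v j)                     ≈⟨ inverse-order (v j) ⟩
    v j                                         ∎)

  ⟨⟩-permute : ∀ (u v : V n) π → ⟨ u ∙ π , v ⟩ ≈ ⟨ u , (λ i → v (π ⟨$⟩ʳ i)) ⟩
  ⟨⟩-permute u v π = begin
    ⟨ u ∙ π , v ⟩                                       ≡⟨ ⟨⟩≡sum (u ∙ π) v ⟩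
    sum (λ i → u (π ⟨$⟩ˡ i) * v i)                       ≈⟨ R-Sums.sum-permute _ π ⟩
    sum (λ i → u (π ⟨$⟩ˡ (π ⟨$⟩ʳ i)) * v (π ⟨$⟩ʳ i))
      ≈⟨ R-Sums.sum-cong (λ i → *-congʳ (reflexive (cong u (inverseˡ π)))) ⟩
    sum (λ i → u i * v (π ⟨$⟩ʳ i))                       ≡⟨ ⟨⟩≡sum u _ ⟨
    ⟨ u , (λ i → v (π ⟨$⟩ʳ i)) ⟩                         ∎

  -- Moving a permutation from u to w has no effect on an invariant w, so all |H| summands equal
  -- (u,w).
  ⟨θ,⟩ : ∀ u {w} → Invariant w → ⟨ θ u , w ⟩ ≈ ⟨ u , w ⟩
  ⟨θ,⟩ u {w} inv = begin
    ⟨ θ u , w ⟩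
      ≡⟨ ⟨⟩≡sum (θ u) w ⟩
    sum (λ i → θ u i * w i)
      ≈⟨ R-Sums.sum-cong (λ i → ≈-trans (*-congʳ (θ≈sum u i)) (≈-trans (*-assoc _ _ _) (*-congˡ (*-distribʳ-sum (w i) _)))) ⟩
    sum (λ i → inverse * sum (λ k → u (element k ⟨$⟩ˡ i) * w i))
      ≈⟨ *-distribˡ-sum inverse _ ⟨
    inverse * sum (λ i → sum (λ k → u (element k ⟨$⟩ˡ i) * w i))
      ≈⟨ *-congˡ (R-Sums.sum-comm _) ⟩
    inverse * sum (λ k → sum (λ i → u (element k ⟨$⟩ˡ i) * w i))
      ≈⟨ *-congˡ (R-Sums.sum-cong λ k → ≈-trans (reflexive (≡.sym (⟨⟩≡sum (u ∙ element k) w)))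
           (≈-trans (⟨⟩-permute u w (element k))
             (⟨⟩-cong (λ _ → ≈-refl) (λ i → ≈-sym (invariant-orbit inv (∈⇒InOrbit {element k} (element-∈ k) i)))))) ⟩
    inverse * sum {order} (λ _ → ⟨ u , w ⟩)
      ≈⟨ *-congˡ (sum-const order _) ⟩
    inverse * (order · ⟨ u , w ⟩)
      ≈⟨ inverse-order _ ⟩
    ⟨ u , w ⟩ ∎

  orbit-sum-∈ : ∀ {u} → mem C u → ∀ πs → All _∈ᴳ πs → mem C (λ i → foldr _+_ 0# (map (λ π → (u ∙ π) i) πs))
  orbit-sum-∈ u∈ []       []         = 0-∈
  orbit-sum-∈ u∈ (π ∷ πs) (π∈ ∷ πs∈) = +-∈ (∙-∈ {π = π} (H≤G π π∈) u∈) (orbit-sum-∈ u∈ πs πs∈)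

  elements-∈ : All _∈ᴳ elements
  elements-∈ = All.tabulate (λ π∈ → Any.map (λ { refl _ → refl }) π∈)

  -- C is an H-stable left submodule, so θ maps it into itself; Cθ is therefore the set of invariant
  -- vectors in C.
  θ-∈C : ∀ {u} → mem C u → mem C (θ u)
  θ-∈C u∈ = *-∈ inverse (orbit-sum-∈ u∈ elements elements-∈)

  ∈Cθ⇒ : ∀ {v} → mem (C ⟨θ⟩) v → mem C v × Invariant v
  ∈Cθ⇒ (u , u∈ , v≋θu) = resp C (λ i → ≈-sym (v≋θu i)) (θ-∈C u∈)
    , invariant-resp (λ i → ≈-sym (v≋θu i)) (θ-invariant u)

  ∈Cθ⇐ : ∀ {v} → mem C v → Invariant v → mem (C ⟨θ⟩) v
  ∈Cθ⇐ {v} v∈ inv = v , v∈ , invariant⇒θ inv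

  ∈Vθ⇒ : ∀ {v} → mem Vθ v → Invariant v
  ∈Vθ⇒ (u , _ , v≋θu) = invariant-resp (λ i → ≈-sym (v≋θu i)) (θ-invariant u)

  private
    ∈-A : Vₜ.Property p
    ∈-A = record
      { holds = λ u → mem C (extend u) ; holds? = λ u → mem? C (extend u)
      ; resp = λ u≋v → resp C (λ j → u≋v (ι j)) }

  A : Subset (q ℕ.^ t)
  A = Vₜ.comprehension ∈-A

  ∈A⁺ : ∀ {u} → mem C (extend u) → u Vₜ.∈ A
  ∈A⁺ {u} = Vₜ.∈-comprehension⁺ ∈-A {u}

  ∈A⁻ : ∀ {u} → u Vₜ.∈ A → mem C (extend u)
  ∈A⁻ {u} = Vₜ.∈-comprehension⁻ ∈-A {u}

  A-isSubmodule : Subcodes.IsSubmodule t A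
  A-isSubmodule = record
    { 0-∈ = ∈A⁺ 0-∈
    ; +-∈ = λ u∈ v∈ → ∈A⁺ (+-∈ (∈A⁻ u∈) (∈A⁻ v∈))
    ; neg-∈ = λ {u} u∈ → ∈A⁺ (resp C (λ j → RingProperties.-1*x≈-x R (u (ι j))) (*-∈ (- 1#) (∈A⁻ u∈)))
    ; *-∈ = λ {s} _ u∈ → ∈A⁺ (*-∈ s (∈A⁻ u∈))
    }

  ∈Cθ⇒∈A : ∀ {v} → mem (C ⟨θ⟩) v → restrict v Vₜ.∈ A
  ∈Cθ⇒∈A {v} v∈ = let v∈C , inv = ∈Cθ⇒ v∈ in ∈A⁺ (resp C inv v∈C)

  ∈A⇒∈Cθ : ∀ {u} → u Vₜ.∈ A → mem (C ⟨θ⟩) (extend u)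
  ∈A⇒∈Cθ {u} u∈ = ∈Cθ⇐ (∈A⁻ u∈) (extend-invariant u)

  size : Fin t → ℕ
  size i = orbitSize (α i)

  -- Both vectors are constant on orbits, so each orbit contributes one product as often as it has
  -- elements. These multiplicities are what M_H compensates for.
  ⟨extend,⟩ : ∀ (u : V t) {w} → Invariant w → ⟨ extend u , w ⟩ ≈ sum (λ i → size i · (u i * w (α i)))
  ⟨extend,⟩ u {w} inv = begin
    ⟨ extend u , w ⟩
      ≡⟨ ⟨⟩≡sum (extend u) w ⟩
    sum (λ j → u (ι j) * w j)
      ≈⟨ R-Sums.sum-cong (λ j → ≈-trans (*-congˡ (inv j)) (≈-sym (R-Sums.sum-single (λ i → u i * w (α i)) (ι j)))) ⟩
    sum (λ j → sum (λ i → (u i * w (α i)) when does (i Fin.≟ ι j)))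
      ≈⟨ R-Sums.sum-comm _ ⟩
    sum (λ i → sum (λ j → (u i * w (α i)) when does (i Fin.≟ ι j)))
      ≈⟨ R-Sums.sum-cong (λ i → ≈-trans (R-Sums.sum-cong λ j → R-Sums.when-cong (i Fin.≟ ι j) (InOrbit? (α i) j)
           (λ { refl → ι-orbit j }) ι-unique (λ _ → ≈-refl))
           (≈-trans (≈-sym (sum-when-· +-commutativeMonoid (λ j → does (InOrbit? (α i) j)) (u i * w (α i))))
             (reflexive (cong (_· (u i * w (α i))) (≡.sym (∣tabulate∣≡sum (λ j → does (InOrbit? (α i) j)))))))) ⟩
    sum (λ i → size i · (u i * w (α i))) ∎
    where open R-Sums using (_when_)

  -- The stabilizer order over |H|, which inverts the orbit length by the orbit-stabilizer relation
  -- `order≡`.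
  size⁻¹ : Fin t → Carrier
  size⁻¹ i = inverse * stabilizerSize (α i) · 1#

  size⁻¹-inverse : ∀ i → size⁻¹ i * size i · 1# ≈ 1#
  size⁻¹-inverse i = begin
    inverse * stabilizerSize (α i) · 1# * size i · 1#    ≈⟨ *-assoc _ _ _ ⟩
    inverse * (stabilizerSize (α i) · 1# * size i · 1#)  ≈⟨ *-congˡ (×1-homo-* (stabilizerSize (α i)) (size i)) ⟨
    inverse * (stabilizerSize (α i) ℕ.* size i) · 1#
      ≡⟨ cong (λ k → inverse * k · 1#) (≡.trans (ℕ.*-comm (stabilizerSize (α i)) (size i)) (≡.sym (order≡ (α i)))) ⟩
    inverse * order · 1#                                 ≈⟨ inverse-order-1 ⟩
    1#                                                   ∎

  orbitLengthMatrix≈ : ∀ i j → orbitLengthMatrix H i j ≈ R-Sums._when_ (orbitSize j · 1#) (does (i Fin.≟ j))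
  orbitLengthMatrix≈ i j with i Fin.≟ j
  ... | yes _ = ≈-refl
  ... | no  _ = ≈-refl

  ·M≈ : ∀ (v : V n) j → rawSum (λ i → v i * orbitLengthMatrix H i j) ≈ v j * orbitSize j · 1#
  ·M≈ v j = ≈-trans (reflexive (≡.sym (R-Sums.sum≡ _))) (≈-trans
    (R-Sums.sum-cong {g = λ i → R-Sums._when_ (v i * orbitSize j · 1#) (does (i Fin.≟ j))}
      (λ i → ≈-trans (*-congˡ (orbitLengthMatrix≈ i j)) (pull (does (i Fin.≟ j)) (v i))))
    (R-Sums.sum-single (λ i → v i * orbitSize j · 1#) j))
    where
    pull : ∀ b x → x * R-Sums._when_ (orbitSize j · 1#) b ≈ R-Sums._when_ (x * orbitSize j · 1#) b
    pull true  x = ≈-refl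
    pull false x = zeroʳ x

  -- With 1/|H| moved to the left, (v, θu) is an average of the products (vπ⁻¹, u), which vanish
  -- because C is stable under H.
  θ-∈C⊥ : ∀ {u} → mem (C ^⊥) u → mem (C ^⊥) (θ u)
  θ-∈C⊥ {u} u∈ v v∈ = begin
    ⟨ v , θ u ⟩
      ≡⟨ ⟨⟩≡sum v (θ u) ⟩
    sum (λ i → v i * θ u i)
      ≈⟨ R-Sums.sum-cong (λ i → begin
           v i * θ u i                                        ≈⟨ *-congˡ (θ≈sum u i) ⟩
           v i * (inverse * sum (λ k → u (element k ⟨$⟩ˡ i)))    ≈⟨ *-assoc _ _ _ ⟨
           v i * inverse * sum (λ k → u (element k ⟨$⟩ˡ i))      ≈⟨ *-congʳ (inverse-central (v i)) ⟨
           inverse * v i * sum (λ k → u (element k ⟨$⟩ˡ i))      ≈⟨ *-assoc _ _ _ ⟩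
           inverse * (v i * sum (λ k → u (element k ⟨$⟩ˡ i)))    ≈⟨ *-congˡ (*-distribˡ-sum (v i) _) ⟩
           inverse * sum (λ k → v i * u (element k ⟨$⟩ˡ i))      ∎) ⟩
    sum (λ i → inverse * sum (λ k → v i * u (element k ⟨$⟩ˡ i)))
      ≈⟨ *-distribˡ-sum inverse _ ⟨
    inverse * sum (λ i → sum (λ k → v i * u (element k ⟨$⟩ˡ i)))
      ≈⟨ *-congˡ (R-Sums.sum-comm _) ⟩
    inverse * sum (λ k → sum (λ i → v i * u (element k ⟨$⟩ˡ i)))
      ≈⟨ *-congˡ (R-Sums.sum-ε vanish) ⟩
    inverse * 0#
      ≈⟨ zeroʳ inverse ⟩
    0# ∎
    where
    vanish : ∀ k → sum (λ i → v i * u (element k ⟨$⟩ˡ i)) ≈ 0#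
    vanish k = ≈-trans (reflexive (≡.sym (⟨⟩≡sum v _)))
      (≈-trans (≈-sym (⟨⟩-permute v u (flip π))) (u∈ (v ∙ flip π) (∙-∈ {π = flip π} (H≤G (flip π) (inv-∈ {π} (element-∈ k))) v∈)))
      where π = element k

  -- Write v = wM with w invariant in the dual of C. The orbit lengths in v make the product over
  -- representatives equal to the full product of w with the extended word, which lies in C.
  ∈C⊥θM⇒ : ∀ {v} → mem (_·M H ((C ^⊥) ⟨θ⟩)) v → Invariant v × (∀ u → u Vₜ.∈ A → ⟨ u , restrict v ⟩ ≈ 0#)
  ∈C⊥θM⇒ {v} (w , (u , u∈ , w≋θu) , v≋wM) = v-invariant , orthogonal
    where
    v≈ : ∀ j → v j ≈ w j * orbitSize j · 1#
    v≈ j = ≈-trans (v≋wM j) (·M≈ w j)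
    w-invariant : Invariant w
    w-invariant = invariant-resp (λ i → ≈-sym (w≋θu i)) (θ-invariant u)
    w∈C⊥ : mem (C ^⊥) w
    w∈C⊥ = resp (C ^⊥) (λ i → ≈-sym (w≋θu i)) (θ-∈C⊥ u∈)
    v-invariant : Invariant v
    v-invariant j = begin
      v j                                   ≈⟨ v≈ j ⟩
      w j * orbitSize j · 1#
        ≈⟨ *-cong (w-invariant j) (reflexive (cong (_· 1#) (≡.sym (orbitSize-cong (ι-orbit j))))) ⟩
      w (α (ι j)) * orbitSize (α (ι j)) · 1#  ≈⟨ v≈ (α (ι j)) ⟨
      v (α (ι j))                           ∎
    orthogonal : ∀ u → u Vₜ.∈ A → ⟨ u , restrict v ⟩ ≈ 0#
    orthogonal x x∈A = begin
      ⟨ x , restrict v ⟩                            ≡⟨ ⟨⟩≡sum x (restrict v) ⟩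
      sum (λ i → x i * v (α i))
        ≈⟨ R-Sums.sum-cong (λ i → ≈-trans (*-congˡ (≈-trans (v≈ (α i)) (*·1 (size i) (w (α i))))) (×-comm-* (size i) (x i) (w (α i)))) ⟩
      sum (λ i → size i · (x i * w (α i)))          ≈⟨ ⟨extend,⟩ x w-invariant ⟨
      ⟨ extend x , w ⟩                              ≈⟨ w∈C⊥ (extend x) (∈A⁻ x∈A) ⟩
      0#                                            ∎

  -- The preimage w under M_H has its entries divided by the orbit lengths. To test w against v in
  -- C, v may be replaced by θ v because w is invariant, and θ v restricts to a word of `A`.
  ∈C⊥θM⇐ : ∀ {u} → (∀ x → x Vₜ.∈ A → ⟨ x , u ⟩ ≈ 0#) → mem (_·M H ((C ^⊥) ⟨θ⟩)) (extend u)
  ∈C⊥θM⇐ {u} u⊥A = w , (w , w∈C⊥ , invariant⇒θ w-invariant) , λ j → ≈-sym (≈-trans (·M≈ w j) (wM j))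
    where
    w : V n
    w = extend (λ i → u i * size⁻¹ i)
    w-invariant : Invariant w
    w-invariant = extend-invariant (λ i → u i * size⁻¹ i)
    unscale : ∀ i → u i * size⁻¹ i * size i · 1# ≈ u i
    unscale i = ≈-trans (*-assoc _ _ _) (≈-trans (*-congˡ (size⁻¹-inverse i)) (*-identityʳ _))
    wM : ∀ j → w j * orbitSize j · 1# ≈ extend u j
    wM j = ≈-trans (*-congˡ (reflexive (cong (_· 1#) (≡.sym (orbitSize-cong (ι-orbit j)))))) (unscale (ι j))
    w∈C⊥ : mem (C ^⊥) w
    w∈C⊥ v v∈ = begin
      ⟨ v , w ⟩                                     ≈⟨ ⟨θ,⟩ v w-invariant ⟨
      ⟨ θ v , w ⟩                                   ≈⟨ ⟨⟩-cong (θ-invariant v) (λ _ → ≈-refl) ⟩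
      ⟨ extend (restrict (θ v)) , w ⟩               ≈⟨ ⟨extend,⟩ (restrict (θ v)) w-invariant ⟩
      sum (λ i → size i · (θ v (α i) * w (α i)))
        ≈⟨ R-Sums.sum-cong (λ i → ≈-trans (≈-sym (×-comm-* (size i) _ _)) (*-congˡ (≈-trans
             (×-congʳ (size i) (reflexive (cong (λ l → u l * size⁻¹ l) (ι-α i))))
             (≈-trans (≈-sym (*·1 (size i) _)) (unscale i))))) ⟩
      sum (λ i → θ v (α i) * u i)                   ≡⟨ ⟨⟩≡sum (restrict (θ v)) u ⟨
      ⟨ restrict (θ v) , u ⟩                        ≈⟨ u⊥A (restrict (θ v)) (∈A⁺ (resp C (θ-invariant v) (θ-∈C v∈))) ⟩
      0#                                            ∎

  module _ {m ℓm} (M : CommutativeMonoid m ℓm) where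
    private module M = CommutativeMonoid M
    open Sums M using (_when_; sum-setoid-bijection) renaming (sum to sumM)

    sum-restrict : ∀ {a b} {P : Pred (V n) a} {Q : Pred (V t) b} (P? : Decidable P) (Q? : Decidable Q)
      {g : V n → M.Carrier} {h : V t → M.Carrier} →
      P Respects _≋_ → Q Respects _≋_ → (∀ {v} → P v → Invariant v) →
      (∀ {v} → P v → Q (restrict v)) → (∀ {u} → Q u → P (extend u)) →
      (∀ {u v} → u ≋ v → h u M.≈ h v) →
      (∀ v → g v M.≈ h (restrict v)) →
      sumM (λ k → g (vector {n} k) when does (P? (vector k))) M.≈ sumM (λ l → h (vector {t} l) when does (Q? (vector l)))
    sum-restrict P? Q? P-resp Q-resp P⇒invariant P⇒Q Q⇒P h-cong g≈h =
      sum-setoid-bijection (enumerationⱽ n) (enumerationⱽ t) P? Q? restrict extend P-resp Q-resp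
        (λ u≋v i → u≋v (α i)) (λ u≋v j → u≋v (ι j)) h-cong P⇒Q Q⇒P
        (λ Pv j → ≈-sym (P⇒invariant Pv j)) (λ {u} _ → restrict-extend u) (λ {v} _ → g≈h v)

-- Harmonic weight enumerators

module ℝ-Weights = SubsetFunctions ℝ-commutativeRing
module 𝒫-Weights = SubsetFunctions 𝒫-commutativeRing
open 𝒫-Weights using (subset-sum; monomial)

-- f extended by zero to subsets of the wrong size.
extendByZero : ∀ {t d} → ℝ[ t ] d → Subset t → ℝ
extendByZero {d = d} f z = go (∣ z ∣ ℕ.≟ d)
  module ExtendByZero where
  go : Dec (∣ z ∣ ≡ d) → ℝ
  go (yes ∣z∣≡d) = f (z , ∣z∣≡d)
  go (no _)      = 0ℝ

extendByZero-on : ∀ {t d} (f : ℝ[ t ] d) z (∣z∣≡d : ∣ z ∣ ≡ d) → f (z , ∣z∣≡d) ≡ extendByZero f z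
extendByZero-on {d = d} f z ∣z∣≡d = go (∣ z ∣ ℕ.≟ d)
  where
  go : (eq? : Dec (∣ z ∣ ≡ d)) → f (z , ∣z∣≡d) ≡ ExtendByZero.go f z eq?
  go (yes eq) = cong (λ eq → f (z , eq)) (ℕ.≡-irrelevant ∣z∣≡d eq)
  go (no neq) = contradiction ∣z∣≡d neq

extendByZero-off : ∀ {t d} (f : ℝ[ t ] d) z → ∣ z ∣ ≢ d → extendByZero f z ≡ 0ℝ
extendByZero-off {d = d} f z ∣z∣≢d = go (∣ z ∣ ℕ.≟ d)
  where
  go : (eq? : Dec (∣ z ∣ ≡ d)) → ExtendByZero.go f z eq? ≡ 0ℝ
  go (yes eq) = contradiction eq ∣z∣≢d
  go (no _)   = refl

module _ where
  open ℝ-Ring hiding (zero) renaming (refl to ≈-refl; sym to ≈-sym; trans to ≈-trans)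

  listSum-cong : ∀ {a} {A : Set a} {v w : A → ℝ} → (∀ x → v x ≈ʳ w x) → ∀ xs → listSum v xs ≈ʳ listSum w xs
  listSum-cong v≈w []       = ≈-refl
  listSum-cong v≈w (x ∷ xs) = +-cong (v≈w x) (listSum-cong v≈w xs)

  listSum-0 : ∀ {a} {A : Set a} {v : A → ℝ} → (∀ x → v x ≈ʳ 0ℝ) → ∀ xs → listSum v xs ≈ʳ 0ℝ
  listSum-0 v≈0 []       = ≈-refl
  listSum-0 v≈0 (x ∷ xs) = ≈-trans (+-cong (v≈0 x) (listSum-0 v≈0 xs)) (+-identityˡ 0ℝ)

  listSum-++ : ∀ {a} {A : Set a} (v : A → ℝ) xs ys → listSum v (xs ++ ys) ≈ʳ listSum v xs ⊞ listSum v ys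
  listSum-++ v []       ys = ≈-sym (+-identityˡ _)
  listSum-++ v (x ∷ xs) ys = ≈-trans (+-congˡ (listSum-++ v xs ys)) (≈-sym (+-assoc _ _ _))

  listSum-map : ∀ {a b} {A : Set a} {B : Set b} (v : B → ℝ) (g : A → B) xs → listSum v (map g xs) ≈ʳ listSum (v ∘ g) xs
  listSum-map v g []       = ≈-refl
  listSum-map v g (x ∷ xs) = +-congˡ (listSum-map v g xs)

  listSum-tabulate : ∀ {a} {A : Set a} (v : A → ℝ) {n} (g : Fin n → A) →
    listSum v (List.tabulate g) ≈ʳ ℝ-Sums.sum (v ∘ g)
  listSum-tabulate v {zero}  g = ≈-sym (ℝ-Sums.sum-zero _)
  listSum-tabulate v {suc n} g = ≈-trans (+-congˡ (listSum-tabulate v (g ∘ Fin.suc))) (≈-sym (ℝ-Sums.sum-suc _))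

  layer? : ∀ {t} k (y z : Subset t) → Dec (∣ z ∣ ≡ k ℕ.+ ∣ y ∣ × y Subset.⊆ z)
  layer? k y z = (∣ z ∣ ℕ.≟ k ℕ.+ ∣ y ∣) ×-dec (y Subset.⊆? z)

  layer-sum : ∀ {t} → ℕ → (Subset t → ℝ) → Subset t → ℝ
  layer-sum {t} k F y = listSum (λ z → F z whenʳ does (layer? k y z)) (allSubsets t)

  private
    split : ∀ {t} (v : Subset (suc t) → ℝ) → listSum v (allSubsets (suc t)) ≈ʳ
      listSum (v ∘ (outside ∷_)) (allSubsets t) ⊞ listSum (v ∘ (inside ∷_)) (allSubsets t)
    split {t} v = ≈-trans (listSum-++ v (map (outside ∷_) (allSubsets t)) _)
      (+-cong (listSum-map v (outside ∷_) (allSubsets t)) (listSum-map v (inside ∷_) (allSubsets t)))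

    drop : ∀ {p} {P : Set p} (P? : Dec P) x → ¬ P → (x whenʳ does P?) ≈ʳ 0ℝ
    drop (yes p) x ¬p = contradiction p ¬p
    drop (no _)  x ¬p = ≈-refl

    below-inside : ∀ {t} k (F : Subset (suc t) → ℝ) y →
      layer-sum k F (inside ∷ y) ≈ʳ layer-sum k (F ∘ (inside ∷_)) y
    below-inside {t} k F y = ≈-trans (split (λ z → F z whenʳ does (layer? k (inside ∷ y) z))) (≈-trans (+-cong
      (listSum-0 (λ z → drop (layer? k (inside ∷ y) (outside ∷ z)) (F (outside ∷ z)) (λ (_ , y⊆z) → in⊈out y⊆z)) (allSubsets t))
      (listSum-cong (λ z → ℝ-Sums.when-cong (layer? k (inside ∷ y) (inside ∷ z)) (layer? k y z)
        (λ (eq , y⊆z) → ℕ.suc-injective (≡.trans eq (ℕ.+-suc k _)) , Subset.drop-∷-⊆ y⊆z)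
        (λ (eq , y⊆z) → ≡.trans (cong suc eq) (≡.sym (ℕ.+-suc k _)) , Subset.in⊆in y⊆z)
        (λ _ → ≈-refl)) (allSubsets t)))
      (+-identityˡ _))
      where
      in⊈out : ∀ {z : Subset t} → ¬ ((inside ∷ y) Subset.⊆ (outside ∷ z))
      in⊈out y⊆z with y⊆z Vec.here
      ... | ()

    below-outside : ∀ {t} k (F : Subset (suc t) → ℝ) y → layer-sum k F (outside ∷ y) ≈ʳ
      layer-sum k (F ∘ (outside ∷_)) y ⊞
      listSum (λ z → F (inside ∷ z) whenʳ does (layer? k (outside ∷ y) (inside ∷ z))) (allSubsets t)
    below-outside {t} k F y = ≈-trans (split (λ z → F z whenʳ does (layer? k (outside ∷ y) z))) (+-congʳ (listSum-cong
      (λ z → ℝ-Sums.when-cong (layer? k (outside ∷ y) (outside ∷ z)) (layer? k y z)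
        (λ (eq , y⊆z) → eq , Subset.drop-∷-⊆ y⊆z) (λ (eq , y⊆z) → eq , Subset.out⊆ y⊆z) (λ _ → ≈-refl))
      (allSubsets t)))

  -- Links the recursive layers to the list sum that defines `γ`. Only k = 1 is wanted, but
  -- including a position outside y lowers k, so the induction covers all k.
  up-layer≈layer-sum : ∀ {t} k (F : Subset t → ℝ) y → ℝ-Weights.up-layer k F y ≈ʳ layer-sum k F y
  up-layer≈layer-sum zero    F []            = ≈-sym (+-identityʳ _)
  up-layer≈layer-sum (suc k) F []            = ≈-sym (+-identityʳ _)
  up-layer≈layer-sum zero    F (inside  ∷ y) =
    ≈-trans (up-layer≈layer-sum zero (F ∘ (inside ∷_)) y) (≈-sym (below-inside zero F y))
  up-layer≈layer-sum (suc k) F (inside  ∷ y) =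
    ≈-trans (up-layer≈layer-sum (suc k) (F ∘ (inside ∷_)) y) (≈-sym (below-inside (suc k) F y))
  up-layer≈layer-sum {suc t} zero F (outside ∷ y) = ≈-sym (≈-trans (below-outside zero F y)
    (≈-trans (+-cong (≈-sym (up-layer≈layer-sum zero (F ∘ (outside ∷_)) y))
      (listSum-0 (λ z → drop (layer? zero (outside ∷ y) (inside ∷ z)) _ (λ (eq , y⊆z) →
        ℕ.<-irrefl refl (ℕ.≤-trans (ℕ.≤-reflexive eq) (Subset.p⊆q⇒∣p∣≤∣q∣ (Subset.drop-∷-⊆ y⊆z))))) (allSubsets t)))
      (+-identityʳ _)))
  up-layer≈layer-sum {suc t} (suc k) F (outside ∷ y) = ≈-sym (≈-trans (below-outside (suc k) F y)
    (+-cong (≈-sym (up-layer≈layer-sum (suc k) (F ∘ (outside ∷_)) y))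
      (≈-trans (listSum-cong (λ z → ℝ-Sums.when-cong (layer? (suc k) (outside ∷ y) (inside ∷ z)) (layer? k y z)
          (λ (eq , y⊆z) → ℕ.suc-injective eq , Subset.drop-∷-⊆ y⊆z) (λ (eq , y⊆z) → cong suc eq , Subset.out⊆ y⊆z)
          (λ _ → ≈-refl)) (allSubsets t))
        (≈-sym (up-layer≈layer-sum k (F ∘ (inside ∷_)) y)))))

  -- For |y| = d - 1 this is the hypothesis on f. For any other y, including every y when d = 0, the
  -- sets one larger than y have the wrong size and all terms are zero.
  Harm⇒Harmonic : ∀ {t d} (f : ℝ[ t ] d) → Harm t d f → ℝ-Weights.Harmonic (extendByZero f)
  Harm⇒Harmonic {t} {d} f f-harm y = ≈-trans (up-layer≈layer-sum 1 (extendByZero f) y) (go d f f-harm (d ℕ.≟ suc ∣ y ∣))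
    where
    go : ∀ d (f : ℝ[ t ] d) → Harm t d f → Dec (d ≡ suc ∣ y ∣) → layer-sum 1 (extendByZero f) y ≈ʳ 0ℝ
    -- Matching on this equation makes d a successor, so that `γ f` reduces to its sum.
    go .(suc ∣ y ∣) f f-harm (yes refl) = ≈-trans
      (≈-sym (sumOver≈listSum (λ z → (∣ z ∣ ℕ.≟ suc ∣ y ∣) ×-dec (y Subset.⊆? z)) (λ z (∣z∣≡d , _) → f (z , ∣z∣≡d))
        (extendByZero f) (λ z (∣z∣≡d , _) → reflexive (extendByZero-on f z ∣z∣≡d)) (allSubsets t)))
      (wrap (f-harm (y , refl)))
    go d f f-harm (no d≢) = listSum-0 (λ z → vanish z (layer? 1 y z)) (allSubsets t)
      where
      vanish : ∀ z (l? : Dec (∣ z ∣ ≡ 1 ℕ.+ ∣ y ∣ × y Subset.⊆ z)) → (extendByZero f z whenʳ does l?) ≈ʳ 0ℝ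
      vanish z (yes (eq , _)) = reflexive (extendByZero-off f z (λ ∣z∣≡d → d≢ (≡.trans (≡.sym ∣z∣≡d) eq)))
      vanish z (no _)         = ≈-refl

constₚ-up-layer : ∀ {t} k (F : Subset t → ℝ) y →
  constₚ (ℝ-Weights.up-layer k F y) ~ 𝒫-Weights.up-layer k (constₚ ∘ F) y
constₚ-up-layer zero    F y             = 𝒫.refl
constₚ-up-layer (suc k) F []            = constₚ-0
constₚ-up-layer (suc k) F (inside  ∷ y) = constₚ-up-layer (suc k) (F ∘ (inside ∷_)) y
constₚ-up-layer (suc k) F (outside ∷ y) = 𝒫.trans (constₚ-⊞ _ _)
  (𝒫.+-cong (constₚ-up-layer (suc k) (F ∘ (outside ∷_)) y) (constₚ-up-layer k (F ∘ (inside ∷_)) y))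

constₚ-· : ∀ k x → constₚ (k ·ʳ x) ~ k ·ₚ constₚ x
constₚ-· zero    x = constₚ-0
constₚ-· (suc k) x = 𝒫.trans (constₚ-⊞ x (k ·ʳ x)) (𝒫.+-congˡ (constₚ-· k x))

constₚ-injective-0 : ∀ {c} → constₚ c ~ [] → c ≈ʳ 0ℝ
constₚ-injective-0 c~0 = ℝ-Ring.trans (ℝ-Ring.sym (ℝ-Ring.trans (ℝ-Ring.+-identityʳ _) (ℝ-Ring.*-identityʳ _)))
  (evals c~0 (λ _ _ → 1ℝ))

weightₚ : ∀ {t d} → ℝ[ t ] d → Subset t → Poly
weightₚ f z = constₚ (extendByZero f z)

weightₚ-harmonic : ∀ {t d} (f : ℝ[ t ] d) → Harm t d f → 𝒫-Weights.Harmonic (weightₚ f)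
weightₚ-harmonic f f-harm y = 𝒫.trans (𝒫.sym (constₚ-up-layer 1 (extendByZero f) y))
  (𝒫.trans (constₚ-cong (Harm⇒Harmonic f f-harm y)) constₚ-0)

weightₚ-homogeneous : ∀ {t d} (f : ℝ[ t ] d) → 𝒫-Weights.Homogeneous-of d (weightₚ f)
weightₚ-homogeneous f z ∣z∣≢d = 𝒫.trans (𝒫.reflexive (cong constₚ (extendByZero-off f z ∣z∣≢d))) constₚ-0

monomial~^ : ∀ {t} (S : Subset t) P Q → monomial S Q P ~ P ^ᵖ (t ℕ.∸ ∣ S ∣) ⊗ₚ Q ^ᵖ ∣ S ∣
monomial~^ []            P Q = 𝒫.sym (𝒫.*-identityˡ _)
monomial~^ (inside  ∷ S) P Q = 𝒫.trans (𝒫.*-congˡ (monomial~^ S P Q))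
  (𝒫.trans (𝒫.sym (𝒫.*-assoc _ _ _)) (𝒫.trans (𝒫.*-congʳ (𝒫.*-comm _ _)) (𝒫.*-assoc _ _ _)))
monomial~^ {suc t} (outside ∷ S) P Q = 𝒫.trans (𝒫.*-congˡ (monomial~^ S P Q))
  (𝒫.trans (𝒫.sym (𝒫.*-assoc _ _ _))
    (𝒫.*-congʳ (𝒫.reflexive (cong (P ^ᵖ_) (≡.sym (ℕ.+-∸-assoc 1 (Subset.∣p∣≤n S)))))))

open import Data.Integer using (_-_)
open import Data.Nat using (_*_; _^_; _≤_)

length-filter-tabulate : ∀ {a p} {A : Set a} {P : Pred A p} (P? : Decidable P) {n} (g : Fin n → A) →
  List.length (filter P? (List.tabulate g)) ≡ sumℕ (λ k → 1 whenℕ does (P? (g k)))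
length-filter-tabulate P? {zero}  g = ≡.sym (ℕ-Sums.sum-zero _)
length-filter-tabulate P? {suc n} g with P? (g Fin.zero) in eq
... | yes _ = ≡.trans (cong₂ ℕ._+_ (cong (λ d → 1 whenℕ does d) (≡.sym eq)) (length-filter-tabulate P? (g ∘ Fin.suc)))
                (≡.sym (ℕ-Sums.sum-suc _))
... | no _  = ≡.trans (cong₂ ℕ._+_ (cong (λ d → 1 whenℕ does d) (≡.sym eq)) (length-filter-tabulate P? (g ∘ Fin.suc)))
                (≡.sym (ℕ-Sums.sum-suc _))

+[m+k]-k : ∀ m k → + (m ℕ.+ k) ℤ.- + k ≡ + m
+[m+k]-k m k = ≡.trans (cong (ℤ._- + k) (ℤ.pos-+ m k)) (≡.trans (ℤ.+-assoc (+ m) (+ k) (ℤ.- + k))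
  (≡.trans (cong (ℤ._+_ (+ m)) (ℤ.+-inverseʳ (+ k))) (ℤ.+-identityʳ (+ m))))

module ProductRearrangements {c ℓ} (𝓡 : CommutativeRing c ℓ) where
  private module 𝓡 = CommutativeRing 𝓡
  open NaturalSolver 𝓡.commutativeSemiring using (solve; _:*_; _:=_)

  regroup : ∀ c p p′ q q′ → c 𝓡.* (p 𝓡.* p′) 𝓡.* (q 𝓡.* q′) 𝓡.≈ (p 𝓡.* q) 𝓡.* (c 𝓡.* p′ 𝓡.* q′)
  regroup = solve 5 (λ c p p′ q q′ → c :* (p :* p′) :* (q :* q′) := (p :* q) :* (c :* p′ :* q′)) 𝓡.refl

  collectˡ : ∀ l a m x y z → (l 𝓡.* a) 𝓡.* (m 𝓡.* ((x 𝓡.* y) 𝓡.* z)) 𝓡.≈ l 𝓡.* (a 𝓡.* (x 𝓡.* (y 𝓡.* (m 𝓡.* z))))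
  collectˡ = solve 6 (λ l a m x y z → (l :* a) :* (m :* ((x :* y) :* z)) := l :* (a :* (x :* (y :* (m :* z))))) 𝓡.refl

  collectʳ : ∀ x q y s l a z → (x 𝓡.* (q 𝓡.* y)) 𝓡.* (s 𝓡.* ((l 𝓡.* a) 𝓡.* z)) 𝓡.≈
    l 𝓡.* (a 𝓡.* (x 𝓡.* (y 𝓡.* (s 𝓡.* q 𝓡.* z))))
  collectʳ = solve 7 (λ x q y s l a z → (x :* (q :* y)) :* (s :* ((l :* a) :* z)) :=
    l :* (a :* (x :* (y :* (s :* q :* z))))) 𝓡.refl

  pull : ∀ k l m e → k 𝓡.* (l 𝓡.* (m 𝓡.* e)) 𝓡.≈ l 𝓡.* (m 𝓡.* (k 𝓡.* e))
  pull = solve 4 (λ k l m e → k :* (l :* (m :* e)) := l :* (m :* (k :* e))) 𝓡.refl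

module CodeEnumerators {c ℓ p} (R : Ring c ℓ) {q} (enum : Enumeration R q)
    {n} (G H : PermutationGroup n) (H≤G : ∀ π → PermutationGroup._∈ᴳ H π → PermutationGroup._∈ᴳ G π) {t} (orbits : Orbits H t)
    (∣H∣⁻¹ : Coding.OrderInvertible R enum H)
    (C : Coding.DecSubset R enum n p) (isCode : Coding.IsLeftGCode R enum G C)
    {d} (f : ℝ[ t ] d) (f-harm : Harm t d f) where
  open Vectors R enum using (V; _≋_; vector; position; DecSubset; card; allVectors; enumerationⱽ; module Average; module Subcodes)
  open OrbitReduction R enum G H H≤G orbits ∣H∣⁻¹ C isCode public
  open Supports R enum
  open Average H ∣H∣⁻¹
  open Enumerator orbits
  open DecSubset
  private module Vₜ = FiniteAbelianGroup (Subcodes.group t)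

  F : Subset t → Poly
  F = weightₚ f

  F-harmonic : 𝒫-Weights.Harmonic F
  F-harmonic = weightₚ-harmonic f f-harm

  F-homogeneous : 𝒫-Weights.Homogeneous-of d F
  F-homogeneous = weightₚ-homogeneous f

  open 𝒫-Weights.HarmonicWeight 𝒫-torsionFree F-harmonic F-homogeneous

  σ : Fin (q ^ t) → Subset t
  σ k = support (vector {t} k)

  enumerator : (Fin (q ^ t) → Bool) → Poly → Poly → Poly
  enumerator = 𝒫-Weights.Enumerators.enumerator σ 𝒫-torsionFree F-harmonic F-homogeneous

  -- This is (q-1)^d, the number of vectors with a given support of size d, hence the ratio of f̃ to
  -- the plain subset sum.
  K : Poly
  K = (nonzeros ·ₚ constₚ 1ℝ) ^ᵖ d

  private
    Fʳ : Subset t → ℝ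
    Fʳ = extendByZero f

    Fʳ-cong : ∀ {S T} → S ≡ T → Fʳ S ≈ʳ Fʳ T
    Fʳ-cong S≡T = ℝ-Ring.reflexive (cong Fʳ S≡T)

  -- Extension of f by zero absorbs the condition on the weight of v. What is left depends only on
  -- the restriction of v to orbit representatives, so it becomes a sum over all vectors of length t
  -- supported in supp u.
  tilde≈weighted-total : ∀ u → tilde f u ≈ʳ weighted-total ℝ-Ring.+-commutativeMonoid (supp u) Fʳ
  tilde≈weighted-total u = begin
    tilde f u
      ≈⟨ sumOver≈listSum counted? (λ v (_ , wt≡d , _) → f (supp v , wt≡d)) (λ v → Fʳ (supp v))
           (λ v (_ , wt≡d , _) → ℝ-Ring.reflexive (extendByZero-on f (supp v) wt≡d)) (allVectors n) ⟩
    listSum (λ v → Fʳ (supp v) whenʳ does (counted? v)) (allVectors n)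
      ≈⟨ listSum-tabulate (λ v → Fʳ (supp v) whenʳ does (counted? v)) (vector {n}) ⟩
    ℝ-Sums.sum (λ k → Fʳ (supp (vector {n} k)) whenʳ does (counted? (vector k)))
      ≈⟨ ℝ-Sums.sum-cong (λ k → forget (vector k) (mem? Vθ (vector k)) (wt (vector k) ℕ.≟ d) (supp (vector k) Subset.⊆? S)) ⟩
    ℝ-Sums.sum (λ k → Fʳ (supp (vector {n} k)) whenʳ does (below? (vector k)))
      ≈⟨ sum-restrict ℝ-Ring.+-commutativeMonoid below? (λ x → support x Subset.⊆? S)
           {g = λ v → Fʳ (supp v)} {h = λ x → Fʳ (support x)}
           (λ {v} {w} v≋w (v∈ , v⊆) → resp Vθ v≋w v∈ , subst (Subset._⊆ S) (support-cong (λ i → v≋w (Orbits.α orbits i))) v⊆)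
           (λ {x} {y} x≋y x⊆ → subst (Subset._⊆ S) (support-cong x≋y) x⊆)
           (λ (v∈ , _) → ∈Vθ⇒ v∈) (λ (_ , v⊆) → v⊆)
           (λ {x} x⊆ → (extend x , _ , invariant⇒θ (extend-invariant x))
                     , subst (Subset._⊆ S) (≡.sym (support-cong (restrict-extend x))) x⊆)
           (λ x≋y → Fʳ-cong (support-cong x≋y)) (λ _ → ℝ-Ring.refl) ⟩
    ℝ-Sums.sum (λ l → Fʳ (support (vector {t} l)) whenʳ does (support (vector {t} l) Subset.⊆? S))
      ≈⟨ support-sum ℝ-Ring.+-commutativeMonoid S Fʳ ⟩
    weighted-total ℝ-Ring.+-commutativeMonoid S Fʳ ∎
    where
    open SetoidReasoning ℝ-Ring.setoid
    S = supp u
    counted? = λ v → mem? Vθ v ×-dec (wt v ℕ.≟ d) ×-dec (supp v Subset.⊆? S)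
    below? : Decidable (λ v → mem Vθ v × supp v Subset.⊆ S)
    below? v = mem? Vθ v ×-dec (supp v Subset.⊆? S)
    forget : ∀ v (x : Dec (mem Vθ v)) (y : Dec (wt v ≡ d)) (z : Dec (supp v Subset.⊆ S)) →
      (Fʳ (supp v) whenʳ does (x ×-dec y ×-dec z)) ≈ʳ (Fʳ (supp v) whenʳ does (x ×-dec z))
    forget v (no _)  y       z       = ℝ-Ring.refl
    forget v (yes _) (yes _) z       = ℝ-Ring.refl
    forget v (yes _) (no _)  (no _)  = ℝ-Ring.refl
    forget v (yes _) (no ≢d) (yes _) = ℝ-Ring.reflexive (≡.sym (extendByZero-off f (supp v) ≢d))

  constₚ-weighted-total : ∀ {t} (S : Subset t) (W : Subset t → ℝ) →
    constₚ (weighted-total ℝ-Ring.+-commutativeMonoid S W) ~ weighted-total 𝒫.+-commutativeMonoid S (constₚ ∘ W)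
  constₚ-weighted-total []            W = 𝒫.refl
  constₚ-weighted-total (outside ∷ S) W = constₚ-weighted-total S (W ∘ (outside ∷_))
  constₚ-weighted-total (inside  ∷ S) W = 𝒫.trans (constₚ-⊞ _ _) (𝒫.+-cong (constₚ-weighted-total S (W ∘ (outside ∷_)))
    (𝒫.trans (constₚ-· nonzeros _)
      (SemiringMult.×-congʳ 𝒫.semiring nonzeros (constₚ-weighted-total S (W ∘ (inside ∷_))))))

  -- The multiplicities (q-1)^|z| amount to evaluating the form at q - 1 times the indicator of the
  -- support, and homogeneity extracts (q-1)^d.
  tilde~ : ∀ u → constₚ (tilde f u) ~ K ⊗ₚ subset-sum F (supp u)
  tilde~ u = begin
    constₚ (tilde f u)                                           ≈⟨ constₚ-cong (tilde≈weighted-total u) ⟩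
    constₚ (weighted-total ℝ-Ring.+-commutativeMonoid S Fʳ)       ≈⟨ constₚ-weighted-total S Fʳ ⟩
    weighted-total 𝒫.+-commutativeMonoid S F                     ≈⟨ weighted-total≈evaluate₁ 𝒫-commutativeRing S F ⟩
    𝒫-Weights.evaluate₁ F (𝒫-Weights.pick S κ [])
      ≈⟨ 𝒫-Weights.evaluate₁-point {F = F} (𝒫-Weights.pick-map S (κ ⊗ₚ_) (𝒫.sym (𝒫.*-identityʳ κ)) (𝒫.sym (𝒫.zeroʳ κ))) ⟩
    𝒫-Weights.evaluate₁ F (λ i → κ ⊗ₚ 𝒫-Weights.pick S (constₚ 1ℝ) [] i)
      ≈⟨ evaluate₁-homogeneous κ _ ⟩
    K ⊗ₚ subset-sum F S                                          ∎
    where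
    open SetoidReasoning 𝒫.setoid
    S = supp u
    κ = nonzeros ·ₚ constₚ 1ℝ

  tilde-vanishes : ∀ u → ¬ (d ℕ.≤ t ℕ.∸ wt u × d ℕ.≤ wt u) → tilde f u ≈ʳ 0ℝ
  tilde-vanishes u ¬d≤ = constₚ-injective-0 (𝒫.trans (tilde~ u) (𝒫.trans (𝒫.*-congˡ subset-sum≈0) (𝒫.zeroʳ K)))
    where
    subset-sum≈0 : subset-sum F (supp u) ~ []
    subset-sum≈0 with d ℕ.≤? wt u
    ... | no  d≰wt = subset-sum-small (supp u) (ℕ.≰⇒> d≰wt)
    ... | yes d≤wt = subset-sum-large (supp u) (ℕ.≰⇒> (λ d≤ → ¬d≤ (d≤ , d≤wt)))

  module _ {p′} (D : DecSubset n p′) (B : Subset (q ^ t)) (D⇒invariant : ∀ {v} → mem D v → Invariant v)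
      (D⇒B : ∀ {v} → mem D v → restrict v Vₜ.∈ B) (B⇒D : ∀ {u} → u Vₜ.∈ B → mem D (extend u)) where

    codeword : Fin (q ^ t) → Bool
    codeword k = does (k Subset.∈? B)

    card≡ : card D ≡ ∣ B ∣
    card≡ = ≡.trans (length-filter-tabulate (mem? D) (vector {n}))
      (≡.trans (sum-restrict ℕ.+-0-commutativeMonoid (mem? D) (Vₜ._∈? B)
          {g = λ _ → 1} {h = λ _ → 1} (resp D) Vₜ.∈-resp D⇒invariant D⇒B B⇒D (λ _ → refl) (λ _ → refl))
      (≡.trans (ℕ-Sums.sum-cong λ l → ℕ-Sums.when-cong (vector {t} l Vₜ.∈? B) (l Subset.∈? B) Vₜ.∈-from⁻ Vₜ.∈-from (λ _ → refl))
        (≡.sym (∣-∣≡sum B))))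

    -- P and Q stay arbitrary here and in `W-quotient`, because the duality evaluates the enumerator
    -- of C at the transformed forms and not at x and y.
    W-enumerator : ∀ P Q → substitute P Q (W D f) ~ K ⊗ₚ enumerator codeword P Q
    W-enumerator P Q = begin
      substitute P Q (W D f)
        ≈⟨ substitute-sum (mem? D) (λ u → tilde f u , t ℕ.∸ wt u , wt u) P Q (vector {n}) ⟩
      sumₚ (λ k → term P Q (tilde f (vector k) , t ℕ.∸ wt (vector k) , wt (vector k)) whenₚ does (mem? D (vector k)))
        ≈⟨ sum-restrict 𝒫.+-commutativeMonoid (mem? D) (Vₜ._∈? B)
             {g = λ v → term P Q (tilde f v , t ℕ.∸ wt v , wt v)} {h = summand}
             (resp D) Vₜ.∈-resp D⇒invariant D⇒B B⇒D
             (λ x≋y → 𝒫.reflexive (cong (λ S → K ⊗ₚ (subset-sum F S ⊗ₚ monomial S Q P)) (support-cong x≋y)))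
             term~ ⟩
      sumₚ (λ l → summand (vector l) whenₚ does (vector {t} l Vₜ.∈? B))
        ≈⟨ 𝒫-Sums.sum-cong (λ l → 𝒫.trans
             (𝒫-Sums.when-cong (vector {t} l Vₜ.∈? B) (l Subset.∈? B) Vₜ.∈-from⁻ Vₜ.∈-from (λ _ → 𝒫.refl))
             (𝒫.sym (𝒫-Weights.*-when (codeword l) K _))) ⟩
      sumₚ (λ l → K ⊗ₚ (subset-sum F (σ l) ⊗ₚ monomial (σ l) Q P whenₚ codeword l))
        ≈⟨ 𝒫-Weights.sum-*ˡ K _ ⟨
      K ⊗ₚ enumerator codeword P Q ∎
      where
      open SetoidReasoning 𝒫.setoid
      summand : V t → Poly
      summand x = K ⊗ₚ (subset-sum F (support x) ⊗ₚ monomial (support x) Q P)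
      term~ : ∀ v → term P Q (tilde f v , t ℕ.∸ wt v , wt v) ~ summand (restrict v)
      term~ v = 𝒫.trans (𝒫.*-assoc _ _ _) (𝒫.trans (𝒫.*-cong (tilde~ v) (𝒫.sym (monomial~^ (supp v) P Q))) (𝒫.*-assoc _ _ _))

    -- Division by (xy)^d. Wherever one of the truncated subtractions would lose something, the
    -- coefficient is zero by `tilde-vanishes`.
    quotient : Poly
    quotient = map (λ u → tilde f u , t ℕ.∸ wt u ℕ.∸ d , wt u ℕ.∸ d) (filter (mem? D) (allVectors n))

    term-quotient : ∀ P Q u → term P Q (tilde f u , t ℕ.∸ wt u , wt u) ~
      (P ⊗ₚ Q) ^ᵖ d ⊗ₚ term P Q (tilde f u , t ℕ.∸ wt u ℕ.∸ d , wt u ℕ.∸ d)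
    term-quotient P Q u = go ((d ℕ.≤? t ℕ.∸ wt u) ×-dec (d ℕ.≤? wt u))
      where
      open SetoidReasoning 𝒫.setoid
      i = t ℕ.∸ wt u
      j = wt u
      go : Dec (d ℕ.≤ i × d ℕ.≤ j) → term P Q (tilde f u , i , j) ~ (P ⊗ₚ Q) ^ᵖ d ⊗ₚ term P Q (tilde f u , i ℕ.∸ d , j ℕ.∸ d)
      go (no ¬d≤) = 𝒫.trans (vanish i j) (𝒫.sym (𝒫.trans (𝒫.*-congˡ (vanish (i ℕ.∸ d) (j ℕ.∸ d))) (𝒫.zeroʳ _)))
        where
        vanish : ∀ i j → term P Q (tilde f u , i , j) ~ []
        vanish i j = 𝒫.trans (𝒫.*-congʳ (𝒫.*-congʳ (𝒫.trans (constₚ-cong (tilde-vanishes u ¬d≤)) constₚ-0)))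
          (𝒫.trans (𝒫.*-congʳ (𝒫.zeroˡ _)) (𝒫.zeroˡ _))
      go (yes (d≤i , d≤j)) = begin
        constₚ (tilde f u) ⊗ₚ P ^ᵖ i ⊗ₚ Q ^ᵖ j
          ≈⟨ 𝒫.*-cong (𝒫.*-congˡ (split P i d≤i)) (split Q j d≤j) ⟩
        constₚ (tilde f u) ⊗ₚ (P ^ᵖ d ⊗ₚ P ^ᵖ (i ℕ.∸ d)) ⊗ₚ (Q ^ᵖ d ⊗ₚ Q ^ᵖ (j ℕ.∸ d))
          ≈⟨ regroup (constₚ (tilde f u)) (P ^ᵖ d) (P ^ᵖ (i ℕ.∸ d)) (Q ^ᵖ d) (Q ^ᵖ (j ℕ.∸ d)) ⟩
        (P ^ᵖ d ⊗ₚ Q ^ᵖ d) ⊗ₚ (constₚ (tilde f u) ⊗ₚ P ^ᵖ (i ℕ.∸ d) ⊗ₚ Q ^ᵖ (j ℕ.∸ d))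
          ≈⟨ 𝒫.*-congʳ (CommutativeSemiringExp.^-distrib-* 𝒫.commutativeSemiring P Q d) ⟨
        (P ⊗ₚ Q) ^ᵖ d ⊗ₚ term P Q (tilde f u , i ℕ.∸ d , j ℕ.∸ d) ∎
        where
        split : ∀ P i → d ℕ.≤ i → P ^ᵖ i ~ P ^ᵖ d ⊗ₚ P ^ᵖ (i ℕ.∸ d)
        split P i d≤i = 𝒫.trans (𝒫.reflexive (cong (P ^ᵖ_) (≡.sym (ℕ.m+[n∸m]≡n d≤i))))
          (SemiringExp.^-homo-* 𝒫.semiring P d (i ℕ.∸ d))
        regroup = ProductRearrangements.regroup 𝒫-commutativeRing

    W-quotient : ∀ P Q → substitute P Q (W D f) ~ (P ⊗ₚ Q) ^ᵖ d ⊗ₚ substitute P Q quotient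
    W-quotient P Q = go (filter (mem? D) (allVectors n))
      where
      go : ∀ us → substitute P Q (map (λ u → tilde f u , t ℕ.∸ wt u , wt u) us) ~
        (P ⊗ₚ Q) ^ᵖ d ⊗ₚ substitute P Q (map (λ u → tilde f u , t ℕ.∸ wt u ℕ.∸ d , wt u ℕ.∸ d) us)
      go []       = 𝒫.sym (𝒫.zeroʳ _)
      go (u ∷ us) = 𝒫.trans (𝒫.+-cong (term-quotient P Q u) (go us)) (𝒫.sym (𝒫.distribˡ _ _ _))

    quotient-homogeneous : Homogeneous (+ t - + (2 * d)) quotient
    quotient-homogeneous = homogeneous (+ t - + (2 * d)) quotient (all (filter (mem? D) (allVectors n)))
      where
      degree : ∀ u → d ℕ.≤ t ℕ.∸ wt u × d ℕ.≤ wt u → + ((t ℕ.∸ wt u ℕ.∸ d) ℕ.+ (wt u ℕ.∸ d)) ≡ + t - + (2 * d)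
      degree u (d≤i , d≤j) = ≡.trans (≡.sym (+[m+k]-k (i ℕ.∸ d ℕ.+ (j ℕ.∸ d)) (2 * d))) (cong (λ m → + m - + (2 * d)) total)
        where
        i = t ℕ.∸ wt u
        j = wt u
        total : i ℕ.∸ d ℕ.+ (j ℕ.∸ d) ℕ.+ 2 * d ≡ t
        total = ≡.trans (solve 3 (λ x y d → x :+ y :+ con 2 :* d := (x :+ d) :+ (y :+ d)) refl (i ℕ.∸ d) (j ℕ.∸ d) d)
          (≡.trans (cong₂ ℕ._+_ (ℕ.m∸n+n≡m d≤i) (ℕ.m∸n+n≡m d≤j)) (ℕ.m∸n+n≡m (Subset.∣p∣≤n (supp u))))
          where open +-*-Solver
      vanish : ∀ u → Dec (d ℕ.≤ t ℕ.∸ wt u × d ℕ.≤ wt u) →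
        + ((t ℕ.∸ wt u ℕ.∸ d) ℕ.+ (wt u ℕ.∸ d)) ≢ + t - + (2 * d) → tilde f u ≈ʳ 0ℝ
      vanish u (yes d≤) neq = contradiction (degree u d≤) neq
      vanish u (no ¬d≤) _   = tilde-vanishes u ¬d≤
      all : ∀ us → All (λ (c , i , j) → + (i ℕ.+ j) ≢ + t - + (2 * d) → c ≈ʳ 0ℝ)
        (map (λ u → tilde f u , t ℕ.∸ wt u ℕ.∸ d , wt u ℕ.∸ d) us)
      all []       = []
      all (u ∷ us) = vanish u ((d ℕ.≤? t ℕ.∸ wt u) ×-dec (d ℕ.≤? wt u)) ∷ all us

module LinearForms where
  open 𝒫 renaming (refl to ~-refl; sym to ~-sym; trans to ~-trans) hiding (zero)

  -- The value x - y taken by the parameter a of `enumerator-duality`. The forms a + y and Qy + a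
  -- then become x and x + (q-1)y.
  difference : Poly
  difference = X ⊕ₚ constₚ -1ℝ ⊗ₚ Y

  difference+Y : difference ⊕ₚ Y ~ X
  difference+Y = ~-trans (+-assoc X _ Y) (~-trans (+-congˡ (-‿inverseˡ Y)) (+-identityʳ X))

  module _ (q : ℕ) where
    coefficient : ℝ
    coefficient = fraction q 1 ⊞ -1ℝ

    form : Poly
    form = X ⊕ₚ constₚ coefficient ⊗ₚ Y

    constₚ-fraction : constₚ (fraction q 1) ~ q ·ₚ constₚ 1ℝ
    constₚ-fraction = ~-trans (~-sym (constₚ-cong (·1≈fraction q))) (constₚ-·ʳ q)

    form~ : (q ·ₚ constₚ 1ℝ) ⊗ₚ Y ⊕ₚ difference ~ form
    form~ = ~-trans (~-sym (+-assoc _ X _)) (~-trans (+-congʳ (+-comm _ X)) (~-trans (+-assoc X _ _)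
      (+-congˡ (~-trans (~-sym (distribʳ Y _ _))
        (*-congʳ (~-trans (+-congʳ (~-sym constₚ-fraction)) (~-sym (constₚ-⊞ (fraction q 1) -1ℝ))))))))

power-constₚ : ∀ x k → constₚ (x ^ʳ k) ~ constₚ x ^ᵖ k
power-constₚ x zero    = 𝒫.refl
power-constₚ x (suc k) = 𝒫.trans (𝒫.reflexive (cong constₚ (≡.sym (⊡≡ x (x ^ʳ k)))))
  (𝒫.trans (constₚ-⊡ x (x ^ʳ k)) (𝒫.*-congˡ (power-constₚ x k)))

·1-cancel : ∀ m → .{{_ : ℕ.NonZero m}} → ∀ {P Q} → m ·ₚ constₚ 1ℝ ⊗ₚ P ~ m ·ₚ constₚ 1ℝ ⊗ₚ Q → P ~ Q
·1-cancel m {P} {Q} eq = 𝒫.trans (𝒫.sym (divide P)) (𝒫.trans (𝒫.*-congˡ eq) (divide Q))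
  where
  divide : ∀ P → constₚ (fraction 1 m) ⊗ₚ (m ·ₚ constₚ 1ℝ ⊗ₚ P) ~ P
  divide P = begin
    constₚ (fraction 1 m) ⊗ₚ (m ·ₚ constₚ 1ℝ ⊗ₚ P)
      ≈⟨ 𝒫.*-assoc _ _ P ⟨
    constₚ (fraction 1 m) ⊗ₚ m ·ₚ constₚ 1ℝ ⊗ₚ P
      ≈⟨ 𝒫.*-congʳ (𝒫.trans (𝒫.*-congˡ (𝒫.sym (constₚ-·ʳ m))) (𝒫.sym (constₚ-⊡ (fraction 1 m) (m ·ʳ 1ℝ)))) ⟩
    constₚ (fraction 1 m ⊡ m ·ʳ 1ℝ) ⊗ₚ P
      ≈⟨ 𝒫.*-congʳ (constₚ-cong (ℝ-Ring.trans (ℝ-Ring.*-comm _ _)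
           (ℝ-Ring.trans (fraction-cancel 1 m) (ℝ-Ring.+-identityʳ 1ℝ)))) ⟩
    constₚ 1ℝ ⊗ₚ P
      ≈⟨ 𝒫.*-identityˡ P ⟩
    P ∎
    where open SetoidReasoning 𝒫.setoid

-- The duality identity

opaque
  unfolding _⊕ₚ_ _⊗ₚ_

  form≡ : ∀ P Q S T → P +ₚ (Q -ₚ S) *ₚ T ≡ P ⊕ₚ (Q ⊕ₚ constₚ -1ℝ ⊗ₚ S) ⊗ₚ T
  form≡ P Q S T = refl

  difference≡ : ∀ P Q → P -ₚ Q ≡ P ⊕ₚ constₚ -1ℝ ⊗ₚ Q
  difference≡ P Q = refl

power-product~ : ∀ P Q Z k → (P ⊗ₚ Q) ^ᵖ k ⊗ₚ Z ~ (P *ₚ Q) ^ₚ k *ₚ Z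
power-product~ P Q Z k = 𝒫.reflexive (≡.sym (≡.trans
  (cong (_*ₚ Z) (≡.trans (^ₚ≡^ᵖ (P *ₚ Q) k) (cong (_^ᵖ k) (≡.sym (⊗ₚ≡ P Q))))) (≡.sym (⊗ₚ≡ _ Z))))

module DualityProof {c ℓ p} (R : Ring c ℓ) {q} (enum : Enumeration R q)
    {g} (generator : FiniteRing.SocleGenerator R enum g)
    {n} (G H : PermutationGroup n)
    (H≤G : ∀ π → PermutationGroup._∈ᴳ H π → PermutationGroup._∈ᴳ G π) {t} (orbits : Orbits H t)
    (∣H∣⁻¹ : Coding.OrderInvertible R enum H)
    (C : Coding.DecSubset R enum n p) (isCode : Coding.IsLeftGCode R enum G C)
    {d} (f : ℝ[ t ] d) (f-harm : Harm t d f) where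
  open Coding R enum using (card; _·M; _^⊥; module Average)
  open Average H ∣H∣⁻¹
  open Enumerator orbits using (W)
  open CodeEnumerators R enum G H H≤G orbits ∣H∣⁻¹ C isCode f f-harm
  open VectorDuality R enum generator t using (dual; ∈-dual⁺; ∈-dual⁻)
  open Shortening R enum generator t using (shortening; count-∩)
  open LinearForms

  D  = C ⟨θ⟩
  D′ = _·M H ((C ^⊥) ⟨θ⟩)
  A′ = dual A

  D⇒invariant : ∀ {v} → Coding.DecSubset.mem D v → Invariant v
  D⇒invariant v∈ = proj₂ (∈Cθ⇒ v∈)

  D′⇒invariant : ∀ {v} → Coding.DecSubset.mem D′ v → Invariant v
  D′⇒invariant v∈ = proj₁ (∈C⊥θM⇒ v∈)

  D′⇒A′ : ∀ {v} → Coding.DecSubset.mem D′ v → FiniteAbelianGroup._∈_ (Vectors.Subcodes.group R enum t) (restrict v) A′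
  D′⇒A′ v∈ = ∈-dual⁺ (proj₂ (∈C⊥θM⇒ v∈))

  A′⇒D′ : ∀ {u} → FiniteAbelianGroup._∈_ (Vectors.Subcodes.group R enum t) u A′ → Coding.DecSubset.mem D′ (extend u)
  A′⇒D′ u∈ = ∈C⊥θM⇐ (∈-dual⁻ u∈)

  Z Z′ : Poly
  Z  = quotient D A D⇒invariant ∈Cθ⇒∈A ∈A⇒∈Cθ
  Z′ = quotient D′ A′ D′⇒invariant D′⇒A′ A′⇒D′

  private
    a b : Fin (q ^ t) → Bool
    a k = does (k Subset.∈? A)
    b k = does (k Subset.∈? A′)

    m : ℕ
    m = card D

    Q M x l : Poly
    Q = q ·ₚ constₚ 1ℝ
    M = m ·ₚ constₚ 1ℝ
    x = difference ⊕ₚ Y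
    l = Q ⊗ₚ Y ⊕ₚ difference

    counts : ∀ S → 𝒫-Weights.Enumerators.count-in σ b (∁ S) * m ≡ q ^ ∣ ∁ S ∣ * 𝒫-Weights.Enumerators.count-in σ a S
    counts S = ≡.trans (cong₂ _*_ (≡.sym (count-∩ A′ (∁ S))) (card≡ D A D⇒invariant ∈Cθ⇒∈A ∈A⇒∈Cθ))
      (≡.trans (shortening A-isSubmodule S) (cong (q ^ ∣ ∁ S ∣ *_) (count-∩ A S)))

    sign : Poly
    sign = (𝒫.- constₚ 1ℝ) ^ᵖ d

    duality : (l ^ᵖ d ⊗ₚ difference ^ᵖ d) ⊗ₚ (M ⊗ₚ enumerator b x Y) ~
      (x ^ᵖ d ⊗ₚ (Q ⊗ₚ Y) ^ᵖ d) ⊗ₚ (sign ⊗ₚ enumerator a l difference)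
    duality = 𝒫-Weights.Enumerators.enumerator-duality σ 𝒫-torsionFree F-harmonic F-homogeneous
      {q} {m} {a} {b} counts difference Y

    ^-⊗ : ∀ P Q → (P ⊗ₚ Q) ^ᵖ d ~ P ^ᵖ d ⊗ₚ Q ^ᵖ d
    ^-⊗ P Q = CommutativeSemiringExp.^-distrib-* 𝒫.commutativeSemiring P Q d

    K-enumerator-b : K ⊗ₚ enumerator b x Y ~ (x ^ᵖ d ⊗ₚ Y ^ᵖ d) ⊗ₚ substitute x Y Z′
    K-enumerator-b = 𝒫.trans (𝒫.sym (W-enumerator D′ A′ D′⇒invariant D′⇒A′ A′⇒D′ x Y))
      (𝒫.trans (W-quotient D′ A′ D′⇒invariant D′⇒A′ A′⇒D′ x Y) (𝒫.*-congʳ (^-⊗ x Y)))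

    K-enumerator-a : K ⊗ₚ enumerator a l difference ~ (l ^ᵖ d ⊗ₚ difference ^ᵖ d) ⊗ₚ substitute l difference Z
    K-enumerator-a = 𝒫.trans (𝒫.sym (W-enumerator D A D⇒invariant ∈Cθ⇒∈A ∈A⇒∈Cθ l difference))
      (𝒫.trans (W-quotient D A D⇒invariant ∈Cθ⇒∈A ∈A⇒∈Cθ l difference) (𝒫.*-congʳ (^-⊗ l difference)))

    open ProductRearrangements 𝒫-commutativeRing

    -- Multiplied by `K`, both enumerators become weight enumerators, divisible by the d-th power of
    -- the product of their two arguments. These powers complete the outer factors of `duality` to
    -- the same four powers on both sides.
    factored : l ^ᵖ d ⊗ₚ (difference ^ᵖ d ⊗ₚ (x ^ᵖ d ⊗ₚ (Y ^ᵖ d ⊗ₚ (M ⊗ₚ substitute x Y Z′)))) ~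
      l ^ᵖ d ⊗ₚ (difference ^ᵖ d ⊗ₚ (x ^ᵖ d ⊗ₚ (Y ^ᵖ d ⊗ₚ (sign ⊗ₚ Q ^ᵖ d ⊗ₚ substitute l difference Z))))
    factored = begin
      l ^ᵖ d ⊗ₚ (difference ^ᵖ d ⊗ₚ (x ^ᵖ d ⊗ₚ (Y ^ᵖ d ⊗ₚ (M ⊗ₚ substitute x Y Z′))))
        ≈⟨ collectˡ _ _ _ _ _ _ ⟨
      (l ^ᵖ d ⊗ₚ difference ^ᵖ d) ⊗ₚ (M ⊗ₚ ((x ^ᵖ d ⊗ₚ Y ^ᵖ d) ⊗ₚ substitute x Y Z′))
        ≈⟨ 𝒫.*-congˡ (𝒫.*-congˡ K-enumerator-b) ⟨
      (l ^ᵖ d ⊗ₚ difference ^ᵖ d) ⊗ₚ (M ⊗ₚ (K ⊗ₚ enumerator b x Y))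
        ≈⟨ pull _ _ _ _ ⟨
      K ⊗ₚ ((l ^ᵖ d ⊗ₚ difference ^ᵖ d) ⊗ₚ (M ⊗ₚ enumerator b x Y))
        ≈⟨ 𝒫.*-congˡ duality ⟩
      K ⊗ₚ ((x ^ᵖ d ⊗ₚ (Q ⊗ₚ Y) ^ᵖ d) ⊗ₚ (sign ⊗ₚ enumerator a l difference))
        ≈⟨ pull _ _ _ _ ⟩
      (x ^ᵖ d ⊗ₚ (Q ⊗ₚ Y) ^ᵖ d) ⊗ₚ (sign ⊗ₚ (K ⊗ₚ enumerator a l difference))
        ≈⟨ 𝒫.*-cong (𝒫.*-congˡ (^-⊗ Q Y)) (𝒫.*-congˡ K-enumerator-a) ⟩
      (x ^ᵖ d ⊗ₚ (Q ^ᵖ d ⊗ₚ Y ^ᵖ d)) ⊗ₚ (sign ⊗ₚ ((l ^ᵖ d ⊗ₚ difference ^ᵖ d) ⊗ₚ substitute l difference Z))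
        ≈⟨ collectʳ _ _ _ _ _ _ _ ⟩
      l ^ᵖ d ⊗ₚ (difference ^ᵖ d ⊗ₚ (x ^ᵖ d ⊗ₚ (Y ^ᵖ d ⊗ₚ (sign ⊗ₚ Q ^ᵖ d ⊗ₚ substitute l difference Z)))) ∎
      where open SetoidReasoning 𝒫.setoid

    cancel-~ : ∀ {L L′ : Poly} → L ~ L′ → (∀ {P Q} → L′ ⊗ₚ P ~ L′ ⊗ₚ Q → P ~ Q) → ∀ {P Q} → L ⊗ₚ P ~ L ⊗ₚ Q → P ~ Q
    cancel-~ L~L′ cancel eq = cancel (𝒫.trans (𝒫.*-congʳ (𝒫.sym L~L′)) (𝒫.trans eq (𝒫.*-congʳ L~L′)))

    X~ : X ~ X ⊕ₚ constₚ 0ℝ ⊗ₚ Y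
    X~ = 𝒫.sym (𝒫.trans (𝒫.+-congˡ (𝒫.trans (𝒫.*-congʳ constₚ-0) (𝒫.zeroˡ Y))) (𝒫.+-identityʳ X))

    cancelled : M ⊗ₚ substitute x Y Z′ ~ sign ⊗ₚ Q ^ᵖ d ⊗ₚ substitute l difference Z
    cancelled =
      -- Read from the innermost call outwards, the factors l, x - y, x and y are cancelled in turn.
      -- The first three are of the form x + cy, with c = q - 1, -1 and 0.
      power-cancel Y-cancel d
        (power-cancel (cancel-~ (𝒫.trans difference+Y X~) (linear-cancel 0ℝ)) d
          (power-cancel (linear-cancel -1ℝ) d
            (power-cancel (cancel-~ (form~ q) (linear-cancel (coefficient q))) d factored)))

    l~substituted : l ~ X +ₚ (constₚ (fraction q 1) -ₚ constₚ 1ℝ) *ₚ Y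
    l~substituted = 𝒫.trans (form~ q) (𝒫.trans
      (𝒫.+-congˡ (𝒫.*-congʳ (𝒫.trans (constₚ-⊞ (fraction q 1) -1ℝ) (𝒫.+-congˡ (𝒫.sym (𝒫.*-identityʳ (constₚ -1ℝ)))))))
      (𝒫.reflexive (≡.sym (form≡ X (constₚ (fraction q 1)) (constₚ 1ℝ) Y))))

    -- The real scalar and the two linear forms stay variables here, so that their
    -- Cauchy sequences are never unfolded.
    module _ (s r : ℝ) (L E : Poly) {k : ℕ} (k≡m : k ≡ m) .{{m-nonZero : ℕ.NonZero m}}
        (s~ : constₚ s ~ constₚ -1ℝ ^ᵖ d) (kr≈q^d : k ·ʳ 1ℝ ⊡ r ≈ʳ (q ^ d) ·ʳ 1ℝ)
        (l~L : l ~ L) (difference~E : difference ~ E) where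

      M-scalar : M ⊗ₚ constₚ (s *ʳ r) ~ sign ⊗ₚ Q ^ᵖ d
      M-scalar = begin
        M ⊗ₚ constₚ (s *ʳ r)
          ≈⟨ 𝒫.*-cong (𝒫.sym (constₚ-·ʳ m)) (𝒫.trans (𝒫.reflexive (cong constₚ (≡.sym (⊡≡ s r)))) (constₚ-⊡ s r)) ⟩
        constₚ (m ·ʳ 1ℝ) ⊗ₚ (constₚ s ⊗ₚ constₚ r)
          ≈⟨ 𝒫.trans (𝒫.sym (𝒫.*-assoc _ _ _)) (𝒫.trans (𝒫.*-congʳ (𝒫.*-comm _ _)) (𝒫.*-assoc _ _ _)) ⟩
        constₚ s ⊗ₚ (constₚ (m ·ʳ 1ℝ) ⊗ₚ constₚ r)
          ≈⟨ 𝒫.*-cong s~ (𝒫.trans (𝒫.sym (constₚ-⊡ (m ·ʳ 1ℝ) r)) (constₚ-cong (subst (λ k → k ·ʳ 1ℝ ⊡ r ≈ʳ (q ^ d) ·ʳ 1ℝ) k≡m kr≈q^d))) ⟩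
        constₚ -1ℝ ^ᵖ d ⊗ₚ constₚ ((q ^ d) ·ʳ 1ℝ)
          ≈⟨ 𝒫.*-cong (SemiringExp.^-congˡ 𝒫.semiring d (𝒫.sym (𝒫.*-identityʳ (constₚ -1ℝ))))
               (𝒫.trans (constₚ-·ʳ (q ^ d)) (𝒫.trans (𝒫-Weights.^-· q d (constₚ 1ℝ)) (𝒫.*-identityʳ _))) ⟩
        sign ⊗ₚ Q ^ᵖ d ∎
        where open SetoidReasoning 𝒫.setoid

      Z′-transform : Z′ ~ constₚ (s *ʳ r) *ₚ Z [ L , E ]
      Z′-transform = 𝒫.trans (·1-cancel m (begin
        M ⊗ₚ Z′
          -- Here `x` stands for (X - Y) + Y, which equals `X`, so this substitution leaves `Z′`
          -- unchanged.
          ≈⟨ 𝒫.*-congˡ (𝒫.trans (substitute-XY Z′) (substitute-cong (𝒫.sym difference+Y) 𝒫.refl Z′)) ⟩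
        M ⊗ₚ substitute x Y Z′
          ≈⟨ cancelled ⟩
        sign ⊗ₚ Q ^ᵖ d ⊗ₚ substitute l difference Z
          ≈⟨ 𝒫.*-cong (𝒫.sym M-scalar) (substitute-cong l~L difference~E Z) ⟩
        M ⊗ₚ constₚ (s *ʳ r) ⊗ₚ substitute L E Z
          ≈⟨ 𝒫.*-assoc _ _ _ ⟩
        M ⊗ₚ (constₚ (s *ʳ r) ⊗ₚ substitute L E Z)
          ≈⟨ 𝒫.*-congˡ (𝒫.*-congˡ (𝒫.sym ([,]~substitute Z L E))) ⟩
        M ⊗ₚ (constₚ (s *ʳ r) ⊗ₚ Z [ L , E ]) ∎))
        (𝒫.reflexive (⊗ₚ≡ (constₚ (s *ʳ r)) (Z [ L , E ])))
        where open SetoidReasoning 𝒫.setoid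

  -- The fraction is a variable for the same reason.
  Z′~ : (r : ℝ) → card (C ⟨θ⟩) ·ʳ 1ℝ ⊡ r ≈ʳ (q ^ d) ·ʳ 1ℝ → .{{nz : ℕ.NonZero (card (C ⟨θ⟩))}} →
    Z′ ~ constₚ (-1ℝ ^ʳ d *ʳ r) *ₚ Z [ X +ₚ (constₚ (fraction q 1) -ₚ constₚ 1ℝ) *ₚ Y , X -ₚ Y ]
  Z′~ r mr≈q^d {{nz}} = Z′-transform (-1ℝ ^ʳ d) r
    (X +ₚ (constₚ (fraction q 1) -ₚ constₚ 1ℝ) *ₚ Y) (X -ₚ Y) {card (C ⟨θ⟩)} refl {{nz}}
    (power-constₚ -1ℝ d) mr≈q^d
    l~substituted (𝒫.reflexive (≡.sym (difference≡ X Y)))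

  Z′≈ : (r : ℝ) → card (C ⟨θ⟩) ·ʳ 1ℝ ⊡ r ≈ʳ (q ^ d) ·ʳ 1ℝ → .{{nz : ℕ.NonZero (card (C ⟨θ⟩))}} →
    Z′ ≈ₚ[x,y] constₚ (-1ℝ ^ʳ d *ʳ r) *ₚ Z [ X +ₚ (constₚ (fraction q 1) -ₚ constₚ 1ℝ) *ₚ Y , X -ₚ Y ]
  Z′≈ r mr≈q^d {{nz}} = ~⇒≈ₚ {Z′}
    {constₚ (-1ℝ ^ʳ d *ʳ r) *ₚ Z [ X +ₚ (constₚ (fraction q 1) -ₚ constₚ 1ℝ) *ₚ Y , X -ₚ Y ]} (Z′~ r mr≈q^d {{nz}})

  W~ : W (C ⟨θ⟩) f ~ (X *ₚ Y) ^ₚ d *ₚ Z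
  W~ = 𝒫.trans (substitute-XY (W D f)) (𝒫.trans (W-quotient D A D⇒invariant ∈Cθ⇒∈A ∈A⇒∈Cθ X Y)
    (𝒫.trans (𝒫.*-congˡ (𝒫.sym (substitute-XY Z))) (power-product~ X Y Z d)))

  W′~ : W (_·M H ((C ^⊥) ⟨θ⟩)) f ~ (X *ₚ Y) ^ₚ d *ₚ Z′
  W′~ = 𝒫.trans (substitute-XY (W D′ f)) (𝒫.trans (W-quotient D′ A′ D′⇒invariant D′⇒A′ A′⇒D′ X Y)
    (𝒫.trans (𝒫.*-congˡ (𝒫.sym (substitute-XY Z′))) (power-product~ X Y Z′ d)))

  Z-homogeneous : Homogeneous (+ t - + (2 * d)) Z
  Z-homogeneous = quotient-homogeneous D A D⇒invariant ∈Cθ⇒∈A ∈A⇒∈Cθ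

  Z′-homogeneous : Homogeneous (+ t - + (2 * d)) Z′
  Z′-homogeneous = quotient-homogeneous D′ A′ D′⇒invariant D′⇒A′ A′⇒D′

  conclusion : (r : ℝ) → card (C ⟨θ⟩) ·ʳ 1ℝ ⊡ r ≈ʳ (q ^ d) ·ʳ 1ℝ → .{{nz : ℕ.NonZero (card (C ⟨θ⟩))}} →
    Σ[ Z ∈ Poly ] Σ[ Z′ ∈ Poly ]
      Homogeneous (+ t - + (2 * d)) Z ×
      Homogeneous (+ t - + (2 * d)) Z′ ×
      W (C ⟨θ⟩) f ≈ₚ[x,y] (X *ₚ Y) ^ₚ d *ₚ Z ×
      W (_·M H ((C ^⊥) ⟨θ⟩)) f ≈ₚ[x,y] (X *ₚ Y) ^ₚ d *ₚ Z′ ×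
      Z′ ≈ₚ[x,y] constₚ (-1ℝ ^ʳ d *ʳ r) *ₚ Z [ X +ₚ (constₚ (fraction q 1) -ₚ constₚ 1ℝ) *ₚ Y , X -ₚ Y ]
  conclusion r mr≈q^d {{nz}} =
    Z , Z′ , Z-homogeneous , Z′-homogeneous , ~⇒≈ₚ W~ , ~⇒≈ₚ W′~ , Z′≈ r mr≈q^d {{nz}}

-- The scalar q^d / |Cθ| appears as any r with |Cθ| r = q^d; this equation is all that the proof
-- extracts from the fraction.
transformation :
    ∀ {c ℓ p} (R : Ring c ℓ) {q : ℕ} (enum : Enumeration R q) →
    Frobenius.IsFrobenius R enum →
    (n : ℕ) (G H : PermutationGroup n) → H ≤ᴳ G →
    (t : ℕ) (orbits : Orbits H t) (∣H∣⁻¹ : Coding.OrderInvertible R enum H) →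
    (d : ℕ) → d ≤ t → (f : ℝ[ t ] d) → Harm t d f →
    (C : Coding.DecSubset R enum n p) (isCode : Coding.IsLeftGCode R enum G C) →
    (r : ℝ) → Coding.card R enum (Coding.Average._⟨θ⟩ R enum H ∣H∣⁻¹ C) ·ʳ 1ℝ ⊡ r ≈ʳ (q ^ d) ·ʳ 1ℝ →
    Σ[ Z ∈ Poly ] Σ[ Z′ ∈ Poly ]
      Homogeneous (+ t - + (2 * d)) Z ×
      Homogeneous (+ t - + (2 * d)) Z′ ×
      Coding.Average.Enumerator.W R enum H ∣H∣⁻¹ orbits (Coding.Average._⟨θ⟩ R enum H ∣H∣⁻¹ C) f ≈ₚ[x,y] (X *ₚ Y) ^ₚ d *ₚ Z ×
      Coding.Average.Enumerator.W R enum H ∣H∣⁻¹ orbits (Coding._·M R enum H (Coding.Average._⟨θ⟩ R enum H ∣H∣⁻¹ (Coding._^⊥ R enum C))) f ≈ₚ[x,y] (X *ₚ Y) ^ₚ d *ₚ Z′ ×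
      Z′ ≈ₚ[x,y] constₚ (-1ℝ ^ʳ d *ʳ r) *ₚ Z [ X +ₚ (constₚ (fraction q 1) -ₚ constₚ 1ℝ) *ₚ Y , X -ₚ Y ]
transformation R {q} enum (_ , left-iso) n G H H≤G t orbits ∣H∣⁻¹ d d≤t f f-harm C isCode r eq =
  DualityProof.conclusion R enum generator G H H⊆G orbits ∣H∣⁻¹ C isCode f f-harm r eq
    {{Coding.Average.⟨θ⟩-nonZero R enum H ∣H∣⁻¹ isCode}}
  where
  H⊆G : ∀ π → PermutationGroup._∈ᴳ H π → PermutationGroup._∈ᴳ G π
  H⊆G π = H≤G {π}
  generator = proj₂ (FiniteRing.socle-generator R enum left-iso)

-- The type refers to the definitions of Coding by their qualified names: the copies
-- made by a local open would have to be unified with them underneath the Cauchy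
-- proofs of the real scalar. The implicit arguments of ⟨θ⟩-nonZero are given for the
-- same reason.
theorem3p6 :
    ∀ {c ℓ p} (R : Ring c ℓ) {q : ℕ} (enum : Enumeration R q) →
    Frobenius.IsFrobenius R enum →
    (n : ℕ) (G H : PermutationGroup n) → H ≤ᴳ G →
    (t : ℕ) (orbits : Orbits H t) (∣H∣⁻¹ : Coding.OrderInvertible R enum H) →
    (d : ℕ) → d ≤ t → (f : ℝ[ t ] d) → Harm t d f →
    (C : Coding.DecSubset R enum n p) (isCode : Coding.IsLeftGCode R enum G C) →
    let D  = Coding.Average._⟨θ⟩ R enum H ∣H∣⁻¹ C
        D′ = Coding._·M R enum H (Coding.Average._⟨θ⟩ R enum H ∣H∣⁻¹ (Coding._^⊥ R enum C)) in
    Σ[ Z ∈ Poly ] Σ[ Z′ ∈ Poly ]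
      Homogeneous (+ t - + (2 * d)) Z ×
      Homogeneous (+ t - + (2 * d)) Z′ ×
      Coding.Average.Enumerator.W R enum H ∣H∣⁻¹ orbits D f ≈ₚ[x,y] (X *ₚ Y) ^ₚ d *ₚ Z ×
      Coding.Average.Enumerator.W R enum H ∣H∣⁻¹ orbits D′ f ≈ₚ[x,y] (X *ₚ Y) ^ₚ d *ₚ Z′ ×
      Z′ ≈ₚ[x,y] constₚ (-1ℝ ^ʳ d *ʳ fraction (q ^ d) (Coding.card R enum D) {{Coding.Average.⟨θ⟩-nonZero R enum H ∣H∣⁻¹ isCode}}) *ₚ Z [ X +ₚ (constₚ (fraction q 1) -ₚ constₚ 1ℝ) *ₚ Y , X -ₚ Y ]
theorem3p6 {p = p} R {q} enum isFrobenius n G H H≤G t orbits ∣H∣⁻¹ d d≤t f f-harm C isCode =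
  transformation R enum isFrobenius n G H (λ {π} → H≤G {π}) t orbits ∣H∣⁻¹ d d≤t f f-harm C isCode
    (fraction (q ^ d) (Coding.card R enum (Coding.Average._⟨θ⟩ R enum H ∣H∣⁻¹ C)) {{Coding.Average.⟨θ⟩-nonZero R enum H ∣H∣⁻¹ {p} {G} {C} isCode}})
    (fraction-cancel (q ^ d) (Coding.card R enum (Coding.Average._⟨θ⟩ R enum H ∣H∣⁻¹ C)) {{Coding.Average.⟨θ⟩-nonZero R enum H ∣H∣⁻¹ {p} {G} {C} isCode}})
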